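{- Let $\Gamma$ be a distance-regular graph with classical parameters $(D,b,\alpha,\beta)$ such that $b\ge 2$ and $D\ge 3$. Let $r=[D]$. If $$\beta \geq \max\left\{\tfrac{2b+4}{2b+3}\,r\,(b+2)(\alpha b+b+\alpha),\ \tfrac{2b+4}{2b+3}\,r\,\big((b+1)(b^2+b+2)-3\big)\right\},$$ then $\Gamma$ is geometric.
   Context: Distance-regular graph with intersection numbers $b_i,c_i$, valency $k=b_0$. For integer $b\ne1$, $[j]=\frac{b^j-1}{b-1}$. Classical parameters $(D,b,\alpha,\beta)$: diameter $D$, $b_i=([D]-[i])(\beta-\alpha[i])$ ($0\le i\le D-1$), $c_i=[i](1+\alpha[i-1])$ ($1\le i\le D$). A Delsarte clique is a clique with $1+\frac{k}{ -\theta_{\min}}$ vertices, $\theta_{\min}$ the smallest adjacency eigenvalue; $\Gamma$ is geometric if there is a set of Delsarte cliques such that every edge lies in exactly one of them. -}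

module Defs where

open import Data.Bool.Base using (if_then_else_)
open import Data.Fin.Base using (Fin)
open import Data.Fin.Properties as Fin using (any?)
open import Data.Fin.Subset using (Subset; _∈_; ∣_∣)
open import Data.Integer.Base as ℤ using (ℤ; +_)
import Data.Integer.Properties as ℤ
open import Data.Nat.Base as ℕ using (ℕ; zero; suc; _∸_)
import Data.Nat.Properties as ℕ
open import Data.Product using (∃; ∃₂; ∃!; ∃-syntax; _×_; _,_; proj₁; proj₂)
open import Data.Rational.Base as ℚ using (ℚ; 0ℚ; 1ℚ; _÷_)
open import Data.Rational.Literals using (fromℤ)
import Data.Rational.Properties as ℚ
open import Data.Rational.Solver using (module +-*-Solver)
open import Data.Sum.Base using (inj₁; inj₂)
import Data.Vec.Base as Vec
open import Data.Vec.Functional as Vector using (Vector)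
open import Function.Base using (_∘_)
open import Level using (0ℓ)
open import Relation.Binary.Core using (Rel)
open import Relation.Binary.Definitions using (Decidable; Irreflexive; Symmetric)
open import Relation.Binary.PropositionalEquality
open import Relation.Nullary.Decidable using (Dec; does; map′; _×-dec_; ¬?)
open import Relation.Nullary.Negation using (¬_)
open import Relation.Unary using (Pred)
import Relation.Unary as Unary

-- Equality of real numbers is the setoid equality _≈_ below, not _≡_.
Cauchy : (ℕ → ℚ) → Set
Cauchy x = ∀ ε → 0ℚ ℚ.< ε →
  ∃[ N ] (∀ m n → N ℕ.≤ m → N ℕ.≤ n → ℚ.∣ x m ℚ.- x n ∣ ℚ.≤ ε)

record ℝ : Set where
  constructor mkℝ
  field
    seq    : ℕ → ℚ
    cauchy : Cauchy seq

open ℝ public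

infix 4 _≈_ _≤_ _≥_

_≈_ : Rel ℝ 0ℓ
x ≈ y = ∀ ε → 0ℚ ℚ.< ε →
  ∃[ N ] (∀ n → N ℕ.≤ n → ℚ.∣ seq x n ℚ.- seq y n ∣ ℚ.≤ ε)

_≤_ : Rel ℝ 0ℓ
x ≤ y = ∀ ε → 0ℚ ℚ.< ε →
  ∃[ N ] (∀ n → N ℕ.≤ n → seq x n ℚ.≤ seq y n ℚ.+ ε)

_≥_ : Rel ℝ 0ℓ
x ≥ y = y ≤ x

private
  module _ where
    open +-*-Solver

    telescope : ∀ p q r s → (p ℚ.+ q) ℚ.- (r ℚ.+ s) ≡ (p ℚ.- r) ℚ.+ (q ℚ.- s)
    telescope = solve 4 (λ p q r s → (p :+ q) :- (r :+ s) := (p :- r) :+ (q :- s)) refl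

    telescope* : ∀ p q r s →
      (p ℚ.* q) ℚ.- (r ℚ.* s) ≡ p ℚ.* (q ℚ.- s) ℚ.+ s ℚ.* (p ℚ.- r)
    telescope* = solve 4 (λ p q r s →
      (p :* q) :- (r :* s) := p :* (q :- s) :+ s :* (p :- r)) refl

    p≡q+[p-q] : ∀ p q → p ≡ q ℚ.+ (p ℚ.- q)
    p≡q+[p-q] = solve 2 (λ p q → p := q :+ (p :- q)) refl

    swap-neg : ∀ p q → p ℚ.- q ≡ ℚ.- (q ℚ.- p)
    swap-neg = solve 2 (λ p q → p :- q := :- (q :- p)) refl

    neg-sub : ∀ p q → (ℚ.- p) ℚ.- (ℚ.- q) ≡ ℚ.- (p ℚ.- q)
    neg-sub = solve 2 (λ p q → (:- p) :- (:- q) := :- (p :- q)) refl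

    cancel : ∀ q d → (q ℚ.+ d) ℚ.- q ≡ d
    cancel = solve 2 (λ q d → (q :+ d) :- q := d) refl

    double : ∀ K δ → K ℚ.* (δ ℚ.+ δ) ≡ δ ℚ.* (K ℚ.+ K)
    double = solve 2 (λ K δ → K :* (δ :+ δ) := δ :* (K :+ K)) refl

    factor : ∀ B C u v → B ℚ.* v ℚ.+ C ℚ.* u ℚ.+ (B ℚ.* u ℚ.+ C ℚ.* v)
           ≡ (B ℚ.+ C) ℚ.* (u ℚ.+ v)
    factor = solve 4 (λ B C u v →
      B :* v :+ C :* u :+ (B :* u :+ C :* v) := (B :+ C) :* (u :+ v)) refl

  0≤∣_∣ : ∀ p → 0ℚ ℚ.≤ ℚ.∣ p ∣
  0≤∣ p ∣ = ℚ.0≤∣p∣ p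

  p≤∣p∣ : ∀ p → p ℚ.≤ ℚ.∣ p ∣
  p≤∣p∣ p with ℚ.≤-total 0ℚ p
  ... | inj₁ 0≤p = ℚ.≤-reflexive (sym (ℚ.0≤p⇒∣p∣≡p 0≤p))
  ... | inj₂ p≤0 = ℚ.≤-trans p≤0 0≤∣ p ∣

  ∣-∣-comm : ∀ p q → ℚ.∣ p ℚ.- q ∣ ≡ ℚ.∣ q ℚ.- p ∣
  ∣-∣-comm p q = trans (cong ℚ.∣_∣ (swap-neg p q)) (ℚ.∣-p∣≡∣p∣ (q ℚ.- p))

  p≤q+∣p-q∣ : ∀ p q → p ℚ.≤ q ℚ.+ ℚ.∣ p ℚ.- q ∣
  p≤q+∣p-q∣ p q = ℚ.≤-trans (ℚ.≤-reflexive (p≡q+[p-q] p q))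
                            (ℚ.+-monoʳ-≤ q (p≤∣p∣ (p ℚ.- q)))

  within : ∀ p q d → p ℚ.≤ q ℚ.+ d → q ℚ.≤ p ℚ.+ d → ℚ.∣ p ℚ.- q ∣ ℚ.≤ d
  within p q d p≤ q≤ with ℚ.∣p∣≡p∨∣p∣≡-p (p ℚ.- q)
  ... | inj₁ eq = subst (ℚ._≤ d) (sym eq)
    (ℚ.≤-trans (ℚ.+-monoˡ-≤ (ℚ.- q) p≤) (ℚ.≤-reflexive (cancel q d)))
  ... | inj₂ eq = subst (ℚ._≤ d) (sym (trans eq (sym (swap-neg q p))))
    (ℚ.≤-trans (ℚ.+-monoˡ-≤ (ℚ.- p) q≤) (ℚ.≤-reflexive (cancel p d)))

  lipschitz⇒cauchy : (f : ℚ → ℚ → ℚ) (x y : ℝ) (K : ℚ) → 0ℚ ℚ.< K → (M : ℕ) →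
    (∀ m n → M ℕ.≤ m → M ℕ.≤ n →
      ℚ.∣ f (seq x m) (seq y m) ℚ.- f (seq x n) (seq y n) ∣ ℚ.≤
      K ℚ.* (ℚ.∣ seq x m ℚ.- seq x n ∣ ℚ.+ ℚ.∣ seq y m ℚ.- seq y n ∣)) →
    Cauchy (λ n → f (seq x n) (seq y n))
  lipschitz⇒cauchy f x y K K>0 M lip ε ε>0 = N , bound
    where
    K+K>0 : 0ℚ ℚ.< K ℚ.+ K
    K+K>0 = ℚ.+-mono-< K>0 K>0
    instance
      _ = ℚ.positive ε>0
      _ = ℚ.positive K>0
      _ = ℚ.positive K+K>0
      _ = ℚ.>-nonZero K+K>0
      _ = ℚ.pos⇒nonNeg K
      _ = ℚ.1/pos⇒pos (K ℚ.+ K)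
      _ = ℚ.pos*pos⇒pos ε (ℚ.1/ (K ℚ.+ K))
    δ = ε ÷ (K ℚ.+ K)
    Nx = cauchy x δ (ℚ.positive⁻¹ δ)
    Ny = cauchy y δ (ℚ.positive⁻¹ δ)
    N = M ℕ.⊔ (proj₁ Nx ℕ.⊔ proj₁ Ny)
    M≤ : ∀ {m} → N ℕ.≤ m → M ℕ.≤ m
    M≤ = ℕ.m⊔n≤o⇒m≤o M _
    x≤ : ∀ {m} → N ℕ.≤ m → proj₁ Nx ℕ.≤ m
    x≤ = ℕ.m⊔n≤o⇒m≤o (proj₁ Nx) (proj₁ Ny) ∘ ℕ.m⊔n≤o⇒n≤o M _
    y≤ : ∀ {m} → N ℕ.≤ m → proj₁ Ny ℕ.≤ m
    y≤ = ℕ.m⊔n≤o⇒n≤o (proj₁ Nx) (proj₁ Ny) ∘ ℕ.m⊔n≤o⇒n≤o M _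
    Kδ : K ℚ.* (δ ℚ.+ δ) ≡ ε
    Kδ = trans (double K δ) (trans (ℚ.*-assoc ε (ℚ.1/ (K ℚ.+ K)) (K ℚ.+ K))
      (trans (cong (ε ℚ.*_) (ℚ.*-inverseˡ (K ℚ.+ K))) (ℚ.*-identityʳ ε)))
    bound : ∀ m n → N ℕ.≤ m → N ℕ.≤ n →
      ℚ.∣ f (seq x m) (seq y m) ℚ.- f (seq x n) (seq y n) ∣ ℚ.≤ ε
    bound m n p q = ℚ.≤-trans (lip m n (M≤ p) (M≤ q)) (ℚ.≤-trans
      (ℚ.*-monoˡ-≤-nonNeg K (ℚ.+-mono-≤ (proj₂ Nx m n (x≤ p) (x≤ q))
                                         (proj₂ Ny m n (y≤ p) (y≤ q))))
      (ℚ.≤-reflexive Kδ))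

  0<1 : 0ℚ ℚ.< 1ℚ
  0<1 = ℚ.positive⁻¹ 1ℚ

  p≤p+q : ∀ p q → 0ℚ ℚ.≤ q → p ℚ.≤ p ℚ.+ q
  p≤p+q p q 0≤q = subst (ℚ._≤ p ℚ.+ q) (ℚ.+-identityʳ p) (ℚ.+-monoʳ-≤ p {0ℚ} {q} 0≤q)

  p≤q+p : ∀ p q → 0ℚ ℚ.≤ q → p ℚ.≤ q ℚ.+ p
  p≤q+p p q 0≤q = subst (p ℚ.≤_) (ℚ.+-comm p q) (p≤p+q p q 0≤q)

  +-lip : ∀ p q r s → ℚ.∣ (p ℚ.+ q) ℚ.- (r ℚ.+ s) ∣ ℚ.≤
                      1ℚ ℚ.* (ℚ.∣ p ℚ.- r ∣ ℚ.+ ℚ.∣ q ℚ.- s ∣)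
  +-lip p q r s = subst₂ ℚ._≤_ (cong ℚ.∣_∣ (sym (telescope p q r s)))
    (sym (ℚ.*-identityˡ (ℚ.∣ p ℚ.- r ∣ ℚ.+ ℚ.∣ q ℚ.- s ∣)))
    (ℚ.∣p+q∣≤∣p∣+∣q∣ (p ℚ.- r) (q ℚ.- s))

  ⊔-bound : ∀ p q r s →
    p ℚ.⊔ q ℚ.≤ (r ℚ.⊔ s) ℚ.+ (ℚ.∣ p ℚ.- r ∣ ℚ.+ ℚ.∣ q ℚ.- s ∣)
  ⊔-bound p q r s = ℚ.⊔-lub {_} {p} {q}
    (ℚ.≤-trans {p} {r ℚ.+ u} (p≤q+∣p-q∣ p r)
      (ℚ.+-mono-≤ {r} {r ℚ.⊔ s} {u} {u ℚ.+ v} (ℚ.p≤p⊔q r s) (p≤p+q u v 0≤∣ q ℚ.- s ∣)))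
    (ℚ.≤-trans {q} {s ℚ.+ v} (p≤q+∣p-q∣ q s)
      (ℚ.+-mono-≤ {s} {r ℚ.⊔ s} {v} {u ℚ.+ v} (ℚ.p≤q⊔p r s) (p≤q+p v u 0≤∣ p ℚ.- r ∣)))
    where
    u = ℚ.∣ p ℚ.- r ∣
    v = ℚ.∣ q ℚ.- s ∣

  ⊔-lip : ∀ p q r s → ℚ.∣ (p ℚ.⊔ q) ℚ.- (r ℚ.⊔ s) ∣ ℚ.≤
                      1ℚ ℚ.* (ℚ.∣ p ℚ.- r ∣ ℚ.+ ℚ.∣ q ℚ.- s ∣)
  ⊔-lip p q r s = subst (ℚ.∣ (p ℚ.⊔ q) ℚ.- (r ℚ.⊔ s) ∣ ℚ.≤_) (sym (ℚ.*-identityˡ d))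
    (within (p ℚ.⊔ q) (r ℚ.⊔ s) d (⊔-bound p q r s)
      (subst (λ d → r ℚ.⊔ s ℚ.≤ (p ℚ.⊔ q) ℚ.+ d)
        (cong₂ ℚ._+_ (∣-∣-comm r p) (∣-∣-comm s q)) (⊔-bound r s p q)))
    where
    d = ℚ.∣ p ℚ.- r ∣ ℚ.+ ℚ.∣ q ℚ.- s ∣

  eventually-bounded : ∀ x →
    ∃₂ λ B N → 0ℚ ℚ.< B × (∀ n → N ℕ.≤ n → ℚ.∣ seq x n ∣ ℚ.≤ B)
  eventually-bounded x with cauchy x 1ℚ 0<1
  ... | N , close = ℚ.∣ seq x N ∣ ℚ.+ 1ℚ , N
      , ℚ.+-mono-≤-< 0≤∣ seq x N ∣ 0<1
      , λ n N≤n → ℚ.≤-trans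
          (ℚ.≤-trans (ℚ.≤-reflexive (cong ℚ.∣_∣ (p≡q+[p-q] (seq x n) (seq x N))))
                     (ℚ.∣p+q∣≤∣p∣+∣q∣ (seq x N) (seq x n ℚ.- seq x N)))
          (ℚ.+-monoʳ-≤ ℚ.∣ seq x N ∣ (close n N N≤n ℕ.≤-refl))

  *-lip : ∀ B C → 0ℚ ℚ.< B → 0ℚ ℚ.< C → ∀ p q r s →
    ℚ.∣ p ∣ ℚ.≤ B → ℚ.∣ s ∣ ℚ.≤ C →
    ℚ.∣ (p ℚ.* q) ℚ.- (r ℚ.* s) ∣ ℚ.≤
    (B ℚ.+ C) ℚ.* (ℚ.∣ p ℚ.- r ∣ ℚ.+ ℚ.∣ q ℚ.- s ∣)
  *-lip B C B>0 C>0 p q r s p≤B s≤C = begin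
    ℚ.∣ (p ℚ.* q) ℚ.- (r ℚ.* s) ∣
      ≡⟨ cong ℚ.∣_∣ (telescope* p q r s) ⟩
    ℚ.∣ p ℚ.* (q ℚ.- s) ℚ.+ s ℚ.* (p ℚ.- r) ∣
      ≤⟨ ℚ.∣p+q∣≤∣p∣+∣q∣ (p ℚ.* (q ℚ.- s)) (s ℚ.* (p ℚ.- r)) ⟩
    ℚ.∣ p ℚ.* (q ℚ.- s) ∣ ℚ.+ ℚ.∣ s ℚ.* (p ℚ.- r) ∣
      ≡⟨ cong₂ ℚ._+_ (ℚ.∣p*q∣≡∣p∣*∣q∣ p (q ℚ.- s)) (ℚ.∣p*q∣≡∣p∣*∣q∣ s (p ℚ.- r)) ⟩
    ℚ.∣ p ∣ ℚ.* v ℚ.+ ℚ.∣ s ∣ ℚ.* u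
      ≤⟨ ℚ.+-mono-≤ (ℚ.*-monoʳ-≤-nonNeg v {ℚ.∣ p ∣} {B} p≤B)
                      (ℚ.*-monoʳ-≤-nonNeg u {ℚ.∣ s ∣} {C} s≤C) ⟩
    B ℚ.* v ℚ.+ C ℚ.* u
      ≤⟨ p≤p+q (B ℚ.* v ℚ.+ C ℚ.* u) (B ℚ.* u ℚ.+ C ℚ.* v) rest ⟩
    B ℚ.* v ℚ.+ C ℚ.* u ℚ.+ (B ℚ.* u ℚ.+ C ℚ.* v)
      ≡⟨ factor B C u v ⟩
    (B ℚ.+ C) ℚ.* (u ℚ.+ v) ∎
    where
    open ℚ.≤-Reasoning
    u = ℚ.∣ p ℚ.- r ∣
    v = ℚ.∣ q ℚ.- s ∣
    instance
      u≥0 : ℚ.NonNegative u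
      u≥0 = ℚ.nonNegative {u} 0≤∣ p ℚ.- r ∣
      v≥0 : ℚ.NonNegative v
      v≥0 = ℚ.nonNegative {v} 0≤∣ q ℚ.- s ∣
    0≤-* : ∀ a w → 0ℚ ℚ.< a → .{{ℚ.NonNegative w}} → 0ℚ ℚ.≤ a ℚ.* w
    0≤-* a w a>0 = subst (ℚ._≤ a ℚ.* w) (ℚ.*-zeroˡ w)
      (ℚ.*-monoʳ-≤-nonNeg w {0ℚ} {a} (ℚ.<⇒≤ a>0))
    rest : 0ℚ ℚ.≤ B ℚ.* u ℚ.+ C ℚ.* v
    rest = ℚ.≤-trans (0≤-* B u B>0) (p≤p+q (B ℚ.* u) (C ℚ.* v) (0≤-* C v C>0))

infix  8 -_
infixl 7 _*_
infixl 6 _+_ _-_ _⊔_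

_+_ : ℝ → ℝ → ℝ
x + y = mkℝ (λ n → seq x n ℚ.+ seq y n)
  (lipschitz⇒cauchy ℚ._+_ x y 1ℚ 0<1 0 λ m n _ _ →
    +-lip (seq x m) (seq y m) (seq x n) (seq y n))

_*_ : ℝ → ℝ → ℝ
x * y = mkℝ (λ n → seq x n ℚ.* seq y n)
  (let B , M , B>0 , x≤B = eventually-bounded x
       C , N , C>0 , y≤C = eventually-bounded y
   in lipschitz⇒cauchy ℚ._*_ x y (B ℚ.+ C) (ℚ.+-mono-< {0ℚ} {B} {0ℚ} {C} B>0 C>0) (M ℕ.⊔ N)
        λ m n p q → *-lip B C B>0 C>0 (seq x m) (seq y m) (seq x n) (seq y n)
          (x≤B m (ℕ.m⊔n≤o⇒m≤o M N p)) (y≤C n (ℕ.m⊔n≤o⇒n≤o M N q)))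

-_ : ℝ → ℝ
- x = mkℝ (λ n → ℚ.- seq x n) λ ε ε>0 →
  let N , close = cauchy x ε ε>0 in
  N , λ m n p q → subst (ℚ._≤ ε)
    (sym (trans (cong ℚ.∣_∣ (neg-sub (seq x m) (seq x n)))
                (ℚ.∣-p∣≡∣p∣ (seq x m ℚ.- seq x n))))
    (close m n p q)

_-_ : ℝ → ℝ → ℝ
x - y = x + (- y)

_⊔_ : ℝ → ℝ → ℝ
x ⊔ y = mkℝ (λ n → seq x n ℚ.⊔ seq y n)
  (lipschitz⇒cauchy ℚ._⊔_ x y 1ℚ 0<1 0 λ m n _ _ →
    ⊔-lip (seq x m) (seq y m) (seq x n) (seq y n))

ℚ⇒ℝ : ℚ → ℝ
ℚ⇒ℝ q = mkℝ (λ _ → q) λ ε ε>0 →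
  0 , λ _ _ _ _ → subst (ℚ._≤ ε) (sym (cong ℚ.∣_∣ (ℚ.+-inverseʳ q))) (ℚ.<⇒≤ ε>0)

ℤ⇒ℝ : ℤ → ℝ
ℤ⇒ℝ i = ℚ⇒ℝ (fromℤ i)

ℕ⇒ℝ : ℕ → ℝ
ℕ⇒ℝ n = ℤ⇒ℝ (+ n)

0ℝ : ℝ
0ℝ = ℕ⇒ℝ 0

1ℝ : ℝ
1ℝ = ℕ⇒ℝ 1

∑ : ∀ {n} → Vector ℝ n → ℝ
∑ = Vector.foldr _+_ 0ℝ

record Graph : Set₁ where
  infix 4 _~_
  field
    order  : ℕ
    _~_    : Rel (Fin order) 0ℓ
    _~?_   : Decidable _~_
    irrefl : Irreflexive _≡_ _~_
    ~-sym  : Symmetric _~_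

  Vertex : Set
  Vertex = Fin order

  #_ : {P : Pred Vertex 0ℓ} → Unary.Decidable P → ℕ
  # P? = Vec.count P? (Vec.allFin order)

  data Walk : ℕ → Rel Vertex 0ℓ where
    []  : ∀ {x} → Walk 0 x x
    _∷_ : ∀ {ℓ x y z} → x ~ y → Walk ℓ y z → Walk (suc ℓ) x z

  walk? : ∀ ℓ → Decidable (Walk ℓ)
  walk? zero    x z = map′ (λ { refl → [] }) (λ { [] → refl }) (x Fin.≟ z)
  walk? (suc ℓ) x z = map′ (λ (y , e , w) → e ∷ w) (λ { (e ∷ w) → _ , e , w })
                               (any? λ y → (x ~? y) ×-dec walk? ℓ y z)

  Connected : Set
  Connected = ∀ x y → ∃[ ℓ ] Walk ℓ x y

  Distance : Vertex → Vertex → ℕ → Set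
  Distance x y d = Walk d x y × (∀ {ℓ} → ℓ ℕ.< d → ¬ Walk ℓ x y)

  distance? : ∀ x y d → Dec (Distance x y d)
  distance? x y d = walk? d x y ×-dec ℕ.allUpTo? (λ ℓ → ¬? (walk? ℓ x y)) d

  HasDiameter : ℕ → Set
  HasDiameter D = (∀ {x y d} → Distance x y d → d ℕ.≤ D)
                × (∃₂ λ x y → Distance x y D)

  adjacency : Vertex → Vertex → ℝ
  adjacency x y = if does (x ~? y) then 1ℝ else 0ℝ

  IsEigenvalue : ℝ → Set
  IsEigenvalue θ = ∃ λ (v : Vector ℝ order) →
      ¬ (∀ x → v x ≈ 0ℝ)
    × (∀ x → ∑ (λ y → adjacency x y * v y) ≈ θ * v x)

  -- The adjacency matrix is symmetric, so all its eigenvalues are real.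
  IsSmallestEigenvalue : ℝ → Set
  IsSmallestEigenvalue θ = IsEigenvalue θ × (∀ θ′ → IsEigenvalue θ′ → θ ≤ θ′)

  IsClique : Subset order → Set
  IsClique C = ∀ {x y} → x ∈ C → y ∈ C → x ≢ y → x ~ y

-- The numbers bᵢ with 0 ≤ i < D and cᵢ with 1 ≤ i ≤ D are the intersection
-- numbers; the remaining values of the two functions carry no meaning.
record DistanceRegularGraph : Set₁ where
  field
    graph : Graph

  open Graph graph public

  field
    diameter    : ℕ
    bᵢ cᵢ       : ℕ → ℕ
    connected   : Connected
    hasDiameter : HasDiameter diameter
    b-regular   : ∀ {i x y} → i ℕ.< diameter → Distance x y i →
                  # (λ z → (y ~? z) ×-dec distance? x z (suc i)) ≡ bᵢ i
    c-regular   : ∀ {i x y} → Distance x y (suc i) →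
                  # (λ z → (y ~? z) ×-dec distance? x z i) ≡ cᵢ (suc i)

  valency : ℕ
  valency = bᵢ 0

  -- ∣C∣ = 1 + k / (- θ), multiplied out: θ < 0 as soon as there is an edge.
  IsDelsarteClique : Subset order → Set
  IsDelsarteClique C = IsClique C × ∃ λ θ →
    IsSmallestEigenvalue θ × (ℕ⇒ℝ ∣ C ∣ - 1ℝ) * (- θ) ≈ ℕ⇒ℝ valency

  IsGeometric : Set₁
  IsGeometric = ∃ λ (𝒞 : Pred (Subset order) 0ℓ) →
      (∀ {C} → 𝒞 C → IsDelsarteClique C)
    × (∀ {x y} → x ~ y → ∃! _≡_ λ C → 𝒞 C × x ∈ C × y ∈ C)

module _ (b : ℤ) .{{_ : ℤ.NonZero (b ℤ.- + 1)}} where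

  gauss : ℕ → ℝ
  gauss j = ℚ⇒ℝ (fromℤ (b ℤ.^ j ℤ.- + 1) ÷ fromℤ (b ℤ.- + 1))

  record HasClassicalParameters (Γ : DistanceRegularGraph)
                                (D : ℕ) (α β : ℝ) : Set where
    open DistanceRegularGraph Γ
    field
      diameter≡D : diameter ≡ D
      b-formula  : ∀ i → i ℕ.< D →
        ℕ⇒ℝ (bᵢ i) ≈ (gauss D - gauss i) * (β - α * gauss i)
      c-formula  : ∀ i → 1 ℕ.≤ i → i ℕ.≤ D →
        ℕ⇒ℝ (cᵢ i) ≈ gauss i * (1ℝ + α * gauss (i ∸ 1))

2b+3-nonZero : ∀ b → ℤ.NonZero (+ 2 ℤ.* b ℤ.+ + 3)
2b+3-nonZero b = ℤ.≢-nonZero {+ 2 ℤ.* b ℤ.+ + 3} λ 2b+3≡0 → 2m≢3 ℤ.∣ b ∣ (begin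
  2 ℕ.* ℤ.∣ b ∣                         ≡⟨ ℤ.abs-* (+ 2) b ⟨
  ℤ.∣ + 2 ℤ.* b ∣                       ≡⟨ cong ℤ.∣_∣ (x≡[x+3]-3 (+ 2 ℤ.* b)) ⟩
  ℤ.∣ (+ 2 ℤ.* b ℤ.+ + 3) ℤ.- + 3 ∣     ≡⟨ cong (λ i → ℤ.∣ i ℤ.- + 3 ∣) 2b+3≡0 ⟩
  3                                     ∎)
  where
  open ≡-Reasoning
  x≡[x+3]-3 : ∀ x → x ≡ (x ℤ.+ + 3) ℤ.- + 3
  x≡[x+3]-3 x = sym (trans (ℤ.+-assoc x (+ 3) (ℤ.- + 3)) (ℤ.+-identityʳ x))
  2m≢3 : ∀ m → 2 ℕ.* m ≢ 3
  2m≢3 (suc (suc m)) eq with trans (sym (ℕ.*-distribˡ-+ 2 2 m)) eq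
  ... | ()

[2b+4]/[2b+3] : ℤ → ℝ
[2b+4]/[2b+3] b = ℚ⇒ℝ (fromℤ (+ 2 ℤ.* b ℤ.+ + 4) ÷ fromℤ (+ 2 ℤ.* b ℤ.+ + 3))
  where instance _ = 2b+3-nonZero b

{-# OPTIONS --safe #-}

-- Write r = [D], so that k = r β; the hypotheses give β ≥ 4 r (c₂ - 1) and β ≥ 21 r. As
-- k = r β and c₂ = (b + 1)(1 + α), the parameters α and β are rational, and one works over ℚ.
--
-- Given an edge xy, count the paths y z w with z, w adjacent to x and w not adjacent to y:
-- since c₂ is small, the common neighbours z of x and y have few non-neighbours among
-- themselves on average. So all but at most β/6 of them form a clique with x and y, which
-- has more than 11β/14 vertices, and these cliques ("lines") partition the edges.
--
-- Let ω be the cosine sequence of -r, and Z the matrix with entries ω (d x y). Then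
-- A Z = - r Z and Z² = c Z with 1 ≤ c ≤ 2. As Z is positive semidefinite, a line has at most
-- β + 1 vertices, with equality iff the rows of Z on the line have sum 0; call the other lines
-- short. For x on t lines, the sums over these lines add up to t - r times the row of x.
-- Hence a vertex with t ≠ r has its row in the span of the sums over the short lines, and by
-- Bessel's inequality there are at most c times as many such vertices as short lines. But
-- all the (many) vertices of a short line are of this kind, each on at most 14r/11 lines, so
-- there is no short line. Finally every vertex is on r lines, so A + r I is the Gram
-- matrix of the incidence and -r, with the columns of Z as eigenvectors, is the smallest
-- eigenvalue: the lines are Delsarte cliques.

module Submission where

open import Algebra.Bundles using (CommutativeRing)
import Algebra.Properties.Semiring.Sum as SemiringSum
open import Data.Bool.Base using (Bool; true; false; _∧_; _∨_; not; if_then_else_)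
open import Data.Bool.Properties as Bool using (∧-comm)
open import Data.Empty using (⊥; ⊥-elim)
open import Data.Fin.Base using (Fin; zero; suc; toℕ)
import Data.Fin.Properties as Fin
import Data.Fin.Subset as Subset
open Subset using (Subset; inside)
open import Data.Integer.Base as ℤ using (ℤ; +_)
import Data.Integer.Properties as ℤ
open import Data.List.Base as List using (List; []; _∷_; concatMap; allFin; deduplicate)
open import Data.List.Membership.Propositional using (_∈_)
import Data.List.Membership.Propositional.Properties as List
open import Data.List.Relation.Unary.All as All using ()
open import Data.List.Relation.Unary.AllPairs using (_∷_)
open import Data.List.Relation.Unary.Any as Any using (here)
import Data.List.Relation.Unary.Any.Properties as Any
import Data.List.Relation.Unary.Unique.DecPropositional.Properties as Unique
open import Data.List.Relation.Unary.Unique.Propositional using (Unique)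
open import Data.Nat.Base as ℕ using (ℕ; zero; suc; pred)
import Data.Nat.Properties as ℕ
open import Data.Product using (_×_; _,_; proj₁; proj₂; ∃; ∃-syntax; ∃!)
open import Data.Rational.Literals using (fromℤ)
open import Data.Rational.Solver using (module +-*-Solver)
import Data.Rational.Unnormalised.Base as ℚᵘ
import Data.Rational.Unnormalised.Properties as ℚᵘ
open import Data.Sum.Base using (_⊎_; inj₁; inj₂)
import Data.Vec.Base as Vec
import Data.Vec.Functional as Vector
import Data.Vec.Properties as Vec
open import Function.Base using (_∘_; case_of_)
open import Relation.Binary.Definitions using (tri<; tri≈; tri>)
open import Relation.Binary.PropositionalEquality
open import Relation.Nullary.Decidable using (Dec; yes; no; does; dec-true; dec-false; True; toWitness; _×-dec_)
open import Relation.Nullary.Negation using (¬_; contradiction)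
import Defs

-- Counting alone yields cliques of size about `β`, whereas a Delsarte clique must satisfy an exact
-- equation, so the missing vertices of a line have to be forced to zero. The bound of Delsarte
-- cannot be quoted for this: it concerns the smallest eigenvalue, and that `-r` is the smallest one
-- is known only after the lines are full. The relation `Z² = c Z` replaces it, since it makes `Z`
-- positive semidefinite without any information on the other eigenvalues. What makes the last count
-- contradictory is that `c` is the number of vertices divided by the multiplicity of `-r`, a number
-- that the classical parameters keep below 2. With `S` short lines and `X` vertices on more than
-- `r` lines, incidences give `121 β S ≤ 196 r X`, Bessel gives `X ≤ 2 S`, and `β ≥ 21 r` leaves a
-- factor above six between the two sides. Reals are Cauchy sequences without decidable order. An
-- arbitrary eigenvalue of the graph is such a real, so at the end it is compared with `-r` through
-- rational approximate eigenvectors.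

module Geometricity where

  open import Data.Rational.Base using (ℚ; 0ℚ; 1ℚ; _+_; _*_; _-_; -_; _≤_; _<_; _÷_; 1/_; ∣_∣; NonZero; ≢-nonZero; nonNegative; positive)
  open import Data.Rational.Properties as ℚ using (≤-trans; ≤-refl; ≤-reflexive; ≤-antisym; <⇒≤; <-≤-trans; ≤-<-trans; <-irrefl)
  open Defs using (DistanceRegularGraph; ℝ; seq; cauchy; ℚ⇒ℝ; ℕ⇒ℝ; ℤ⇒ℝ; 0ℝ; 1ℝ; _≈_; gauss; [2b+4]/[2b+3]; 2b+3-nonZero)
  open +-*-Solver

  -- Ordered field arithmetic and finite sums

  ι : ℕ → ℚ
  ι n = fromℤ (+ n)

  -- The pattern of most inequalities below: `e` is a combination of products of terms known to be
  -- nonnegative, and the ring solver checks the identity. Multiplying through by an integer first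
  -- clears the denominators.
  ≤-by : ∀ {a b e} → 0ℚ ≤ e → b ≡ a + e → a ≤ b
  ≤-by {a} {b} {e} e≥0 refl = subst (_≤ a + e) (ℚ.+-identityʳ a) (ℚ.+-monoʳ-≤ a e≥0)

  <-by : ∀ {a b e} → 0ℚ < e → b ≡ a + e → a < b
  <-by {a} {b} {e} e>0 refl = subst (_< a + e) (ℚ.+-identityʳ a) (ℚ.+-monoʳ-< a e>0)

  diff≥0 : ∀ {a b} → a ≤ b → 0ℚ ≤ b - a
  diff≥0 {a} {b} a≤b = subst (_≤ b - a) (ℚ.+-inverseʳ a) (ℚ.+-monoˡ-≤ (- a) a≤b)

  diff>0 : ∀ {a b} → a < b → 0ℚ < b - a
  diff>0 {a} {b} a<b = subst (_< b - a) (ℚ.+-inverseʳ a) (ℚ.+-monoˡ-< (- a) a<b)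

  infixl 6 _⊕_
  infixl 7 _⊛_

  _⊕_ : ∀ {a b} → 0ℚ ≤ a → 0ℚ ≤ b → 0ℚ ≤ a + b
  _⊕_ = ℚ.+-mono-≤

  _⊛_ : ∀ {a b} → 0ℚ ≤ a → 0ℚ ≤ b → 0ℚ ≤ a * b
  _⊛_ {a} {b} a≥0 b≥0 = subst (_≤ a * b) (ℚ.*-zeroʳ a)
    (ℚ.*-monoˡ-≤-nonNeg a {{nonNegative a≥0}} b≥0)

  0<* : ∀ {a b} → 0ℚ < a → 0ℚ < b → 0ℚ < a * b
  0<* {a} {b} a>0 b>0 = subst (_< a * b) (ℚ.*-zeroʳ a)
    (ℚ.*-monoʳ-<-pos a {{positive a>0}} b>0)

  ι≥0 : ∀ n → 0ℚ ≤ ι n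
  ι≥0 zero    = ≤-refl
  ι≥0 (suc n) = ℚ.nonNegative⁻¹ (ι (suc n))

  ι>0 : ∀ n → 0ℚ < ι (suc n)
  ι>0 n = ℚ.positive⁻¹ (ι (suc n))

  neg≥0 : ∀ {a} → a ≤ 0ℚ → 0ℚ ≤ - a
  neg≥0 = ℚ.neg-antimono-≤

  sq≥0 : ∀ a → 0ℚ ≤ a * a
  sq≥0 a with ℚ.≤-total 0ℚ a
  ... | inj₁ a≥0 = a≥0 ⊛ a≥0
  ... | inj₂ a≤0 = subst (0ℚ ≤_) (solve 1 (λ a → (:- a) :* (:- a) := a :* a) refl a)
    (neg≥0 a≤0 ⊛ neg≥0 a≤0)

  sq≡0 : ∀ {a} → a * a ≡ 0ℚ → a ≡ 0ℚ
  sq≡0 {a} a²≡0 with ℚ.<-cmp a 0ℚ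
  ... | tri≈ _ a≡0 _ = a≡0
  ... | tri> _ _ a>0 = contradiction (0<* a>0 a>0) (<-irrefl (sym a²≡0))
  ... | tri< a<0 _ _ = contradiction
    (0<* (ℚ.neg-antimono-< a<0) (ℚ.neg-antimono-< a<0))
    (<-irrefl (sym (trans (solve 1 (λ a → (:- a) :* (:- a) := a :* a) refl a) a²≡0)))

  *-mono-≤ˡ : ∀ {c a b} → 0ℚ ≤ c → a ≤ b → c * a ≤ c * b
  *-mono-≤ˡ {c} c≥0 = ℚ.*-monoˡ-≤-nonNeg c {{nonNegative c≥0}}

  ≥∧≢⇒> : ∀ {a} → 0ℚ ≤ a → a ≢ 0ℚ → 0ℚ < a
  ≥∧≢⇒> {a} a≥0 a≢0 with ℚ.<-cmp 0ℚ a
  ... | tri< a>0 _ _ = a>0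
  ... | tri≈ _ 0≡a _ = contradiction (sym 0≡a) a≢0
  ... | tri> _ _ a<0 = contradiction (≤-<-trans a≥0 a<0) (<-irrefl refl)

  *-cancel-≤ : ∀ {c a b} → 0ℚ < c → c * a ≤ c * b → a ≤ b
  *-cancel-≤ {c} c>0 = ℚ.*-cancelˡ-≤-pos c {{positive c>0}}

  >⇒≢0 : ∀ {a} → 0ℚ < a → a ≢ 0ℚ
  >⇒≢0 a>0 a≡0 = <-irrefl (sym a≡0) a>0

  ≤⇒≯ : ∀ {a b} → a ≤ b → ¬ (b < a)
  ≤⇒≯ a≤b b<a = <-irrefl refl (≤-<-trans a≤b b<a)

  infix 8 _⁻¹

  opaque
    -- Total, with value 0 at 0: the inverse of `t x - r` can then stand in formulas where an
    -- indicator removes the vertices at which the denominator vanishes.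
    _⁻¹ : ℚ → ℚ
    a ⁻¹ with a ℚ.≟ 0ℚ
    ... | yes _  = 0ℚ
    ... | no a≢0 = 1/_ a {{≢-nonZero a≢0}}

    *-inverseʳ : ∀ {a} → a ≢ 0ℚ → a * a ⁻¹ ≡ 1ℚ
    *-inverseʳ {a} a≢0 with a ℚ.≟ 0ℚ
    ... | yes a≡0 = contradiction a≡0 a≢0
    ... | no _    = ℚ.*-inverseʳ a {{≢-nonZero a≢0}}

  *-cancel-≡ : ∀ {c a b} → c ≢ 0ℚ → c * a ≡ c * b → a ≡ b
  *-cancel-≡ {c} {a} {b} c≢0 ca≡cb = begin
    a                 ≡⟨ ℚ.*-identityˡ a ⟨
    1ℚ * a            ≡⟨ cong (_* a) (*-inverseʳ c≢0) ⟨
    c * c ⁻¹ * a      ≡⟨ solve 3 (λ c d a → c :* d :* a := d :* (c :* a)) refl c (c ⁻¹) a ⟩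
    c ⁻¹ * (c * a)    ≡⟨ cong (c ⁻¹ *_) ca≡cb ⟩
    c ⁻¹ * (c * b)    ≡⟨ solve 3 (λ c d a → d :* (c :* a) := c :* d :* a) refl c (c ⁻¹) b ⟩
    c * c ⁻¹ * b      ≡⟨ cong (_* b) (*-inverseʳ c≢0) ⟩
    1ℚ * b            ≡⟨ ℚ.*-identityˡ b ⟩
    b                 ∎
    where open ≡-Reasoning

  ⁻¹>0 : ∀ {a} → 0ℚ < a → 0ℚ < a ⁻¹
  ⁻¹>0 {a} a>0 = ℚ.*-cancelˡ-<-nonNeg a {{nonNegative (<⇒≤ a>0)}}
    (subst₂ _<_ (sym (ℚ.*-zeroʳ a)) (sym (*-inverseʳ (>⇒≢0 a>0))) (ℚ.positive⁻¹ 1ℚ))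

  decide-≤ : ∀ {a b} {_ : True (a ℚ.≤? b)} → a ≤ b
  decide-≤ {_} {_} {a≤b} = toWitness a≤b

  fromℤ-+ : ∀ i j → fromℤ (i ℤ.+ j) ≡ fromℤ i + fromℤ j
  fromℤ-+ i j = ℚ.toℚᵘ-injective (ℚᵘ.≃-trans
    (ℚᵘ.*≡* (cong (ℤ._* + 1) (sym (cong₂ ℤ._+_ (ℤ.*-identityʳ i) (ℤ.*-identityʳ j)))))
    (ℚᵘ.≃-sym (ℚ.toℚᵘ-homo-+ (fromℤ i) (fromℤ j))))

  fromℤ-* : ∀ i j → fromℤ (i ℤ.* j) ≡ fromℤ i * fromℤ j
  fromℤ-* i j = ℚ.toℚᵘ-injective (ℚᵘ.≃-sym (ℚ.toℚᵘ-homo-* (fromℤ i) (fromℤ j)))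

  fromℤ-mono : ∀ {i j} → i ℤ.≤ j → fromℤ i ≤ fromℤ j
  fromℤ-mono {i} {j} i≤j = ℚ.toℚᵘ-cancel-≤ (ℚᵘ.*≤*
    (subst₂ ℤ._≤_ (sym (ℤ.*-identityʳ i)) (sym (ℤ.*-identityʳ j)) i≤j))

  ι-suc : ∀ n → ι (suc n) ≡ 1ℚ + ι n
  ι-suc n = fromℤ-+ (+ 1) (+ n)

  private variable
    m n : ℕ

  ∑ : (Fin n → ℚ) → ℚ
  ∑ = Vector.foldr _+_ 0ℚ

  private module Sum = SemiringSum (CommutativeRing.semiring ℚ.+-*-commutativeRing)

  ∑-cong : {f g : Fin n → ℚ} → (∀ i → f i ≡ g i) → ∑ f ≡ ∑ g
  ∑-cong = Sum.sum-cong-≗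

  ∑-+ : (f g : Fin n → ℚ) → ∑ (λ i → f i + g i) ≡ ∑ f + ∑ g
  ∑-+ = Sum.∑-distrib-+

  ∑-* : ∀ c (f : Fin n → ℚ) → ∑ (λ i → c * f i) ≡ c * ∑ f
  ∑-* c f = sym (Sum.*-distribˡ-sum c f)

  ∑-*ʳ : ∀ (f : Fin n → ℚ) c → ∑ (λ i → f i * c) ≡ ∑ f * c
  ∑-*ʳ f c = sym (Sum.*-distribʳ-sum c f)

  ∑-swap : (f : Fin m → Fin n → ℚ) → ∑ (λ i → ∑ (f i)) ≡ ∑ (λ j → ∑ (λ i → f i j))
  ∑-swap = Sum.∑-comm

  ∑-- : (f g : Fin n → ℚ) → ∑ (λ i → f i - g i) ≡ ∑ f - ∑ g
  ∑-- f g = begin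
    ∑ (λ i → f i - g i)         ≡⟨ ∑-cong (λ i → solve 2 (λ a b → a :- b := a :+ con (- 1ℚ) :* b) refl (f i) (g i)) ⟩
    ∑ (λ i → f i + - 1ℚ * g i)  ≡⟨ ∑-+ f (λ i → - 1ℚ * g i) ⟩
    ∑ f + ∑ (λ i → - 1ℚ * g i)  ≡⟨ cong (_+_ (∑ f)) (∑-* (- 1ℚ) g) ⟩
    ∑ f + - 1ℚ * ∑ g            ≡⟨ solve 2 (λ a b → a :- b := a :+ con (- 1ℚ) :* b) refl (∑ f) (∑ g) ⟨
    ∑ f - ∑ g                   ∎
    where open ≡-Reasoning

  ∑-0 : ∀ n → ∑ {n} (λ _ → 0ℚ) ≡ 0ℚ
  ∑-0 n = Sum.sum-replicate-zero n

  ∑-mono : {f g : Fin n → ℚ} → (∀ i → f i ≤ g i) → ∑ f ≤ ∑ g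
  ∑-mono {zero}  f≤g = ≤-refl
  ∑-mono {suc n} f≤g = ℚ.+-mono-≤ (f≤g zero) (∑-mono (f≤g ∘ suc))

  ∑≥0 : {f : Fin n → ℚ} → (∀ i → 0ℚ ≤ f i) → 0ℚ ≤ ∑ f
  ∑≥0 {n} {f} f≥0 = subst (_≤ ∑ f) (∑-0 n) (∑-mono f≥0)

  term≤∑ : {f : Fin n → ℚ} → (∀ i → 0ℚ ≤ f i) → ∀ i → f i ≤ ∑ f
  term≤∑ {f = f} f≥0 zero    = ≤-by (∑≥0 (f≥0 ∘ suc)) refl
  term≤∑ {f = f} f≥0 (suc i) = ≤-trans (term≤∑ (f≥0 ∘ suc) i)
    (≤-by (f≥0 zero) (ℚ.+-comm (f zero) (∑ (f ∘ suc))))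

  ∑≡0⇒≡0 : {f : Fin n → ℚ} → (∀ i → 0ℚ ≤ f i) → ∑ f ≡ 0ℚ → ∀ i → f i ≡ 0ℚ
  ∑≡0⇒≡0 f≥0 ∑f≡0 i = ≤-antisym (subst (_ ≤_) ∑f≡0 (term≤∑ f≥0 i)) (f≥0 i)

  𝟙 : Bool → ℚ
  𝟙 true  = 1ℚ
  𝟙 false = 0ℚ

  𝟙≥0 : ∀ a → 0ℚ ≤ 𝟙 a
  𝟙≥0 true  = decide-≤
  𝟙≥0 false = decide-≤

  𝟙-∧ : ∀ a b → 𝟙 (a ∧ b) ≡ 𝟙 a * 𝟙 b
  𝟙-∧ true  true  = refl
  𝟙-∧ true  false = refl
  𝟙-∧ false true  = refl
  𝟙-∧ false false = refl

  infix 4 _==_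

  _==_ : Fin n → Fin n → Bool
  i == j = does (i Fin.≟ j)

  ==-refl : (i : Fin n) → (i == i) ≡ true
  ==-refl i = dec-true (i Fin.≟ i) refl

  ==⇒≡ : {i j : Fin n} → (i == j) ≡ true → i ≡ j
  ==⇒≡ {i = i} {j} eq with i Fin.≟ j
  ... | yes i≡j = i≡j

  ≢⇒==-false : {i j : Fin n} → i ≢ j → (i == j) ≡ false
  ≢⇒==-false {i = i} {j} = dec-false (i Fin.≟ j)

  ==-sym : (i j : Fin n) → (i == j) ≡ (j == i)
  ==-sym i j with i Fin.≟ j
  ... | yes refl = sym (==-refl i)
  ... | no i≢j   = sym (≢⇒==-false (i≢j ∘ sym))

  δ : Fin n → Fin n → ℚ
  δ i j = 𝟙 (i == j)

  ∑-δ : ∀ i (f : Fin n → ℚ) → ∑ (λ j → δ i j * f j) ≡ f i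
  ∑-δ {suc n} zero    f = begin
    1ℚ * f zero + ∑ (λ j → 0ℚ * f (suc j))
      ≡⟨ cong₂ _+_ (ℚ.*-identityˡ (f zero)) (trans (∑-cong (λ j → ℚ.*-zeroˡ (f (suc j)))) (∑-0 n)) ⟩
    f zero + 0ℚ  ≡⟨ ℚ.+-identityʳ (f zero) ⟩
    f zero       ∎
    where open ≡-Reasoning
  ∑-δ {suc n} (suc i) f = begin
    0ℚ * f zero + ∑ (λ j → δ (suc i) (suc j) * f (suc j))
      ≡⟨ cong₂ _+_ (ℚ.*-zeroˡ (f zero)) (∑-cong (λ j → cong (λ b → 𝟙 b * f (suc j)) (suc==suc i j))) ⟩
    0ℚ + ∑ (λ j → δ i j * f (suc j))  ≡⟨ ℚ.+-identityˡ _ ⟩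
    ∑ (λ j → δ i j * f (suc j))       ≡⟨ ∑-δ i (f ∘ suc) ⟩
    f (suc i)                          ∎
    where
    open ≡-Reasoning
    suc==suc : ∀ {n} (i j : Fin n) → (suc i == suc j) ≡ (i == j)
    suc==suc i j with i Fin.≟ j
    ... | yes refl = refl
    ... | no _     = refl

  ∑-δ1 : (i : Fin n) → ∑ (δ i) ≡ 1ℚ
  ∑-δ1 i = trans (∑-cong (λ j → sym (ℚ.*-identityʳ (δ i j)))) (∑-δ i (λ _ → 1ℚ))

  ∑-const : ∀ n c → ∑ {n} (λ _ → c) ≡ ι n * c
  ∑-const zero    c = sym (ℚ.*-zeroˡ c)
  ∑-const (suc n) c = begin
    c + ∑ {n} (λ _ → c)  ≡⟨ cong (_+_ c) (∑-const n c) ⟩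
    c + ι n * c          ≡⟨ solve 2 (λ c a → c :+ a :* c := (con 1ℚ :+ a) :* c) refl c (ι n) ⟩
    (1ℚ + ι n) * c       ≡⟨ cong (_* c) (ι-suc n) ⟨
    ι (suc n) * c        ∎
    where open ≡-Reasoning

  infix 4 _<ᵇ_

  opaque
    _<ᵇ_ : ℚ → ℚ → Bool
    a <ᵇ b = does (a ℚ.<? b)

    <ᵇ-true : ∀ {a b} → (a <ᵇ b) ≡ true → a < b
    <ᵇ-true {a} {b} eq = does⇒ (a ℚ.<? b) eq
      where
      does⇒ : ∀ {P : Set} (p? : Dec P) → does p? ≡ true → P
      does⇒ (yes p) _ = p

    <ᵇ-false : ∀ {a b} → (a <ᵇ b) ≡ false → b ≤ a
    <ᵇ-false {a} {b} eq = ℚ.≮⇒≥ λ a<b → contradiction (trans (sym (dec-true (a ℚ.<? b) a<b)) eq) λ ()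

  -- Large cliques through the edges of a graph

  true≢false : ∀ {a} → a ≡ true → a ≢ false
  true≢false refl ()

  ∧-true : ∀ {a b} → a ∧ b ≡ true → a ≡ true × b ≡ true
  ∧-true {true} {true} _ = refl , refl

  ∧-intro : ∀ {a b} → a ≡ true → b ≡ true → a ∧ b ≡ true
  ∧-intro refl refl = refl

  not-true : ∀ {a} → not a ≡ true → a ≡ false
  not-true {false} _ = refl

  ¬true⇒false : ∀ {a} → ¬ (a ≡ true) → a ≡ false
  ¬true⇒false {true}  h = contradiction refl h
  ¬true⇒false {false} _ = refl

  weighted-≤ : ∀ a {p q} → (a ≡ true → p ≤ q) → 𝟙 a * p ≤ 𝟙 a * q
  weighted-≤ true  {p} {q} h = subst₂ _≤_ (sym (ℚ.*-identityˡ p)) (sym (ℚ.*-identityˡ q)) (h refl)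
  weighted-≤ false {p} {q} h = ≤-reflexive (trans (ℚ.*-zeroˡ p) (sym (ℚ.*-zeroˡ q)))

  weighted-≡ : ∀ a {p q} → (a ≡ true → p ≡ q) → 𝟙 a * p ≡ 𝟙 a * q
  weighted-≡ true  h = cong (1ℚ *_) (h refl)
  weighted-≡ false {p} {q} h = trans (ℚ.*-zeroˡ p) (sym (ℚ.*-zeroˡ q))

  𝟙-mono : ∀ {a b} → (a ≡ true → b ≡ true) → 𝟙 a ≤ 𝟙 b
  𝟙-mono {true}  {b} h rewrite h refl = ≤-refl
  𝟙-mono {false} {b} h = 𝟙≥0 b

  disjoint : ∀ {a b c} → (a ≡ true → c ≡ true) → (b ≡ true → c ≡ true) → (a ≡ true → b ≡ true → ⊥) →
    𝟙 a + 𝟙 b ≤ 𝟙 c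
  disjoint {true}  {true}  f g h = ⊥-elim (h refl refl)
  disjoint {true}  {false} f g h rewrite f refl = decide-≤
  disjoint {false} {true}  f g h rewrite g refl = decide-≤
  disjoint {false} {false} {c} f g h = 𝟙≥0 c

  module SimpleGraph {v : ℕ} (adj : Fin v → Fin v → Bool)
    (adj-irrefl : ∀ x → adj x x ≡ false) (adj-sym : ∀ x y → adj x y ≡ adj y x) where

    nonadj : Fin v → Fin v → Bool
    nonadj x y = not (x == y) ∧ not (adj x y)

    nonadj-sym : ∀ x y → nonadj x y ≡ nonadj y x
    nonadj-sym x y = cong₂ (λ e a → not e ∧ not a) (==-sym x y) (adj-sym x y)

    nonadj-irrefl : ∀ x → nonadj x x ≡ false
    nonadj-irrefl x rewrite ==-refl x = refl

    adj-swap : ∀ {x y} → adj x y ≡ true → adj y x ≡ true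
    adj-swap {x} {y} = trans (adj-sym y x)

    nonadj-swap : ∀ {x y} → nonadj x y ≡ true → nonadj y x ≡ true
    nonadj-swap {x} {y} = trans (nonadj-sym y x)

    ==⇒¬adj : ∀ {x y} → (x == y) ≡ true → adj x y ≡ false
    ==⇒¬adj {x} eq = subst (λ y → adj x y ≡ false) (==⇒≡ eq) (adj-irrefl x)

    adj⇒≢ : ∀ {x y} → adj x y ≡ true → x ≢ y
    adj⇒≢ {x} x~y refl = true≢false x~y (adj-irrefl x)

    nonadj⇒≢ : ∀ {x y} → nonadj x y ≡ true → x ≢ y
    nonadj⇒≢ {x} x≁y refl = true≢false x≁y (nonadj-irrefl x)

    nonadj⇒¬adj : ∀ {x y} → nonadj x y ≡ true → adj x y ≡ false
    nonadj⇒¬adj {x} {y} x≁y = not-true (proj₂ (∧-true {not (x == y)} x≁y))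

    trichotomy : ∀ x y → x ≡ y ⊎ adj x y ≡ true ⊎ nonadj x y ≡ true
    trichotomy x y with x == y in e | adj x y
    ... | true  | _     = inj₁ (==⇒≡ e)
    ... | false | true  = inj₂ (inj₁ refl)
    ... | false | false = inj₂ (inj₂ refl)

    split : ∀ x y → 1ℚ ≡ δ x y + 𝟙 (adj x y) + 𝟙 (nonadj x y)
    split x y = lemma (x == y) (adj x y) ==⇒¬adj
      where
      lemma : ∀ e a → (e ≡ true → a ≡ false) → 1ℚ ≡ 𝟙 e + 𝟙 a + 𝟙 (not e ∧ not a)
      lemma true  true  h with () ← h refl
      lemma true  false _ = refl
      lemma false true  _ = refl
      lemma false false _ = refl

    ∑-nonadj : ∀ (f : Fin v → Bool) z →
      ∑ (λ w → 𝟙 (f w ∧ nonadj z w)) ≡ ∑ (λ w → 𝟙 (f w)) - 𝟙 (f z) - ∑ (λ w → 𝟙 (f w ∧ adj z w))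
    ∑-nonadj f z = begin
      ∑ (λ w → 𝟙 (f w ∧ nonadj z w))
        ≡⟨ ∑-cong pointwise ⟩
      ∑ (λ w → 𝟙 (f w) - δ z w * 𝟙 (f w) - 𝟙 (f w ∧ adj z w))
        ≡⟨ ∑-- (λ w → 𝟙 (f w) - δ z w * 𝟙 (f w)) (λ w → 𝟙 (f w ∧ adj z w)) ⟩
      ∑ (λ w → 𝟙 (f w) - δ z w * 𝟙 (f w)) - ∑ (λ w → 𝟙 (f w ∧ adj z w))
        ≡⟨ cong (_- ∑ (λ w → 𝟙 (f w ∧ adj z w))) (trans (∑-- (λ w → 𝟙 (f w)) (λ w → δ z w * 𝟙 (f w)))
             (cong (λ s → ∑ (λ w → 𝟙 (f w)) - s) (∑-δ z (λ w → 𝟙 (f w))))) ⟩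
      ∑ (λ w → 𝟙 (f w)) - 𝟙 (f z) - ∑ (λ w → 𝟙 (f w ∧ adj z w))  ∎
      where
      open ≡-Reasoning
      pointwise : ∀ w → 𝟙 (f w ∧ nonadj z w) ≡ 𝟙 (f w) - δ z w * 𝟙 (f w) - 𝟙 (f w ∧ adj z w)
      pointwise w = begin
        𝟙 (f w ∧ nonadj z w)
          ≡⟨ 𝟙-∧ (f w) (nonadj z w) ⟩
        𝟙 (f w) * 𝟙 (nonadj z w)
          ≡⟨ solve 4 (λ p e a c → p :* c := p :* (e :+ a :+ c) :- e :* p :- p :* a) refl
               (𝟙 (f w)) (δ z w) (𝟙 (adj z w)) (𝟙 (nonadj z w)) ⟩
        𝟙 (f w) * (δ z w + 𝟙 (adj z w) + 𝟙 (nonadj z w)) - δ z w * 𝟙 (f w) - 𝟙 (f w) * 𝟙 (adj z w)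
          ≡⟨ cong₂ (λ s t → s - δ z w * 𝟙 (f w) - t)
               (trans (cong (𝟙 (f w) *_) (sym (split z w))) (ℚ.*-identityʳ (𝟙 (f w))))
               (sym (𝟙-∧ (f w) (adj z w))) ⟩
        𝟙 (f w) - δ z w * 𝟙 (f w) - 𝟙 (f w ∧ adj z w)  ∎

    module NearCliques (k ℓ m β : ℚ)
      (degree : ∀ x → ∑ (λ z → 𝟙 (adj x z)) ≡ k)
      (common : ∀ {x y} → adj x y ≡ true → ∑ (λ z → 𝟙 (adj x z ∧ adj y z)) ≡ ℓ)
      (common-≤ : ∀ {x y} → nonadj x y ≡ true → ∑ (λ z → 𝟙 (adj x z ∧ adj y z)) ≤ m)
      (β≥28 : ι 28 ≤ β)
      (bound₁ : ι 4 * ((k - 1ℚ - ℓ) * (m - 1ℚ)) ≤ β * β)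
      (bound₂ : ι 11 * β ≤ ι 12 * (ℓ + ι 2 - m))
      (bound₃ : ι 20 * β ≤ ι 21 * ℓ)
      (bound₄ : ι 28 * (m - 1ℚ) ≤ β)
      where

      far : ∀ {x y} → adj x y ≡ true → ∑ (λ w → 𝟙 (adj x w ∧ nonadj y w)) ≡ k - 1ℚ - ℓ
      far {x} {y} x~y = begin
        ∑ (λ w → 𝟙 (adj x w ∧ nonadj y w))
          ≡⟨ ∑-nonadj (adj x) y ⟩
        ∑ (λ w → 𝟙 (adj x w)) - 𝟙 (adj x y) - ∑ (λ w → 𝟙 (adj x w ∧ adj y w))
          ≡⟨ cong₂ _-_ (cong₂ _-_ (degree x) (cong 𝟙 x~y)) (common x~y) ⟩
        k - 1ℚ - ℓ ∎
        where open ≡-Reasoning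

      triangle : Fin v → Fin v → Fin v → ℚ
      triangle x y z = ∑ (λ w → 𝟙 ((adj x w ∧ adj y w) ∧ adj z w))

      defect : Fin v → Fin v → Fin v → ℚ
      defect x y z = ∑ (λ w → 𝟙 ((adj x w ∧ adj y w) ∧ nonadj z w))

      defect≡ : ∀ {x y z} → adj x y ≡ true → adj x z ≡ true → adj y z ≡ true →
        defect x y z ≡ ℓ - 1ℚ - triangle x y z
      defect≡ {x} {y} {z} x~y x~z y~z = trans (∑-nonadj (λ w → adj x w ∧ adj y w) z)
        (cong₂ (λ s t → s - t - triangle x y z) (common x~y) (cong 𝟙 (∧-intro x~z y~z)))

      -- By `defect≡`, both sides are `ℓ - 1` minus the number of common neighbours of all three
      -- vertices, which is symmetric in `y` and `z`. This exchanges the non-neighbours of `z` for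
      -- those of `y`, which can be counted independently of `z`.
      defect-swap : ∀ {x y z} → adj x y ≡ true → adj x z ≡ true → adj y z ≡ true →
        defect x y z ≡ defect x z y
      defect-swap {x} {y} {z} x~y x~z y~z = begin
        defect x y z              ≡⟨ defect≡ x~y x~z y~z ⟩
        ℓ - 1ℚ - triangle x y z   ≡⟨ cong (λ t → ℓ - 1ℚ - t) (∑-cong (λ w → cong 𝟙
                                       (swap (adj x w) (adj y w) (adj z w)))) ⟩
        ℓ - 1ℚ - triangle x z y   ≡⟨ defect≡ x~z x~y (adj-swap y~z) ⟨
        defect x z y              ∎
        where
        open ≡-Reasoning
        swap : ∀ a b c → (a ∧ b) ∧ c ≡ (a ∧ c) ∧ b
        swap a b c = trans (Bool.∧-assoc a b c) (trans (cong (a ∧_) (∧-comm b c)) (sym (Bool.∧-assoc a c b)))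

      -- x is a common neighbour of y and w that the sum does not count.
      triangle-≤ : ∀ {x y w} → adj x y ≡ true → adj x w ≡ true → nonadj y w ≡ true →
        ∑ (λ z → 𝟙 ((adj x z ∧ adj y z) ∧ adj w z)) ≤ m - 1ℚ
      triangle-≤ {x} {y} {w} x~y x~w y≁w = begin
        ∑ (λ z → 𝟙 ((adj x z ∧ adj y z) ∧ adj w z))
          ≤⟨ ∑-mono (λ z → drop (x == z) (adj x z) (adj y z) (adj w z) ==⇒¬adj) ⟩
        ∑ (λ z → 𝟙 (adj y z ∧ adj w z) - δ x z * 𝟙 (adj y z ∧ adj w z))
          ≡⟨ ∑-- (λ z → 𝟙 (adj y z ∧ adj w z)) (λ z → δ x z * 𝟙 (adj y z ∧ adj w z)) ⟩
        ∑ (λ z → 𝟙 (adj y z ∧ adj w z)) - ∑ (λ z → δ x z * 𝟙 (adj y z ∧ adj w z))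
          ≡⟨ cong (λ s → ∑ (λ z → 𝟙 (adj y z ∧ adj w z)) - s) (trans (∑-δ x (λ z → 𝟙 (adj y z ∧ adj w z)))
               (cong 𝟙 (∧-intro (adj-swap x~y) (adj-swap x~w)))) ⟩
        ∑ (λ z → 𝟙 (adj y z ∧ adj w z)) - 1ℚ
          ≤⟨ ℚ.+-monoˡ-≤ (- 1ℚ) (common-≤ y≁w) ⟩
        m - 1ℚ ∎
        where
        open ℚ.≤-Reasoning
        drop : ∀ e a b c → (e ≡ true → a ≡ false) → 𝟙 ((a ∧ b) ∧ c) ≤ 𝟙 (b ∧ c) - 𝟙 e * 𝟙 (b ∧ c)
        drop true  a b c h rewrite h refl = ≤-reflexive
          (solve 1 (λ p → con 0ℚ := p :- con 1ℚ :* p) refl (𝟙 (b ∧ c)))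
        drop false a b c _ = ≤-trans (𝟙-mono {(a ∧ b) ∧ c} {b ∧ c} (λ h →
          let ab , c′ = ∧-true {a ∧ b} h in ∧-intro (proj₂ (∧-true {a} ab)) c′))
          (≤-reflexive (solve 1 (λ p → p := p :- con 0ℚ :* p) refl (𝟙 (b ∧ c))))

      -- After `defect-swap` the end `w` of the path is chosen first: `far` gives `k - 1 - ℓ`
      -- choices, and `triangle-≤` leaves at most `m - 1` middle vertices `z` for each.
      ∑-defect : ∀ {x y} → adj x y ≡ true →
        ∑ (λ z → 𝟙 (adj x z ∧ adj y z) * defect x y z) ≤ (k - 1ℚ - ℓ) * (m - 1ℚ)
      ∑-defect {x} {y} x~y = begin
        ∑ (λ z → 𝟙 (adj x z ∧ adj y z) * defect x y z)
          ≡⟨ ∑-cong (λ z → weighted-≡ (adj x z ∧ adj y z) λ xyz → let x~z , y~z = ∧-true xyz in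
               defect-swap x~y x~z y~z) ⟩
        ∑ (λ z → 𝟙 (adj x z ∧ adj y z) * defect x z y)
          ≡⟨ ∑-cong (λ z → ∑-* (𝟙 (adj x z ∧ adj y z)) (λ w → 𝟙 ((adj x w ∧ adj z w) ∧ nonadj y w))) ⟨
        ∑ (λ z → ∑ (λ w → 𝟙 (adj x z ∧ adj y z) * 𝟙 ((adj x w ∧ adj z w) ∧ nonadj y w)))
          ≡⟨ ∑-swap (λ z w → 𝟙 (adj x z ∧ adj y z) * 𝟙 ((adj x w ∧ adj z w) ∧ nonadj y w)) ⟩
        ∑ (λ w → ∑ (λ z → 𝟙 (adj x z ∧ adj y z) * 𝟙 ((adj x w ∧ adj z w) ∧ nonadj y w)))
          ≡⟨ ∑-cong (λ w → ∑-cong (λ z → regroup w z)) ⟩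
        ∑ (λ w → ∑ (λ z → 𝟙 (adj x w ∧ nonadj y w) * 𝟙 ((adj x z ∧ adj y z) ∧ adj w z)))
          ≡⟨ ∑-cong (λ w → ∑-* (𝟙 (adj x w ∧ nonadj y w)) (λ z → 𝟙 ((adj x z ∧ adj y z) ∧ adj w z))) ⟩
        ∑ (λ w → 𝟙 (adj x w ∧ nonadj y w) * ∑ (λ z → 𝟙 ((adj x z ∧ adj y z) ∧ adj w z)))
          ≤⟨ ∑-mono (λ w → weighted-≤ (adj x w ∧ nonadj y w) λ xyw → let x~w , y≁w = ∧-true xyw in
               triangle-≤ x~y x~w y≁w) ⟩
        ∑ (λ w → 𝟙 (adj x w ∧ nonadj y w) * (m - 1ℚ))
          ≡⟨ ∑-*ʳ (λ w → 𝟙 (adj x w ∧ nonadj y w)) (m - 1ℚ) ⟩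
        ∑ (λ w → 𝟙 (adj x w ∧ nonadj y w)) * (m - 1ℚ)
          ≡⟨ cong (_* (m - 1ℚ)) (far x~y) ⟩
        (k - 1ℚ - ℓ) * (m - 1ℚ) ∎
        where
        open ℚ.≤-Reasoning
        regroup : ∀ w z → 𝟙 (adj x z ∧ adj y z) * 𝟙 ((adj x w ∧ adj z w) ∧ nonadj y w)
                        ≡ 𝟙 (adj x w ∧ nonadj y w) * 𝟙 ((adj x z ∧ adj y z) ∧ adj w z)
        regroup w z =
          trans (cong (p *_) (trans (𝟙-∧ (adj x w ∧ adj z w) (nonadj y w))
                                    (cong (_* 𝟙 (nonadj y w)) (𝟙-∧ (adj x w) (adj z w)))))
          (trans (solve 4 (λ p a b c → p :* (a :* b :* c) := a :* c :* (p :* b)) refl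
                   p (𝟙 (adj x w)) (𝟙 (adj z w)) (𝟙 (nonadj y w)))
          (cong₂ _*_ (sym (𝟙-∧ (adj x w) (nonadj y w)))
                     (trans (cong (λ a → p * 𝟙 a) (adj-sym z w)) (sym (𝟙-∧ (adj x z ∧ adj y z) (adj w z))))))
          where p = 𝟙 (adj x z ∧ adj y z)

      -- The least total defect of two non-adjacent common neighbours (`defect-pair`); half of it is
      -- the threshold in `small`.
      K : ℚ
      K = ℓ + ι 2 - m

      β>0 : 0ℚ < β
      β>0 = <-≤-trans (ι>0 27) β≥28

      module Edge {x y : Fin v} (x~y : adj x y ≡ true) where

        N : Fin v → Bool
        N z = adj x z ∧ adj y z

        N⇒x~ : ∀ {z} → N z ≡ true → adj x z ≡ true
        N⇒x~ {z} Nz = proj₁ (∧-true {adj x z} Nz)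

        N⇒y~ : ∀ {z} → N z ≡ true → adj y z ≡ true
        N⇒y~ {z} Nz = proj₂ (∧-true {adj x z} Nz)

        -- The sum misses the common neighbours x and y of z and w.
        pair-≤ : ∀ {z w} → N z ≡ true → N w ≡ true → nonadj z w ≡ true →
          ∑ (λ u → 𝟙 (N u ∧ (adj z u ∧ adj w u))) ≤ m - ι 2
        pair-≤ {z} {w} Nz Nw z≁w = begin
          ∑ (λ u → 𝟙 (N u ∧ P u))
            ≤⟨ ∑-mono (λ u → drop (x == u) (y == u) (adj x u) (adj y u) (P u) ==⇒¬adj ==⇒¬adj
                 (λ x≡u → ≢⇒==-false λ y≡u → adj⇒≢ x~y (trans (==⇒≡ x≡u) (sym y≡u)))) ⟩
          ∑ (λ u → 𝟙 (P u) - δ x u * 𝟙 (P u) - δ y u * 𝟙 (P u))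
            ≡⟨ trans (∑-- (λ u → 𝟙 (P u) - δ x u * 𝟙 (P u)) (λ u → δ y u * 𝟙 (P u)))
                 (cong (_- ∑ (λ u → δ y u * 𝟙 (P u))) (∑-- (λ u → 𝟙 (P u)) (λ u → δ x u * 𝟙 (P u)))) ⟩
          ∑ (λ u → 𝟙 (P u)) - ∑ (λ u → δ x u * 𝟙 (P u)) - ∑ (λ u → δ y u * 𝟙 (P u))
            ≡⟨ cong₂ (λ s t → ∑ (λ u → 𝟙 (P u)) - s - t)
                 (trans (∑-δ x (λ u → 𝟙 (P u))) (cong 𝟙 (∧-intro (adj-swap (N⇒x~ Nz)) (adj-swap (N⇒x~ Nw)))))
                 (trans (∑-δ y (λ u → 𝟙 (P u))) (cong 𝟙 (∧-intro (adj-swap (N⇒y~ Nz)) (adj-swap (N⇒y~ Nw))))) ⟩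
          ∑ (λ u → 𝟙 (P u)) - 1ℚ - 1ℚ
            ≡⟨ solve 1 (λ s → s :- con 1ℚ :- con 1ℚ := s :- con (ι 2)) refl (∑ (λ u → 𝟙 (P u))) ⟩
          ∑ (λ u → 𝟙 (P u)) - ι 2
            ≤⟨ ℚ.+-monoˡ-≤ (- ι 2) (common-≤ z≁w) ⟩
          m - ι 2 ∎
          where
          open ℚ.≤-Reasoning
          P : Fin v → Bool
          P u = adj z u ∧ adj w u
          drop : ∀ e e′ a a′ p → (e ≡ true → a ≡ false) → (e′ ≡ true → a′ ≡ false) → (e ≡ true → e′ ≡ false) →
            𝟙 ((a ∧ a′) ∧ p) ≤ 𝟙 p - 𝟙 e * 𝟙 p - 𝟙 e′ * 𝟙 p
          drop true e′ a a′ p h h′ d rewrite h refl | d refl = ≤-reflexive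
            (solve 1 (λ p → con 0ℚ := p :- con 1ℚ :* p :- con 0ℚ :* p) refl (𝟙 p))
          drop false true a a′ p h h′ d rewrite h′ refl | Bool.∧-zeroʳ a = ≤-reflexive
            (solve 1 (λ p → con 0ℚ := p :- con 0ℚ :* p :- con 1ℚ :* p) refl (𝟙 p))
          drop false false a a′ p h h′ d = ≤-trans (𝟙-mono {(a ∧ a′) ∧ p} {p} (λ t → proj₂ (∧-true {a ∧ a′} t)))
            (≤-reflexive (solve 1 (λ p → p := p :- con 0ℚ :* p :- con 0ℚ :* p) refl (𝟙 p)))

        -- By `pair-≤`, at most `m - 2` common neighbours of `x` and `y` are adjacent to both `z`
        -- and `w`; every other one is a non-neighbour of `z` or of `w`. Here `z` itself counts as a
        -- non-neighbour of `w`, and conversely.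
        defect-pair : ∀ {z w} → N z ≡ true → N w ≡ true → nonadj z w ≡ true →
          K ≤ defect x y z + defect x y w
        defect-pair {z} {w} Nz Nw z≁w = ≤-by (diff≥0 total)
          (solve 4 (λ dz dw l m → dz :+ dw := l :+ con (ι 2) :- m :+ (dz :+ dw :+ (m :- con (ι 2)) :- l))
            refl (defect x y z) (defect x y w) ℓ m)
          where
          open ℚ.≤-Reasoning
          cover : ∀ p a b c → a ≡ true ⊎ b ≡ true ⊎ c ≡ true → 𝟙 p ≤ 𝟙 (p ∧ a) + 𝟙 (p ∧ b) + 𝟙 (p ∧ c)
          cover false a     b     c     _ = decide-≤
          cover true  true  true  true  _ = decide-≤
          cover true  true  true  false _ = decide-≤
          cover true  true  false true  _ = decide-≤
          cover true  true  false false _ = decide-≤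
          cover true  false true  true  _ = decide-≤
          cover true  false true  false _ = decide-≤
          cover true  false false true  _ = decide-≤
          cover true  false false false (inj₁ ())
          cover true  false false false (inj₂ (inj₁ ()))
          cover true  false false false (inj₂ (inj₂ ()))
          cases : ∀ u → nonadj z u ≡ true ⊎ nonadj w u ≡ true ⊎ (adj z u ∧ adj w u) ≡ true
          cases u with trichotomy z u | trichotomy w u
          ... | inj₁ refl         | _                 = inj₂ (inj₁ (nonadj-swap z≁w))
          ... | _                 | inj₁ refl         = inj₁ z≁w
          ... | inj₂ (inj₂ z≁u)   | _                 = inj₁ z≁u
          ... | _                 | inj₂ (inj₂ w≁u)   = inj₂ (inj₁ w≁u)
          ... | inj₂ (inj₁ z~u)   | inj₂ (inj₁ w~u)   = inj₂ (inj₂ (∧-intro z~u w~u))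
          total : ℓ ≤ defect x y z + defect x y w + (m - ι 2)
          total = begin
            ℓ ≡⟨ common x~y ⟨
            ∑ (λ u → 𝟙 (N u))
              ≤⟨ ∑-mono (λ u → cover (N u) (nonadj z u) (nonadj w u) (adj z u ∧ adj w u) (cases u)) ⟩
            ∑ (λ u → 𝟙 (N u ∧ nonadj z u) + 𝟙 (N u ∧ nonadj w u) + 𝟙 (N u ∧ (adj z u ∧ adj w u)))
              ≡⟨ trans (∑-+ (λ u → 𝟙 (N u ∧ nonadj z u) + 𝟙 (N u ∧ nonadj w u)) (λ u → 𝟙 (N u ∧ (adj z u ∧ adj w u))))
                   (cong (_+ ∑ (λ u → 𝟙 (N u ∧ (adj z u ∧ adj w u))))
                     (∑-+ (λ u → 𝟙 (N u ∧ nonadj z u)) (λ u → 𝟙 (N u ∧ nonadj w u)))) ⟩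
            defect x y z + defect x y w + ∑ (λ u → 𝟙 (N u ∧ (adj z u ∧ adj w u)))
              ≤⟨ ℚ.+-monoʳ-≤ (defect x y z + defect x y w) (pair-≤ Nz Nw z≁w) ⟩
            defect x y z + defect x y w + (m - ι 2) ∎

        -- The number of ordered pairs of non-adjacent common neighbours of `x` and `y`.
        D : ℚ
        D = ∑ (λ z → 𝟙 (N z) * defect x y z)

        4D≤β² : ι 4 * D ≤ β * β
        4D≤β² = ≤-trans (ℚ.*-monoˡ-≤-nonNeg (ι 4) (∑-defect x~y)) bound₁

        small : Fin v → Bool
        small z = ι 2 * defect x y z <ᵇ K

        H : Fin v → Bool
        H z = N z ∧ small z

        H⇒small : ∀ {z} → H z ≡ true → ι 2 * defect x y z < K
        H⇒small {z} Hz = <ᵇ-true (proj₂ (∧-true {N z} Hz))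

        H⇒N : ∀ {z} → H z ≡ true → N z ≡ true
        H⇒N {z} Hz = proj₁ (∧-true {N z} Hz)

        H-clique : ∀ {z w} → H z ≡ true → H w ≡ true → nonadj z w ≡ false
        H-clique {z} {w} Hz Hw with nonadj z w in z≁w
        ... | false = refl
        ... | true  = contradiction
          (ℚ.+-mono-< (H⇒small Hz) (H⇒small Hw))
          (≤⇒≯ (≤-trans (≤-reflexive (solve 1 (λ k → k :+ k := con (ι 2) :* k) refl K))
            (≤-trans (ℚ.*-monoˡ-≤-nonNeg (ι 2) (defect-pair (H⇒N Hz) (H⇒N Hw) z≁w))
              (≤-reflexive (solve 2 (λ a b → con (ι 2) :* (a :+ b) := con (ι 2) :* a :+ con (ι 2) :* b) refl
                (defect x y z) (defect x y w))))))

        large : ℚ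
        large = ∑ (λ z → 𝟙 (N z ∧ not (H z)))

        large≥0 : 0ℚ ≤ large
        large≥0 = ∑≥0 (λ z → 𝟙≥0 (N z ∧ not (H z)))

        large*K≤2D : large * K ≤ ι 2 * D
        large*K≤2D = begin
          large * K
            ≡⟨ ∑-*ʳ (λ z → 𝟙 (N z ∧ not (H z))) K ⟨
          ∑ (λ z → 𝟙 (N z ∧ not (H z)) * K)
            ≤⟨ ∑-mono termwise ⟩
          ∑ (λ z → ι 2 * (𝟙 (N z) * defect x y z))
            ≡⟨ ∑-* (ι 2) (λ z → 𝟙 (N z) * defect x y z) ⟩
          ι 2 * D ∎
          where
          open ℚ.≤-Reasoning
          defect≥0 : ∀ z → 0ℚ ≤ defect x y z
          defect≥0 z = ∑≥0 (λ w → 𝟙≥0 (N w ∧ nonadj z w))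
          termwise : ∀ z → 𝟙 (N z ∧ not (H z)) * K ≤ ι 2 * (𝟙 (N z) * defect x y z)
          termwise z with N z | small z in eq
          ... | false | _     = ≤-reflexive (solve 2 (λ k d → con 0ℚ :* k := con (ι 2) :* (con 0ℚ :* d)) refl K (defect x y z))
          ... | true  | true  = subst₂ _≤_ (sym (ℚ.*-zeroˡ K)) (cong (ι 2 *_) (sym (ℚ.*-identityˡ (defect x y z))))
                                  (ι≥0 2 ⊛ defect≥0 z)
          ... | true  | false = subst₂ _≤_ (sym (ℚ.*-identityˡ K)) (cong (ι 2 *_) (sym (ℚ.*-identityˡ (defect x y z))))
                                  (<ᵇ-false eq)

        -- A common neighbour outside `H` contributes at least `K/2` to `D`. As `D ≤ β²/4` and
        -- `K ≥ 11β/12`, there are at most `(β²/2) / (11β/12) = 6β/11` of them.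
        11large≤6β : ι 11 * large ≤ ι 6 * β
        11large≤6β = *-cancel-≤ β>0 (≤-by
          (large≥0 ⊛ diff≥0 bound₂ ⊕ ι≥0 12 ⊛ diff≥0 large*K≤2D ⊕ ι≥0 6 ⊛ diff≥0 4D≤β²)
          (solve 4 (λ b q k d → b :* (con (ι 6) :* b) := b :* (con (ι 11) :* q) :+
              (q :* (con (ι 12) :* k :- con (ι 11) :* b) :+ con (ι 12) :* (con (ι 2) :* d :- q :* k)
                :+ con (ι 6) :* (b :* b :- con (ι 4) :* d)))
            refl β large K D))

        ∑H : ∑ (λ z → 𝟙 (H z)) ≡ ℓ - large
        ∑H = begin
          ∑ (λ z → 𝟙 (H z))
            ≡⟨ ∑-cong (λ z → lemma (N z) (small z)) ⟩
          ∑ (λ z → 𝟙 (N z) - 𝟙 (N z ∧ not (H z)))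
            ≡⟨ ∑-- (λ z → 𝟙 (N z)) (λ z → 𝟙 (N z ∧ not (H z))) ⟩
          ∑ (λ z → 𝟙 (N z)) - large
            ≡⟨ cong (_- large) (common x~y) ⟩
          ℓ - large ∎
          where
          open ≡-Reasoning
          lemma : ∀ a b → 𝟙 (a ∧ b) ≡ 𝟙 a - 𝟙 (a ∧ not (a ∧ b))
          lemma true  true  = refl
          lemma true  false = refl
          lemma false _     = refl

        -- The two sides are compared through `20β/21 - 6β/11 = 94β/231` and `m - 1 ≤ β/28`; 924 is
        -- the common denominator of 231 and 28.
        m-2<∑H : m - ι 2 < ∑ (λ z → 𝟙 (H z))
        m-2<∑H = subst (m - ι 2 <_) (sym ∑H) (ℚ.*-cancelˡ-<-nonNeg (ι 924)
          (<-by (0<* (ι>0 342) β>0 ⊕< (ι≥0 44 ⊛ diff≥0 bound₃ ⊕ ι≥0 84 ⊛ diff≥0 11large≤6β ⊕ ι≥0 33 ⊛ diff≥0 bound₄ ⊕ ι≥0 924))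
            (solve 4 (λ b l q m → con (ι 924) :* (l :- q) := con (ι 924) :* (m :- con (ι 2)) :+
               (con (ι 343) :* b :+ (con (ι 44) :* (con (ι 21) :* l :- con (ι 20) :* b) :+
                 con (ι 84) :* (con (ι 6) :* b :- con (ι 11) :* q) :+
                 con (ι 33) :* (b :- con (ι 28) :* (m :- con 1ℚ)) :+ con (ι 924))))
               refl β ℓ large m)))
          where
          infixl 6 _⊕<_
          _⊕<_ : ∀ {a b} → 0ℚ < a → 0ℚ ≤ b → 0ℚ < a + b
          _⊕<_ = ℚ.+-mono-<-≤

        blocked? : ∀ z → Dec (∃[ h ] (H h ∧ nonadj z h) ≡ true)
        blocked? z = Fin.any? λ h → (H h ∧ nonadj z h) Bool.≟ true

        -- The estimate for `H` is too weak for the final size. `C` adds every common neighbour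
        -- without a non-neighbour in `H`; the vertices still missing then satisfy the quadratic
        -- inequality `2q[K-q]≤D`.
        C : Fin v → Bool
        C z = N z ∧ not (does (blocked? z))

        C⇒N : ∀ {z} → C z ≡ true → N z ≡ true
        C⇒N {z} Cz = proj₁ (∧-true {N z} Cz)

        C⇒meets-H : ∀ {z h} → C z ≡ true → H h ≡ true → nonadj z h ≡ false
        C⇒meets-H {z} {h} Cz Hh with nonadj z h in z≁h
        ... | false = refl
        ... | true  = contradiction (dec-true (blocked? z) (h , ∧-intro Hh z≁h))
          λ b → true≢false b (not-true (proj₂ (∧-true {N z} Cz)))

        ¬C⇒blocked : ∀ {z} → N z ≡ true → C z ≡ false → ∃[ h ] H h ≡ true × nonadj z h ≡ true
        ¬C⇒blocked {z} Nz ¬Cz with blocked? z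
        ... | yes (h , p) = h , ∧-true p
        ... | no _ = contradiction ¬Cz (true≢false (∧-intro Nz refl))

        H⇒C : ∀ {z} → H z ≡ true → C z ≡ true
        H⇒C {z} Hz with C z in eq
        ... | true  = refl
        ... | false = let h , Hh , z≁h = ¬C⇒blocked (H⇒N Hz) eq in
          contradiction (H-clique Hz Hh) (true≢false z≁h)

        -- All of `H` would be adjacent to both of two non-adjacent vertices of `C`, but `pair-≤`
        -- allows only `m - 2` such vertices and `H` has more.
        C-clique : ∀ {z w} → C z ≡ true → C w ≡ true → nonadj z w ≡ false
        C-clique {z} {w} Cz Cw with nonadj z w in z≁w
        ... | false = refl
        ... | true  = contradiction
          (≤-trans (∑-mono {v} λ u → 𝟙-mono λ Hu → ∧-intro (H⇒N Hu) (∧-intro (meet Cz Cw z≁w Hu) (meet Cw Cz (nonadj-swap z≁w) Hu)))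
                   (pair-≤ (C⇒N Cz) (C⇒N Cw) z≁w))
          (λ le → <-irrefl refl (<-≤-trans m-2<∑H le))
          where
          meet : ∀ {z w u} → C z ≡ true → C w ≡ true → nonadj z w ≡ true → H u ≡ true → adj z u ≡ true
          meet {z} {w} {u} Cz Cw z≁w Hu with trichotomy z u
          ... | inj₁ refl       = contradiction (C⇒meets-H Cw Hu) (true≢false (nonadj-swap z≁w))
          ... | inj₂ (inj₁ z~u) = z~u
          ... | inj₂ (inj₂ z≁u) = contradiction (C⇒meets-H Cz Hu) (true≢false z≁u)

        -- A common neighbour `z` outside `C` has a non-neighbour `h` in `H`. The neighbours of `z`
        -- in `C` are also adjacent to `h`, so `pair-≤` applies to `z` and `h`.
        ∑C∧adj≤ : ∀ {z} → N z ≡ true → C z ≡ false → ∑ (λ u → 𝟙 (C u ∧ adj z u)) ≤ m - ι 2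
        ∑C∧adj≤ {z} Nz ¬Cz = let h , Hh , z≁h = ¬C⇒blocked Nz ¬Cz in
          ≤-trans (∑-mono {v} λ u → 𝟙-mono λ Cu∧z~u → let Cu , z~u = ∧-true {C u} Cu∧z~u in
                    ∧-intro (C⇒N Cu) (∧-intro z~u (meet z~u Cu Hh z≁h)))
                  (pair-≤ Nz (H⇒N Hh) z≁h)
          where
          meet : ∀ {u h} → adj z u ≡ true → C u ≡ true → H h ≡ true → nonadj z h ≡ true → adj h u ≡ true
          meet {u} {h} z~u Cu Hh z≁h with trichotomy h u
          ... | inj₁ refl       = contradiction (nonadj⇒¬adj z≁h) (true≢false z~u)
          ... | inj₂ (inj₁ h~u) = h~u
          ... | inj₂ (inj₂ h≁u) = contradiction (C⇒meets-H Cu Hh) (true≢false (nonadj-swap h≁u))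

        Q : Fin v → Bool
        Q z = N z ∧ not (C z)

        q : ℚ
        q = ∑ (λ z → 𝟙 (Q z))

        q≥0 : 0ℚ ≤ q
        q≥0 = ∑≥0 (λ z → 𝟙≥0 (Q z))

        q≤large : q ≤ large
        q≤large = ∑-mono λ z → 𝟙-mono λ Qz → let Nz , ¬Cz = ∧-true {N z} Qz in
          ∧-intro Nz (cong not (¬H (not-true ¬Cz)))
          where
          ¬H : ∀ {z} → C z ≡ false → H z ≡ false
          ¬H {z} ¬Cz with H z in Hz
          ... | false = refl
          ... | true  = contradiction ¬Cz (true≢false (H⇒C Hz))

        ∑C : ∑ (λ z → 𝟙 (C z)) ≡ ℓ - q
        ∑C = begin
          ∑ (λ z → 𝟙 (C z))
            ≡⟨ ∑-cong (λ z → lemma (N z) (not (does (blocked? z)))) ⟩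
          ∑ (λ z → 𝟙 (N z) - 𝟙 (Q z))
            ≡⟨ ∑-- (λ z → 𝟙 (N z)) (λ z → 𝟙 (Q z)) ⟩
          ∑ (λ z → 𝟙 (N z)) - q
            ≡⟨ cong (_- q) (common x~y) ⟩
          ℓ - q ∎
          where
          open ≡-Reasoning
          lemma : ∀ a b → 𝟙 (a ∧ b) ≡ 𝟙 a - 𝟙 (a ∧ not (a ∧ b))
          lemma true  true  = refl
          lemma true  false = refl
          lemma false _     = refl

        C-defect : ∀ {z} → Q z ≡ true → K - q ≤ ∑ (λ w → 𝟙 (C w ∧ nonadj z w))
        C-defect {z} Qz = begin
          K - q
            ≡⟨ solve 3 (λ l q m → l :+ con (ι 2) :- m :- q := l :- q :- con 0ℚ :- (m :- con (ι 2))) refl ℓ q m ⟩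
          ℓ - q - 0ℚ - (m - ι 2)
            ≤⟨ ℚ.+-monoʳ-≤ (ℓ - q - 0ℚ) (ℚ.neg-antimono-≤ (∑C∧adj≤ Nz ¬Cz)) ⟩
          ℓ - q - 0ℚ - ∑ (λ w → 𝟙 (C w ∧ adj z w))
            ≡⟨ cong₂ (λ s t → s - t - ∑ (λ w → 𝟙 (C w ∧ adj z w))) ∑C (cong 𝟙 ¬Cz) ⟨
          ∑ (λ w → 𝟙 (C w)) - 𝟙 (C z) - ∑ (λ w → 𝟙 (C w ∧ adj z w))
            ≡⟨ ∑-nonadj C z ⟨
          ∑ (λ w → 𝟙 (C w ∧ nonadj z w)) ∎
          where
          open ℚ.≤-Reasoning
          Nz = proj₁ (∧-true {N z} Qz)
          ¬Cz = not-true (proj₂ (∧-true {N z} Qz))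

        -- Every non-adjacent pair between C and Q is counted twice in D.
        2q[K-q]≤D : ι 2 * (q * (K - q)) ≤ D
        2q[K-q]≤D = begin
          ι 2 * (q * (K - q))
            ≡⟨ cong (ι 2 *_) (∑-*ʳ (λ z → 𝟙 (Q z)) (K - q)) ⟨
          ι 2 * ∑ (λ z → 𝟙 (Q z) * (K - q))
            ≤⟨ ℚ.*-monoˡ-≤-nonNeg (ι 2) (∑-mono λ z → weighted-≤ (Q z) C-defect) ⟩
          ι 2 * ∑ (λ z → 𝟙 (Q z) * ∑ (λ w → 𝟙 (C w ∧ nonadj z w)))
            ≡⟨ cong (ι 2 *_) (∑-cong λ z → ∑-* (𝟙 (Q z)) (λ w → 𝟙 (C w ∧ nonadj z w))) ⟨
          ι 2 * X
            ≡⟨ solve 1 (λ x → con (ι 2) :* x := x :+ x) refl X ⟩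
          X + X
            ≡⟨ cong (_+_ X) (∑-swap (λ z w → 𝟙 (Q z) * 𝟙 (C w ∧ nonadj z w))) ⟩
          X + ∑ (λ z → ∑ (λ w → 𝟙 (Q w) * 𝟙 (C z ∧ nonadj w z)))
            ≡⟨ trans (∑-cong λ z → ∑-+ (λ w → 𝟙 (Q z) * 𝟙 (C w ∧ nonadj z w)) (λ w → 𝟙 (Q w) * 𝟙 (C z ∧ nonadj w z)))
                     (∑-+ (λ z → ∑ (λ w → 𝟙 (Q z) * 𝟙 (C w ∧ nonadj z w))) (λ z → ∑ (λ w → 𝟙 (Q w) * 𝟙 (C z ∧ nonadj w z)))) ⟨
          ∑ (λ z → ∑ (λ w → 𝟙 (Q z) * 𝟙 (C w ∧ nonadj z w) + 𝟙 (Q w) * 𝟙 (C z ∧ nonadj w z)))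
            ≤⟨ ∑-mono (λ z → ∑-mono (λ w → pointwise z w)) ⟩
          ∑ (λ z → ∑ (λ w → 𝟙 (N z) * 𝟙 (N w ∧ nonadj z w)))
            ≡⟨ ∑-cong (λ z → ∑-* (𝟙 (N z)) (λ w → 𝟙 (N w ∧ nonadj z w))) ⟩
          D ∎
          where
          open ℚ.≤-Reasoning
          X = ∑ (λ z → ∑ (λ w → 𝟙 (Q z) * 𝟙 (C w ∧ nonadj z w)))
          pointwise : ∀ z w → 𝟙 (Q z) * 𝟙 (C w ∧ nonadj z w) + 𝟙 (Q w) * 𝟙 (C z ∧ nonadj w z)
                            ≤ 𝟙 (N z) * 𝟙 (N w ∧ nonadj z w)
          pointwise z w = subst₂ _≤_
            (cong₂ _+_ (𝟙-∧ (Q z) (C w ∧ nonadj z w)) (𝟙-∧ (Q w) (C z ∧ nonadj w z)))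
            (𝟙-∧ (N z) (N w ∧ nonadj z w))
            (disjoint {Q z ∧ (C w ∧ nonadj z w)} {Q w ∧ (C z ∧ nonadj w z)} {N z ∧ (N w ∧ nonadj z w)}
              (λ p → let Qz , r = ∧-true {Q z} p ; Cw , z≁w = ∧-true {C w} r in
                ∧-intro (proj₁ (∧-true {N z} Qz)) (∧-intro (C⇒N Cw) z≁w))
              (λ p → let Qw , r = ∧-true {Q w} p ; Cz , w≁z = ∧-true {C z} r in
                ∧-intro (C⇒N Cz) (∧-intro (proj₁ (∧-true {N w} Qw)) (nonadj-swap w≁z)))
              (λ p p′ → let Qz , _ = ∧-true {Q z} p ; _ , r = ∧-true {Q w} p′ ; Cz , _ = ∧-true {C z} r in
                true≢false Cz (not-true (proj₂ (∧-true {N z} Qz)))))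

        -- q lies below the smaller root of (β - 6q)(3β - 4q), because 11q ≤ 6β excludes the larger one.
        6q≤β : ι 6 * q ≤ β
        6q≤β = ≤-by 0≤β-6q (solve 2 (λ b q → b := con (ι 6) :* q :+ (b :- con (ι 6) :* q)) refl β q)
          where
          11q≤6β : ι 11 * q ≤ ι 6 * β
          11q≤6β = ≤-trans (ℚ.*-monoˡ-≤-nonNeg (ι 11) q≤large) 11large≤6β
          pos : 0ℚ < ι 3 * β - ι 4 * q
          pos = ℚ.*-cancelˡ-<-nonNeg (ι 11) (<-by
            (ℚ.+-mono-<-≤ (0<* (ι>0 8) β>0) (ι≥0 4 ⊛ diff≥0 11q≤6β))
            (solve 2 (λ b q → con (ι 11) :* (con (ι 3) :* b :- con (ι 4) :* q) :=
              con (ι 11) :* con 0ℚ :+ (con (ι 9) :* b :+ con (ι 4) :* (con (ι 6) :* b :- con (ι 11) :* q))) refl β q))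
          0≤β-6q : 0ℚ ≤ β - ι 6 * q
          0≤β-6q = *-cancel-≤ pos (≤-by
            (ι≥0 2 ⊛ (q≥0 ⊛ diff≥0 bound₂) ⊕ ι≥0 12 ⊛ diff≥0 2q[K-q]≤D ⊕ ι≥0 3 ⊛ diff≥0 4D≤β²)
            (solve 4 (λ b q k d → (con (ι 3) :* b :- con (ι 4) :* q) :* (b :- con (ι 6) :* q) :=
                (con (ι 3) :* b :- con (ι 4) :* q) :* con 0ℚ :+
                (con (ι 2) :* (q :* (con (ι 12) :* k :- con (ι 11) :* b))
                  :+ con (ι 12) :* (d :- con (ι 2) :* (q :* (k :- q)))
                  :+ con (ι 3) :* (b :* b :- con (ι 4) :* d)))
              refl β q K D))

        L : Fin v → Bool
        L z = (x == z) ∨ ((y == z) ∨ C z)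

        x∈L : L x ≡ true
        x∈L rewrite ==-refl x = refl

        y∈L : L y ≡ true
        y∈L rewrite ==-refl y = Bool.∨-zeroʳ (x == y)

        C⊆L : ∀ {z} → C z ≡ true → L z ≡ true
        C⊆L {z} Cz rewrite Cz | Bool.∨-zeroʳ (y == z) = Bool.∨-zeroʳ (x == z)

        L-cases : ∀ {z} → L z ≡ true → x ≡ z ⊎ y ≡ z ⊎ C z ≡ true
        L-cases {z} Lz with x == z in x≡z | y == z in y≡z
        ... | true  | _     = inj₁ (==⇒≡ x≡z)
        ... | false | true  = inj₂ (inj₁ (==⇒≡ y≡z))
        ... | false | false = inj₂ (inj₂ Lz)

        L-clique : ∀ {z w} → L z ≡ true → L w ≡ true → nonadj z w ≡ false
        L-clique {z} {w} Lz Lw = cases (L-cases Lz) (L-cases Lw)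
          where
          adj⇒ : ∀ {z w} → adj z w ≡ true → nonadj z w ≡ false
          adj⇒ {z} {w} z~w rewrite z~w = Bool.∧-zeroʳ (not (z == w))
          cases : ∀ {z w} → x ≡ z ⊎ y ≡ z ⊎ C z ≡ true → x ≡ w ⊎ y ≡ w ⊎ C w ≡ true → nonadj z w ≡ false
          cases (inj₁ refl)        (inj₁ refl)        = nonadj-irrefl x
          cases (inj₁ refl)        (inj₂ (inj₁ refl)) = adj⇒ x~y
          cases (inj₁ refl)        (inj₂ (inj₂ Cw))   = adj⇒ (N⇒x~ (C⇒N Cw))
          cases (inj₂ (inj₁ refl)) (inj₁ refl)        = adj⇒ (adj-swap x~y)
          cases (inj₂ (inj₁ refl)) (inj₂ (inj₁ refl)) = nonadj-irrefl y
          cases (inj₂ (inj₁ refl)) (inj₂ (inj₂ Cw))   = adj⇒ (N⇒y~ (C⇒N Cw))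
          cases (inj₂ (inj₂ Cz))   (inj₁ refl)        = adj⇒ (adj-swap (N⇒x~ (C⇒N Cz)))
          cases (inj₂ (inj₂ Cz))   (inj₂ (inj₁ refl)) = adj⇒ (adj-swap (N⇒y~ (C⇒N Cz)))
          cases (inj₂ (inj₂ Cz))   (inj₂ (inj₂ Cw))   = C-clique Cz Cw

        ∑L : ∑ (λ z → 𝟙 (L z)) ≡ ι 2 + (ℓ - q)
        ∑L = begin
          ∑ (λ z → 𝟙 (L z))
            ≡⟨ ∑-cong (λ z → lemma (x == z) (y == z) (C z)
                 (λ x≡z → ≢⇒==-false λ y≡z → adj⇒≢ x~y (trans (==⇒≡ x≡z) (sym y≡z)))
                 (λ x≡z → ¬true⇒false λ Cz → adj⇒≢ (N⇒x~ (C⇒N Cz)) (==⇒≡ x≡z))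
                 (λ y≡z → ¬true⇒false λ Cz → adj⇒≢ (N⇒y~ (C⇒N Cz)) (==⇒≡ y≡z))) ⟩
          ∑ (λ z → δ x z + δ y z + 𝟙 (C z))
            ≡⟨ trans (∑-+ (λ z → δ x z + δ y z) (λ z → 𝟙 (C z))) (cong (_+ ∑ (λ z → 𝟙 (C z))) (∑-+ (δ x) (δ y))) ⟩
          ∑ (δ x) + ∑ (δ y) + ∑ (λ z → 𝟙 (C z))
            ≡⟨ cong₂ _+_ (cong₂ _+_ (∑-δ1 x) (∑-δ1 y)) ∑C ⟩
          1ℚ + 1ℚ + (ℓ - q) ∎
          where
          open ≡-Reasoning
          lemma : ∀ a b c → (a ≡ true → b ≡ false) → (a ≡ true → c ≡ false) → (b ≡ true → c ≡ false) →
            𝟙 (a ∨ (b ∨ c)) ≡ 𝟙 a + 𝟙 b + 𝟙 c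
          lemma true  b     c     f g h rewrite f refl | g refl = refl
          lemma false true  c     f g h rewrite h refl = refl
          lemma false false true  f g h = refl
          lemma false false false f g h = refl

        -- From `∑L`, `ℓ ≥ 20β/21` and `q ≤ β/6`, using `20/21 - 1/6 = 11/14`.
        L-large : ι 11 * β ≤ ι 14 * (∑ (λ z → 𝟙 (L z)) - 1ℚ)
        L-large = subst (λ s → ι 11 * β ≤ ι 14 * (s - 1ℚ)) (sym ∑L) (*-cancel-≤ (ι>0 2) (≤-by
          (ι≥0 2 ⊛ diff≥0 bound₃ ⊕ ι≥0 7 ⊛ diff≥0 6q≤β ⊕ ι≥0 42)
          (solve 3 (λ b l q → con (ι 3) :* (con (ι 14) :* (con (ι 2) :+ (l :- q) :- con 1ℚ)) :=
            con (ι 3) :* (con (ι 11) :* b) :+ (con (ι 2) :* (con (ι 21) :* l :- con (ι 20) :* b)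
              :+ con (ι 7) :* (b :- con (ι 6) :* q) :+ con (ι 42))) refl β ℓ q)))

        -- A vertex `u` of `P` outside `L` is a common neighbour outside `C`. So `P` consists of
        -- `x`, `y`, vertices of `Q` and neighbours of `u` in `C`, at most `q + m` vertices in all,
        -- which is far too few.
        L-maximal : (P : Fin v → Bool) → P x ≡ true → P y ≡ true →
          (∀ {z w} → P z ≡ true → P w ≡ true → nonadj z w ≡ false) →
          ι 11 * β ≤ ι 14 * (∑ (λ z → 𝟙 (P z)) - 1ℚ) →
          ∀ {u} → P u ≡ true → L u ≡ true
        L-maximal P Px Py clique big {u} Pu with L u in ¬Lu
        ... | true  = refl
        ... | false = contradiction 0<β″ (≤⇒≯ (≤-trans big small′))
          where
          open ℚ.≤-Reasoning
          P⇒adj : ∀ {z w} → P z ≡ true → P w ≡ true → z ≢ w → adj z w ≡ true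
          P⇒adj {z} {w} Pz Pw z≢w with trichotomy z w
          ... | inj₁ z≡w        = contradiction z≡w z≢w
          ... | inj₂ (inj₁ z~w) = z~w
          ... | inj₂ (inj₂ z≁w) = contradiction (clique Pz Pw) (true≢false z≁w)
          P⇒N : ∀ {z} → P z ≡ true → x ≢ z → y ≢ z → N z ≡ true
          P⇒N Pz x≢z y≢z = ∧-intro (P⇒adj Px Pz x≢z) (P⇒adj Py Pz y≢z)
          Nu : N u ≡ true
          Nu = P⇒N Pu (λ { refl → true≢false x∈L ¬Lu }) (λ { refl → true≢false y∈L ¬Lu })
          ¬Cu : C u ≡ false
          ¬Cu = ¬true⇒false λ Cu → true≢false (C⊆L Cu) ¬Lu
          cover : ∀ {p a b c d} → (p ≡ true → a ≡ true ⊎ b ≡ true ⊎ c ≡ true ⊎ d ≡ true) →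
            𝟙 p ≤ 𝟙 a + 𝟙 b + 𝟙 c + 𝟙 d
          cover {false} {a} {b} {c} {d} _ = 𝟙≥0 a ⊕ 𝟙≥0 b ⊕ 𝟙≥0 c ⊕ 𝟙≥0 d
          cover {true} {a} {b} {c} {d} h with h refl
          ... | inj₁ refl = ≤-by (𝟙≥0 b ⊕ 𝟙≥0 c ⊕ 𝟙≥0 d) (solve 3 (λ b c d → con 1ℚ :+ b :+ c :+ d := con 1ℚ :+ (b :+ c :+ d)) refl (𝟙 b) (𝟙 c) (𝟙 d))
          ... | inj₂ (inj₁ refl) = ≤-by (𝟙≥0 a ⊕ 𝟙≥0 c ⊕ 𝟙≥0 d) (solve 3 (λ b c d → b :+ con 1ℚ :+ c :+ d := con 1ℚ :+ (b :+ c :+ d)) refl (𝟙 a) (𝟙 c) (𝟙 d))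
          ... | inj₂ (inj₂ (inj₁ refl)) = ≤-by (𝟙≥0 a ⊕ 𝟙≥0 b ⊕ 𝟙≥0 d) (solve 3 (λ b c d → b :+ c :+ con 1ℚ :+ d := con 1ℚ :+ (b :+ c :+ d)) refl (𝟙 a) (𝟙 b) (𝟙 d))
          ... | inj₂ (inj₂ (inj₂ refl)) = ≤-by (𝟙≥0 a ⊕ 𝟙≥0 b ⊕ 𝟙≥0 c) (solve 3 (λ b c d → b :+ c :+ d :+ con 1ℚ := con 1ℚ :+ (b :+ c :+ d)) refl (𝟙 a) (𝟙 b) (𝟙 c))
          cases : ∀ w → P w ≡ true → (x == w) ≡ true ⊎ (y == w) ≡ true ⊎ Q w ≡ true ⊎ (C w ∧ adj u w) ≡ true
          cases w Pw with x == w in x≡w | y == w in y≡w | C w in Cw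
          ... | true  | _     | _     = inj₁ refl
          ... | false | true  | _     = inj₂ (inj₁ refl)
          ... | false | false | true  = inj₂ (inj₂ (inj₂ (P⇒adj Pu Pw λ { refl → true≢false Cw ¬Cu })))
          ... | false | false | false = inj₂ (inj₂ (inj₁ (∧-intro (P⇒N Pw
                  (λ { refl → true≢false (==-refl x) x≡w }) (λ { refl → true≢false (==-refl y) y≡w })) refl)))
          ∑P≤ : ∑ (λ w → 𝟙 (P w)) ≤ q + m
          ∑P≤ = begin
            ∑ (λ w → 𝟙 (P w))
              ≤⟨ ∑-mono (λ w → cover {P w} {x == w} {y == w} {Q w} {C w ∧ adj u w} (cases w)) ⟩
            ∑ (λ w → δ x w + δ y w + 𝟙 (Q w) + 𝟙 (C w ∧ adj u w))
              ≡⟨ trans (∑-+ (λ w → δ x w + δ y w + 𝟙 (Q w)) (λ w → 𝟙 (C w ∧ adj u w))) (cong (_+ ∑ (λ w → 𝟙 (C w ∧ adj u w)))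
                  (trans (∑-+ (λ w → δ x w + δ y w) (λ w → 𝟙 (Q w))) (cong (_+ q)
                    (trans (∑-+ (δ x) (δ y)) (cong₂ _+_ (∑-δ1 x) (∑-δ1 y)))))) ⟩
            1ℚ + 1ℚ + q + ∑ (λ w → 𝟙 (C w ∧ adj u w))
              ≤⟨ ℚ.+-monoʳ-≤ (1ℚ + 1ℚ + q) (∑C∧adj≤ Nu ¬Cu) ⟩
            1ℚ + 1ℚ + q + (m - ι 2)
              ≡⟨ solve 2 (λ q m → con 1ℚ :+ con 1ℚ :+ q :+ (m :- con (ι 2)) := q :+ m) refl q m ⟩
            q + m ∎
          -- The sum `14 (1/6 + 1/28) = 17/6` is rounded up to 3.
          small′ : ι 14 * (∑ (λ w → 𝟙 (P w)) - 1ℚ) ≤ ι 3 * β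
          small′ = *-cancel-≤ (ι>0 5) (≤-by
            (ι≥0 84 ⊛ diff≥0 ∑P≤ ⊕ ι≥0 14 ⊛ diff≥0 6q≤β ⊕ ι≥0 3 ⊛ diff≥0 bound₄ ⊕ <⇒≤ β>0)
            (solve 4 (λ b p q m → con (ι 6) :* (con (ι 3) :* b) := con (ι 6) :* (con (ι 14) :* (p :- con 1ℚ)) :+
               (con (ι 84) :* (q :+ m :- p) :+ con (ι 14) :* (b :- con (ι 6) :* q) :+ con (ι 3) :* (b :- con (ι 28) :* (m :- con 1ℚ)) :+ b))
               refl β (∑ (λ w → 𝟙 (P w))) q m))
          0<β″ : ι 3 * β < ι 11 * β
          0<β″ = <-by (0<* (ι>0 7) β>0) (solve 1 (λ b → con (ι 11) :* b := con (ι 3) :* b :+ con (ι 8) :* b) refl β)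

      open Edge using (L; L-clique; L-large; L-maximal; x∈L; y∈L)

      -- Two uses of `L-maximal`: `L x~y` is a large clique through `u` and `w`, hence inside
      -- `L u~w`; this puts `x` and `y` into `L u~w`, and the roles can be exchanged. In particular
      -- the orientation of the edge from which a line is built has no influence on it.
      L-unique : ∀ {x y u w} (x~y : adj x y ≡ true) (u~w : adj u w ≡ true) →
        L x~y u ≡ true → L x~y w ≡ true → ∀ z → L x~y z ≡ L u~w z
      L-unique {x} {y} {u} {w} x~y u~w Lu Lw z = equal
        (L-maximal u~w (L x~y) Lu Lw (L-clique x~y) (L-large x~y))
        (L-maximal x~y (L u~w) (L⊆ (x∈L x~y)) (L⊆ (y∈L x~y)) (L-clique u~w) (L-large u~w))
        where
        L⊆ : ∀ {z} → L x~y z ≡ true → L u~w z ≡ true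
        L⊆ = L-maximal u~w (L x~y) Lu Lw (L-clique x~y) (L-large x~y)
        equal : ∀ {a b} → (a ≡ true → b ≡ true) → (b ≡ true → a ≡ true) → a ≡ b
        equal {true}  f g = sym (f refl)
        equal {false} {true}  f g = g refl
        equal {false} {false} f g = refl

  -- Bessel's inequality

  ⟪_,_⟫ : ∀ {n} → (Fin n → ℚ) → (Fin n → ℚ) → ℚ
  ⟪ f , g ⟫ = ∑ (λ w → f w * g w)

  module _ {n : ℕ} where

    ⟪⟫-comm : (f g : Fin n → ℚ) → ⟪ f , g ⟫ ≡ ⟪ g , f ⟫
    ⟪⟫-comm f g = ∑-cong (λ w → ℚ.*-comm (f w) (g w))

    ⟪⟫≥0 : (f : Fin n → ℚ) → 0ℚ ≤ ⟪ f , f ⟫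
    ⟪⟫≥0 f = ∑≥0 (λ w → sq≥0 (f w))

    ⟪⟫-subˡ : ∀ (f p g : Fin n → ℚ) t → ⟪ (λ w → f w - t * p w) , g ⟫ ≡ ⟪ f , g ⟫ - t * ⟪ p , g ⟫
    ⟪⟫-subˡ f p g t = begin
      ∑ (λ w → (f w - t * p w) * g w)
        ≡⟨ ∑-cong (λ w → solve 4 (λ f p g t → (f :- t :* p) :* g := f :* g :- t :* (p :* g)) refl (f w) (p w) (g w) t) ⟩
      ∑ (λ w → f w * g w - t * (p w * g w))
        ≡⟨ ∑-- (λ w → f w * g w) (λ w → t * (p w * g w)) ⟩
      ⟪ f , g ⟫ - ∑ (λ w → t * (p w * g w))
        ≡⟨ cong (λ s → ⟪ f , g ⟫ - s) (∑-* t (λ w → p w * g w)) ⟩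
      ⟪ f , g ⟫ - t * ⟪ p , g ⟫ ∎
      where open ≡-Reasoning

    ⟪⟫-subʳ : ∀ (g f p : Fin n → ℚ) t → ⟪ g , (λ w → f w - t * p w) ⟫ ≡ ⟪ g , f ⟫ - t * ⟪ g , p ⟫
    ⟪⟫-subʳ g f p t = trans (⟪⟫-comm g (λ w → f w - t * p w))
      (trans (⟪⟫-subˡ f p g t) (cong₂ (λ a b → a - t * b) (⟪⟫-comm f g) (⟪⟫-comm p g)))

    ⟪⟫-∑ˡ : ∀ {s} (a : Fin s → ℚ) (p : Fin s → Fin n → ℚ) g →
      ⟪ (λ w → ∑ (λ i → a i * p i w)) , g ⟫ ≡ ∑ (λ i → a i * ⟪ p i , g ⟫)
    ⟪⟫-∑ˡ a p g = begin
      ∑ (λ w → ∑ (λ i → a i * p i w) * g w)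
        ≡⟨ ∑-cong (λ w → trans (sym (∑-*ʳ (λ i → a i * p i w) (g w))) (∑-cong (λ i → ℚ.*-assoc (a i) (p i w) (g w)))) ⟩
      ∑ (λ w → ∑ (λ i → a i * (p i w * g w)))
        ≡⟨ ∑-swap (λ w i → a i * (p i w * g w)) ⟩
      ∑ (λ i → ∑ (λ w → a i * (p i w * g w)))
        ≡⟨ ∑-cong (λ i → ∑-* (a i) (λ w → p i w * g w)) ⟩
      ∑ (λ i → a i * ⟪ p i , g ⟫) ∎
      where open ≡-Reasoning

  -- Project the vectors h orthogonally to the first spanning vector and induct.
  bessel : ∀ s {n l} (p : Fin s → Fin n → ℚ) (ν : Fin s → ℚ) (h : Fin l → Fin n → ℚ) (a : Fin l → Fin s → ℚ) {C} →
    0ℚ ≤ C → (∀ i → 0ℚ ≤ ν i) → (∀ i → (∀ w → p i w ≡ 0ℚ) ⊎ ν i ≡ 1ℚ) →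
    (∀ x w → h x w ≡ ∑ (λ i → a x i * p i w)) →
    (∀ u → ∑ (λ x → ⟪ h x , u ⟫ * ⟪ h x , u ⟫) ≤ C * ⟪ u , u ⟫) →
    ∑ (λ x → ⟪ h x , h x ⟫) ≤ C * ∑ ν
  bessel zero {n} {l} p ν h a {C} C≥0 ν≥0 cases span bound = ≤-reflexive (begin
    ∑ (λ x → ⟪ h x , h x ⟫)  ≡⟨ ∑-cong (λ x → trans (∑-cong (λ w → trans (cong (_* h x w) (span x w)) (ℚ.*-zeroˡ (h x w)))) (∑-0 n)) ⟩
    ∑ {l} (λ x → 0ℚ)         ≡⟨ ∑-0 l ⟩
    0ℚ                       ≡⟨ ℚ.*-zeroʳ C ⟨
    C * 0ℚ                   ∎)
    where open ≡-Reasoning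
  bessel (suc s) {n} {l} p ν h a {C} C≥0 ν≥0 cases span bound with ⟪ p zero , p zero ⟫ ℚ.≟ 0ℚ
  ... | yes N≡0 = ≤-trans
    (bessel s (p ∘ suc) (ν ∘ suc) h (λ x → a x ∘ suc) C≥0 (ν≥0 ∘ suc) (cases ∘ suc) span′ bound)
    (*-mono-≤ˡ C≥0 (≤-by (ν≥0 zero) (ℚ.+-comm (ν zero) (∑ (ν ∘ suc)))))
    where
    p₀≡0 : ∀ w → p zero w ≡ 0ℚ
    p₀≡0 w = sq≡0 (∑≡0⇒≡0 (λ w → sq≥0 (p zero w)) N≡0 w)
    span′ : ∀ x w → h x w ≡ ∑ (λ i → a x (suc i) * p (suc i) w)
    span′ x w = trans (span x w) (trans
      (cong (_+ ∑ (λ i → a x (suc i) * p (suc i) w)) (trans (cong (a x zero *_) (p₀≡0 w)) (ℚ.*-zeroʳ (a x zero))))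
      (ℚ.+-identityˡ _))
  ... | no N≢0 = begin
    ∑ (λ x → ⟪ h x , h x ⟫)
      -- Pythagoras. By `bound` at `p₀`, the components along `p₀` contribute at most `C`
      -- altogether, which is what `ν zero = 1` pays for; thus `∑ ν` stands for the dimension of the
      -- span.
      ≡⟨ ∑-cong (λ x → proj-norm (h x)) ⟩
    ∑ (λ x → ⟪ proj (h x) , proj (h x) ⟫ + N ⁻¹ * (⟪ h x , p₀ ⟫ * ⟪ h x , p₀ ⟫))
      ≡⟨ trans (∑-+ (λ x → ⟪ proj (h x) , proj (h x) ⟫) (λ x → N ⁻¹ * (⟪ h x , p₀ ⟫ * ⟪ h x , p₀ ⟫)))
           (cong (_+_ (∑ (λ x → ⟪ proj (h x) , proj (h x) ⟫))) (∑-* (N ⁻¹) (λ x → ⟪ h x , p₀ ⟫ * ⟪ h x , p₀ ⟫))) ⟩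
    ∑ (λ x → ⟪ proj (h x) , proj (h x) ⟫) + N ⁻¹ * ∑ (λ x → ⟪ h x , p₀ ⟫ * ⟪ h x , p₀ ⟫)
      ≤⟨ ℚ.+-mono-≤
           (bessel s (proj ∘ p ∘ suc) (ν ∘ suc) (proj ∘ h) (λ x → a x ∘ suc) C≥0 (ν≥0 ∘ suc) cases′ span′ bound′)
           (*-mono-≤ˡ (<⇒≤ N⁻¹>0) (bound p₀)) ⟩
    C * ∑ (ν ∘ suc) + N ⁻¹ * (C * N)
      ≡⟨ solve 4 (λ c s i n → c :* s :+ i :* (c :* n) := c :* (n :* i :+ s)) refl C (∑ (ν ∘ suc)) (N ⁻¹) N ⟩
    C * (N * N ⁻¹ + ∑ (ν ∘ suc))
      ≡⟨ cong (λ e → C * (e + ∑ (ν ∘ suc))) (trans (*-inverseʳ N≢0) (sym ν₀≡1)) ⟩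
    C * (ν zero + ∑ (ν ∘ suc)) ∎
    where
    open ℚ.≤-Reasoning
    p₀ = p zero
    N = ⟪ p₀ , p₀ ⟫
    N>0 : 0ℚ < N
    N>0 = ≥∧≢⇒> (⟪⟫≥0 p₀) N≢0
    N⁻¹>0 : 0ℚ < N ⁻¹
    N⁻¹>0 = ⁻¹>0 N>0
    ν₀≡1 : ν zero ≡ 1ℚ
    ν₀≡1 with cases zero
    ... | inj₂ eq   = eq
    ... | inj₁ p₀≡0 = contradiction
      (trans (∑-cong (λ w → trans (cong (_* p₀ w) (p₀≡0 w)) (ℚ.*-zeroˡ (p₀ w)))) (∑-0 n)) N≢0
    t : (Fin n → ℚ) → ℚ
    t u = ⟪ u , p₀ ⟫ * N ⁻¹
    proj : (Fin n → ℚ) → Fin n → ℚ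
    proj u w = u w - t u * p₀ w
    ⟪p₀,proj⟫ : ∀ u → ⟪ p₀ , proj u ⟫ ≡ 0ℚ
    ⟪p₀,proj⟫ u = trans (⟪⟫-subʳ p₀ u p₀ (t u)) (trans
      (trans (cong (_- t u * N) (⟪⟫-comm p₀ u))
        (solve 3 (λ a i n → a :- a :* i :* n := a :* (con 1ℚ :- n :* i)) refl ⟪ u , p₀ ⟫ (N ⁻¹) N))
      (trans (cong (λ e → ⟪ u , p₀ ⟫ * (1ℚ - e)) (*-inverseʳ N≢0)) (ℚ.*-zeroʳ ⟪ u , p₀ ⟫)))
    proj-norm : ∀ u → ⟪ u , u ⟫ ≡ ⟪ proj u , proj u ⟫ + N ⁻¹ * (⟪ u , p₀ ⟫ * ⟪ u , p₀ ⟫)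
    proj-norm u = sym (trans
      (cong (_+ N ⁻¹ * (⟪ u , p₀ ⟫ * ⟪ u , p₀ ⟫)) (trans (⟪⟫-subˡ u p₀ (proj u) (t u))
        (cong₂ (λ a b → a - t u * b) (⟪⟫-subʳ u u p₀ (t u)) (⟪p₀,proj⟫ u))))
      (solve 3 (λ a b i → a :- b :* i :* b :- b :* i :* con 0ℚ :+ i :* (b :* b) := a) refl ⟪ u , u ⟫ ⟪ u , p₀ ⟫ (N ⁻¹)))
    proj-adjoint : ∀ u u′ → ⟪ proj u , u′ ⟫ ≡ ⟪ u , proj u′ ⟫
    proj-adjoint u u′ = trans (⟪⟫-subˡ u p₀ u′ (t u)) (trans
      (cong (λ e → ⟪ u , u′ ⟫ - t u * e) (⟪⟫-comm p₀ u′))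
      (trans (solve 4 (λ g a b i → g :- a :* i :* b := g :- b :* i :* a) refl ⟪ u , u′ ⟫ ⟪ u , p₀ ⟫ ⟪ u′ , p₀ ⟫ (N ⁻¹))
        (sym (⟪⟫-subʳ u u′ p₀ (t u′)))))
    -- The projection is self-adjoint and does not lengthen vectors, so the constant `C` is
    -- inherited.
    bound′ : ∀ u → ∑ (λ x → ⟪ proj (h x) , u ⟫ * ⟪ proj (h x) , u ⟫) ≤ C * ⟪ u , u ⟫
    bound′ u = begin
      ∑ (λ x → ⟪ proj (h x) , u ⟫ * ⟪ proj (h x) , u ⟫)
        ≡⟨ ∑-cong (λ x → cong (λ e → e * e) (proj-adjoint (h x) u)) ⟩
      ∑ (λ x → ⟪ h x , proj u ⟫ * ⟪ h x , proj u ⟫)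
        ≤⟨ bound (proj u) ⟩
      C * ⟪ proj u , proj u ⟫
        ≤⟨ *-mono-≤ˡ C≥0 (≤-by (<⇒≤ N⁻¹>0 ⊛ sq≥0 ⟪ u , p₀ ⟫) (proj-norm u)) ⟩
      C * ⟪ u , u ⟫ ∎
    cases′ : ∀ i → (∀ w → proj (p (suc i)) w ≡ 0ℚ) ⊎ ν (suc i) ≡ 1ℚ
    cases′ i with cases (suc i)
    ... | inj₂ eq  = inj₂ eq
    ... | inj₁ p≡0 = inj₁ λ w → trans (cong₂ (λ a b → a - b * N ⁻¹ * p₀ w) (p≡0 w)
            (trans (∑-cong (λ u → trans (cong (_* p₀ u) (p≡0 u)) (ℚ.*-zeroˡ (p₀ u)))) (∑-0 n)))
            (solve 2 (λ i p → con 0ℚ :- con 0ℚ :* i :* p := con 0ℚ) refl (N ⁻¹) (p₀ w))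
    span′ : ∀ x w → proj (h x) w ≡ ∑ (λ i → a x (suc i) * proj (p (suc i)) w)
    span′ x w = begin-equality
      h x w - ⟪ h x , p₀ ⟫ * N ⁻¹ * p₀ w
        ≡⟨ cong₂ (λ a b → a - b * N ⁻¹ * p₀ w) (span x w)
             (trans (∑-cong (λ u → cong (_* p₀ u) (span x u))) (⟪⟫-∑ˡ (a x) p p₀)) ⟩
      (a₀ * p₀ w + R) - (a₀ * N + S) * N ⁻¹ * p₀ w
        ≡⟨ solve 6 (λ a p r n s i → (a :* p :+ r) :- (a :* n :+ s) :* i :* p := a :* p :* (con 1ℚ :- n :* i) :+ (r :- s :* (i :* p)))
             refl a₀ (p₀ w) R N S (N ⁻¹) ⟩
      a₀ * p₀ w * (1ℚ - N * N ⁻¹) + (R - S * (N ⁻¹ * p₀ w))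
        ≡⟨ cong (λ e → a₀ * p₀ w * (1ℚ - e) + (R - S * (N ⁻¹ * p₀ w))) (*-inverseʳ N≢0) ⟩
      a₀ * p₀ w * 0ℚ + (R - S * (N ⁻¹ * p₀ w))
        ≡⟨ trans (cong (_+ (R - S * (N ⁻¹ * p₀ w))) (ℚ.*-zeroʳ (a₀ * p₀ w))) (ℚ.+-identityˡ _) ⟩
      R - S * (N ⁻¹ * p₀ w)
        ≡⟨ cong (λ e → R - e) (∑-*ʳ (λ i → a x (suc i) * ⟪ p (suc i) , p₀ ⟫) (N ⁻¹ * p₀ w)) ⟨
      R - ∑ (λ i → a x (suc i) * ⟪ p (suc i) , p₀ ⟫ * (N ⁻¹ * p₀ w))
        ≡⟨ ∑-- (λ i → a x (suc i) * p (suc i) w) (λ i → a x (suc i) * ⟪ p (suc i) , p₀ ⟫ * (N ⁻¹ * p₀ w)) ⟨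
      ∑ (λ i → a x (suc i) * p (suc i) w - a x (suc i) * ⟪ p (suc i) , p₀ ⟫ * (N ⁻¹ * p₀ w))
        ≡⟨ ∑-cong (λ i → solve 5 (λ a p b i q → a :* p :- a :* b :* (i :* q) := a :* (p :- b :* i :* q)) refl
             (a x (suc i)) (p (suc i) w) ⟪ p (suc i) , p₀ ⟫ (N ⁻¹) (p₀ w)) ⟩
      ∑ (λ i → a x (suc i) * proj (p (suc i)) w) ∎
      where
      a₀ = a x zero
      R = ∑ (λ i → a x (suc i) * p (suc i) w)
      S = ∑ (λ i → a x (suc i) * ⟪ p (suc i) , p₀ ⟫)

  -- Clique partitions of the edges

  module Geometry {v s : ℕ} (adj : Fin v → Fin v → Bool)
    (adj-irrefl : ∀ x → adj x x ≡ false) (adj-sym : ∀ x y → adj x y ≡ adj y x)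
    (M : Fin s → Fin v → Bool)
    (pair : ∀ {x y} → adj x y ≡ true → ∑ (λ i → 𝟙 (M i x) * 𝟙 (M i y)) ≡ 1ℚ)
    (clique : ∀ {i x y} → M i x ≡ true → M i y ≡ true → x ≢ y → adj x y ≡ true)
    (r β : ℚ)
    (degree : ∀ x → ∑ (λ z → 𝟙 (adj x z)) ≡ r * β)
    where

    open SimpleGraph adj adj-irrefl adj-sym using (trichotomy; adj⇒≢; nonadj⇒≢; nonadj⇒¬adj)

    t : Fin v → ℚ
    t x = ∑ (λ i → 𝟙 (M i x))

    size : Fin s → ℚ
    size i = ∑ (λ x → 𝟙 (M i x))

    𝟙-idem : ∀ a → 𝟙 a * 𝟙 a ≡ 𝟙 a
    𝟙-idem true  = refl
    𝟙-idem false = refl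

    -- Adjacent vertices share exactly one line and distinct non-adjacent ones share none: the
    -- product of the transposed incidence matrix with itself is the adjacency matrix plus the
    -- diagonal matrix of `t`.
    gram : ∀ x y → ∑ (λ i → 𝟙 (M i x) * 𝟙 (M i y)) ≡ 𝟙 (adj x y) + δ x y * t x
    gram x y with trichotomy x y
    ... | inj₁ refl rewrite adj-irrefl x | ==-refl x = trans (∑-cong (λ i → 𝟙-idem (M i x)))
      (solve 1 (λ t → t := con 0ℚ :+ con 1ℚ :* t) refl (t x))
    ... | inj₂ (inj₁ x~y) rewrite ≢⇒==-false (adj⇒≢ x~y) | x~y = trans (pair x~y)
      (solve 1 (λ t → con 1ℚ := con 1ℚ :+ con 0ℚ :* t) refl (t x))
    ... | inj₂ (inj₂ x≁y) rewrite ≢⇒==-false (nonadj⇒≢ x≁y) | nonadj⇒¬adj x≁y = trans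
      (trans (∑-cong (λ i → zero′ i)) (∑-0 s)) (solve 1 (λ t → con 0ℚ := con 0ℚ :+ con 0ℚ :* t) refl (t x))
      where
      zero′ : ∀ i → 𝟙 (M i x) * 𝟙 (M i y) ≡ 0ℚ
      zero′ i = trans (weighted-≡ (M i x) λ Mx → cong 𝟙 (¬true⇒false λ My →
          true≢false (clique Mx My (nonadj⇒≢ x≁y)) (nonadj⇒¬adj x≁y)))
        (ℚ.*-zeroʳ (𝟙 (M i x)))

    gram-apply : ∀ (f : Fin v → ℚ) x →
      ∑ (λ i → 𝟙 (M i x) * ∑ (λ y → 𝟙 (M i y) * f y)) ≡ ∑ (λ y → 𝟙 (adj x y) * f y) + t x * f x
    gram-apply f x = begin
      ∑ (λ i → 𝟙 (M i x) * ∑ (λ y → 𝟙 (M i y) * f y))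
        ≡⟨ ∑-cong (λ i → trans (sym (∑-* (𝟙 (M i x)) (λ y → 𝟙 (M i y) * f y)))
             (∑-cong (λ y → sym (ℚ.*-assoc (𝟙 (M i x)) (𝟙 (M i y)) (f y))))) ⟩
      ∑ (λ i → ∑ (λ y → 𝟙 (M i x) * 𝟙 (M i y) * f y))
        ≡⟨ ∑-swap (λ i y → 𝟙 (M i x) * 𝟙 (M i y) * f y) ⟩
      ∑ (λ y → ∑ (λ i → 𝟙 (M i x) * 𝟙 (M i y) * f y))
        ≡⟨ ∑-cong (λ y → trans (∑-*ʳ (λ i → 𝟙 (M i x) * 𝟙 (M i y)) (f y)) (trans (cong (_* f y) (gram x y))
             (solve 4 (λ a d t f → (a :+ d :* t) :* f := a :* f :+ d :* (t :* f)) refl (𝟙 (adj x y)) (δ x y) (t x) (f y)))) ⟩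
      ∑ (λ y → 𝟙 (adj x y) * f y + δ x y * (t x * f y))
        ≡⟨ trans (∑-+ (λ y → 𝟙 (adj x y) * f y) (λ y → δ x y * (t x * f y)))
             (cong (_+_ (∑ (λ y → 𝟙 (adj x y) * f y))) (∑-δ x (λ y → t x * f y))) ⟩
      ∑ (λ y → 𝟙 (adj x y) * f y) + t x * f x ∎
      where open ≡-Reasoning

    ∑-size : ∀ x → ∑ (λ i → 𝟙 (M i x) * size i) ≡ r * β + t x
    ∑-size x = begin
      ∑ (λ i → 𝟙 (M i x) * size i)
        ≡⟨ ∑-cong (λ i → cong (𝟙 (M i x) *_) (∑-cong (λ y → sym (ℚ.*-identityʳ (𝟙 (M i y)))))) ⟩
      ∑ (λ i → 𝟙 (M i x) * ∑ (λ y → 𝟙 (M i y) * 1ℚ))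
        ≡⟨ gram-apply (λ _ → 1ℚ) x ⟩
      ∑ (λ y → 𝟙 (adj x y) * 1ℚ) + t x * 1ℚ
        ≡⟨ cong₂ _+_ (trans (∑-cong (λ y → ℚ.*-identityʳ (𝟙 (adj x y)))) (degree x)) (ℚ.*-identityʳ (t x)) ⟩
      r * β + t x ∎
      where open ≡-Reasoning

    -- Affine functions of the line sizes can be summed over the lines through `x` without knowing
    -- the sizes; suitable `a` and `b` bound `t x` from both sides.
    ∑-slack : ∀ x a b → ∑ (λ i → 𝟙 (M i x) * (a + b * size i)) ≡ t x * a + b * (r * β + t x)
    ∑-slack x a b = begin
      ∑ (λ i → 𝟙 (M i x) * (a + b * size i))
        ≡⟨ ∑-cong (λ i → solve 4 (λ m a b s → m :* (a :+ b :* s) := m :* a :+ b :* (m :* s)) refl (𝟙 (M i x)) a b (size i)) ⟩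
      ∑ (λ i → 𝟙 (M i x) * a + b * (𝟙 (M i x) * size i))
        ≡⟨ ∑-+ (λ i → 𝟙 (M i x) * a) (λ i → b * (𝟙 (M i x) * size i)) ⟩
      ∑ (λ i → 𝟙 (M i x) * a) + ∑ (λ i → b * (𝟙 (M i x) * size i))
        ≡⟨ cong₂ _+_ (∑-*ʳ (λ i → 𝟙 (M i x)) a) (trans (∑-* b (λ i → 𝟙 (M i x) * size i)) (cong (b *_) (∑-size x))) ⟩
      t x * a + b * (r * β + t x) ∎
      where open ≡-Reasoning

    -- Short lines, vertices with excess, and their absence

    module Fullness (Z : Fin v → Fin v → ℚ) (c : ℚ)
      (r>0 : 0ℚ < r) (21r≤β : ι 21 * r ≤ β) (1≤c : 1ℚ ≤ c) (c≤2 : c ≤ ι 2)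
      (size-large : ∀ i → ι 11 * β ≤ ι 14 * (size i - 1ℚ))
      (Z-sym : ∀ x y → Z x y ≡ Z y x)
      (Z-diag : ∀ x → Z x x ≡ 1ℚ)
      (Z-adj : ∀ {x y} → adj x y ≡ true → β * Z x y ≡ - 1ℚ)
      (Z-eigen : ∀ x w → ∑ (λ y → 𝟙 (adj x y) * Z y w) ≡ - r * Z x w)
      (Z-square : ∀ x y → ∑ (λ z → Z x z * Z z y) ≡ c * Z x y)
      where

      β>0 : 0ℚ < β
      β>0 = <-≤-trans (0<* (ι>0 20) r>0) 21r≤β

      c>0 : 0ℚ < c
      c>0 = <-≤-trans (ι>0 0) 1≤c

      p : Fin s → Fin v → ℚ
      p i w = ∑ (λ y → 𝟙 (M i y) * Z y w)

      ∑-p : ∀ x w → ∑ (λ i → 𝟙 (M i x) * p i w) ≡ (t x - r) * Z x w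
      ∑-p x w = trans (gram-apply (λ y → Z y w) x) (trans (cong (_+ t x * Z x w) (Z-eigen x w))
        (solve 3 (λ r t z → :- r :* z :+ t :* z := (t :- r) :* z) refl r (t x) (Z x w)))

      ⟪Z,Z⟫ : ∀ x y → ⟪ Z x , Z y ⟫ ≡ c * Z x y
      ⟪Z,Z⟫ x y = trans (∑-cong (λ w → cong (Z x w *_) (Z-sym y w))) (Z-square x y)

      -- Because `Z² = c Z`, the squared norm is the sum of `c * Z y z` over all pairs of vertices
      -- of the line, where the diagonal entries are 1 and the others `-1/β`. Nonnegativity is the
      -- Delsarte bound `slack≥0`; for a full line the norm is 0 and `p i` vanishes.
      p-norm : ∀ i → β * ⟪ p i , p i ⟫ ≡ c * size i * (β + 1ℚ - size i)
      p-norm i = begin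
        β * ⟪ p i , p i ⟫
          ≡⟨ cong (β *_) (⟪⟫-∑ˡ μ Z (p i)) ⟩
        β * ∑ (λ y → μ y * ⟪ Z y , p i ⟫)
          ≡⟨ cong (β *_) (∑-cong (λ y → cong (μ y *_) (trans (⟪⟫-comm (Z y) (p i)) (⟪⟫-∑ˡ μ Z (Z y))))) ⟩
        β * ∑ (λ y → μ y * ∑ (λ z → μ z * ⟪ Z z , Z y ⟫))
          ≡⟨ ∑-* β (λ y → μ y * ∑ (λ z → μ z * ⟪ Z z , Z y ⟫)) ⟨
        ∑ (λ y → β * (μ y * ∑ (λ z → μ z * ⟪ Z z , Z y ⟫)))
          ≡⟨ ∑-cong (λ y → trans (solve 3 (λ b m s → b :* (m :* s) := m :* (b :* s)) refl β (μ y) (∑ (λ z → μ z * ⟪ Z z , Z y ⟫)))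
               (weighted-≡ (M i y) (inner y))) ⟩
        ∑ (λ y → μ y * (μ y * (c * (β + 1ℚ)) - c * size i))
          ≡⟨ ∑-cong (λ y → trans (solve 3 (λ m a b → m :* (m :* a :- b) := m :* m :* a :- m :* b) refl (μ y) (c * (β + 1ℚ)) (c * size i))
               (trans (cong (λ e → e * (c * (β + 1ℚ)) - μ y * (c * size i)) (𝟙-idem (M i y)))
               (solve 3 (λ m a b → m :* a :- m :* b := m :* (a :- b)) refl (μ y) (c * (β + 1ℚ)) (c * size i)))) ⟩
        ∑ (λ y → μ y * (c * (β + 1ℚ) - c * size i))
          ≡⟨ ∑-*ʳ μ (c * (β + 1ℚ) - c * size i) ⟩
        size i * (c * (β + 1ℚ) - c * size i)
          ≡⟨ solve 3 (λ s c b → s :* (c :* (b :+ con 1ℚ) :- c :* s) := c :* s :* (b :+ con 1ℚ :- s)) refl (size i) c β ⟩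
        c * size i * (β + 1ℚ - size i) ∎
        where
        open ≡-Reasoning
        μ : Fin v → ℚ
        μ y = 𝟙 (M i y)
        βZ : ∀ {y z} → M i y ≡ true → M i z ≡ true → β * Z z y ≡ δ y z * (β + 1ℚ) - 1ℚ
        βZ {y} {z} My Mz with y Fin.≟ z
        ... | yes refl = trans (cong (β *_) (Z-diag y)) (solve 1 (λ b → b :* con 1ℚ := con 1ℚ :* (b :+ con 1ℚ) :- con 1ℚ) refl β)
        ... | no y≢z   = trans (Z-adj (clique Mz My (y≢z ∘ sym))) (solve 1 (λ b → con (- 1ℚ) := con 0ℚ :* (b :+ con 1ℚ) :- con 1ℚ) refl β)
        inner : ∀ y → M i y ≡ true → β * ∑ (λ z → μ z * ⟪ Z z , Z y ⟫) ≡ μ y * (c * (β + 1ℚ)) - c * size i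
        inner y My = begin
          β * ∑ (λ z → μ z * ⟪ Z z , Z y ⟫)
            ≡⟨ ∑-* β (λ z → μ z * ⟪ Z z , Z y ⟫) ⟨
          ∑ (λ z → β * (μ z * ⟪ Z z , Z y ⟫))
            ≡⟨ ∑-cong (λ z → trans (cong (λ e → β * (μ z * e)) (⟪Z,Z⟫ z y))
                 (trans (solve 4 (λ b m c z → b :* (m :* (c :* z)) := m :* (c :* (b :* z))) refl β (μ z) c (Z z y))
                 (trans (weighted-≡ (M i z) (λ Mz → cong (c *_) (βZ My Mz)))
                 (solve 4 (λ m c d b → m :* (c :* (d :* b :- con 1ℚ)) := d :* (m :* (c :* b)) :- c :* m) refl (μ z) c (δ y z) (β + 1ℚ))))) ⟩
          ∑ (λ z → δ y z * (μ z * (c * (β + 1ℚ))) - c * μ z)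
            ≡⟨ ∑-- (λ z → δ y z * (μ z * (c * (β + 1ℚ)))) (λ z → c * μ z) ⟩
          ∑ (λ z → δ y z * (μ z * (c * (β + 1ℚ)))) - ∑ (λ z → c * μ z)
            ≡⟨ cong₂ _-_ (∑-δ y (λ z → μ z * (c * (β + 1ℚ)))) (∑-* c μ) ⟩
          μ y * (c * (β + 1ℚ)) - c * size i ∎

      size>0 : ∀ i → 0ℚ < size i
      size>0 i = ℚ.*-cancelˡ-<-nonNeg (ι 14) (<-by
        (ℚ.+-mono-<-≤ (0<* (ι>0 10) β>0) (diff≥0 (size-large i) ⊕ ι≥0 14))
        (solve 2 (λ s b → con (ι 14) :* s := con (ι 14) :* con 0ℚ :+ (con (ι 11) :* b :+ (con (ι 14) :* (s :- con 1ℚ) :- con (ι 11) :* b :+ con (ι 14)))) refl (size i) β))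

      slack≥0 : ∀ i → 0ℚ ≤ β + 1ℚ - size i
      slack≥0 i = *-cancel-≤ (0<* c>0 (size>0 i)) (subst₂ _≤_ (sym (ℚ.*-zeroʳ (c * size i))) (p-norm i)
        (<⇒≤ β>0 ⊛ ⟪⟫≥0 (p i)))

      short : Fin s → Bool
      short i = size i <ᵇ β + 1ℚ

      ¬short⇒full : ∀ {i} → short i ≡ false → β + 1ℚ - size i ≡ 0ℚ
      ¬short⇒full {i} ¬si = ≤-antisym (subst (β + 1ℚ - size i ≤_) (ℚ.+-inverseʳ (size i))
        (ℚ.+-monoˡ-≤ (- size i) (<ᵇ-false ¬si))) (slack≥0 i)

      ¬short⇒p≡0 : ∀ {i} → short i ≡ false → ∀ w → p i w ≡ 0ℚ
      ¬short⇒p≡0 {i} ¬si w = sq≡0 (∑≡0⇒≡0 (λ w → sq≥0 (p i w)) (*-cancel-≡ (>⇒≢0 β>0)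
        (trans (p-norm i) (trans (cong (c * size i *_) (¬short⇒full ¬si)) (trans (ℚ.*-zeroʳ (c * size i)) (sym (ℚ.*-zeroʳ β)))))) w)

      -- If all lines through `x` were full, they would contain `β * t x` neighbours of `x` in place
      -- of `r * β`. So the slack on the lines through a vertex measures how many lines it has
      -- beyond `r`.
      ∑-slack′ : ∀ x → ∑ (λ i → 𝟙 (M i x) * (β + 1ℚ - size i)) ≡ β * (t x - r)
      ∑-slack′ x = trans (∑-cong (λ i → cong (𝟙 (M i x) *_) (solve 2 (λ b s → b :+ con 1ℚ :- s := b :+ con 1ℚ :+ con (- 1ℚ) :* s) refl β (size i))))
        (trans (∑-slack x (β + 1ℚ) (- 1ℚ))
        (solve 3 (λ t b r → t :* (b :+ con 1ℚ) :+ con (- 1ℚ) :* (r :* b :+ t) := b :* (t :- r)) refl (t x) β r))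

      t≥r : ∀ x → 0ℚ ≤ t x - r
      t≥r x = *-cancel-≤ β>0 (subst₂ _≤_ (sym (ℚ.*-zeroʳ β)) (∑-slack′ x)
        (∑≥0 (λ i → 𝟙≥0 (M i x) ⊛ slack≥0 i)))

      -- Each line through `x` contains at least `11β/14` of the `r β` neighbours of `x`, and no
      -- neighbour lies on two of these lines.
      11t≤14r : ∀ x → ι 11 * t x ≤ ι 14 * r
      11t≤14r x = *-cancel-≤ β>0 (≤-by (∑≥0 (λ i → 𝟙≥0 (M i x) ⊛ nonneg i)) (trans
        (solve 3 (λ b t r → b :* (con (ι 14) :* r) := b :* (con (ι 11) :* t) :+
            (t :* (con (- ι 14) :+ :- (con (ι 11) :* b)) :+ con (ι 14) :* (r :* b :+ t))) refl β (t x) r)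
        (cong (_+_ (β * (ι 11 * t x))) (sym (∑-slack x (- ι 14 + - (ι 11 * β)) (ι 14))))))
        where
        nonneg : ∀ i → 0ℚ ≤ - ι 14 + - (ι 11 * β) + ι 14 * size i
        nonneg i = subst (0ℚ ≤_) (solve 2 (λ s b → con (ι 14) :* (s :- con 1ℚ) :- b := con (- ι 14) :+ :- b :+ con (ι 14) :* s) refl (size i) (ι 11 * β))
          (diff≥0 (size-large i))

      excess : Fin v → Bool
      excess x = r <ᵇ t x

      ¬excess⇒full : ∀ {x} i → excess x ≡ false → M i x ≡ true → short i ≡ false
      ¬excess⇒full {x} i ¬ex Mix = ¬true⇒false λ si → contradiction (<ᵇ-true si)
        (≤⇒≯ (≤-by (ι≥0 0) (trans (solve 2 (λ b s → s := b :- (b :- s)) refl (β + 1ℚ) (size i)) (trans (cong (λ e → β + 1ℚ - e) full)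
          (solve 1 (λ b → b :- con 0ℚ := b :+ con 0ℚ) refl (β + 1ℚ))))))
        where
        t-r≡0 : t x - r ≡ 0ℚ
        t-r≡0 = ≤-antisym (subst (t x - r ≤_) (ℚ.+-inverseʳ r) (ℚ.+-monoˡ-≤ (- r) (<ᵇ-false ¬ex))) (t≥r x)
        full : β + 1ℚ - size i ≡ 0ℚ
        full = trans (sym (ℚ.*-identityˡ (β + 1ℚ - size i))) (trans (cong (λ a → 𝟙 a * (β + 1ℚ - size i)) (sym Mix))
          (∑≡0⇒≡0 (λ i → 𝟙≥0 (M i x) ⊛ slack≥0 i) (trans (∑-slack′ x) (trans (cong (β *_) t-r≡0) (ℚ.*-zeroʳ β))) i))

      ∑-short≤ : ∀ x → ∑ (λ i → 𝟙 (short i) * 𝟙 (M i x)) ≤ 𝟙 (excess x) * t x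
      ∑-short≤ x with excess x in ex
      ... | true  = subst (∑ (λ i → 𝟙 (short i) * 𝟙 (M i x)) ≤_) (sym (ℚ.*-identityˡ (t x))) (∑-mono λ i →
        subst₂ _≤_ (𝟙-∧ (short i) (M i x)) refl (𝟙-mono {short i ∧ M i x} λ h → proj₂ (∧-true {short i} h)))
      ... | false = ≤-reflexive (trans (trans (∑-cong λ i → trans (sym (𝟙-∧ (short i) (M i x)))
          (cong 𝟙 (¬true⇒false λ h → let si , Mix = ∧-true {short i} h in true≢false si (¬excess⇒full i ex Mix))))
        (∑-0 s)) (sym (ℚ.*-zeroˡ (t x))))

      -- Since `Z² = c Z`, the vector `Zu` satisfies `|Zu|² = c ⟨u, Zu⟩`, and therefore
      -- `|Zu - c u|² = c² |u|² - |Zu|²`.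
      Z-bound : ∀ u → ∑ (λ x → ⟪ Z x , u ⟫ * ⟪ Z x , u ⟫) ≤ c * c * ⟪ u , u ⟫
      Z-bound u = ≤-by (⟪⟫≥0 (λ x → Zu x - c * u x)) (begin
        c * c * ⟪ u , u ⟫
          ≡⟨ solve 4 (λ c a b u → c :* c :* u := a :+ (a :- c :* b :- c :* (b :- c :* u) :+ con (ι 2) :* (c :* b :- a))) refl c ⟪ Zu , Zu ⟫ ⟪ u , Zu ⟫ ⟪ u , u ⟫ ⟩
        ⟪ Zu , Zu ⟫ + (⟪ Zu , Zu ⟫ - c * ⟪ u , Zu ⟫ - c * (⟪ u , Zu ⟫ - c * ⟪ u , u ⟫) + ι 2 * (c * ⟪ u , Zu ⟫ - ⟪ Zu , Zu ⟫))
          ≡⟨ cong (_+_ ⟪ Zu , Zu ⟫) (trans (cong (λ e → ⟪ Zu , Zu ⟫ - c * ⟪ u , Zu ⟫ - c * (⟪ u , Zu ⟫ - c * ⟪ u , u ⟫) + ι 2 * (e - ⟪ Zu , Zu ⟫)) (sym Zu-norm))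
               (trans (cong₂ (λ a b → ⟪ Zu , Zu ⟫ - c * a - c * b + ι 2 * (⟪ Zu , Zu ⟫ - ⟪ Zu , Zu ⟫)) (⟪⟫-comm u Zu)
                  (trans (cong (_- c * ⟪ u , u ⟫) (⟪⟫-comm u Zu)) (sym (⟪⟫-subˡ Zu u u c))))
               (trans (cong (λ e → ⟪ Zu , Zu ⟫ - c * ⟪ Zu , u ⟫ - c * e + ι 2 * (⟪ Zu , Zu ⟫ - ⟪ Zu , Zu ⟫)) (⟪⟫-comm (λ x → Zu x - c * u x) u))
               (trans (solve 4 (λ a b c d → a :- c :* b :- c :* d :+ con (ι 2) :* (a :- a) := a :- c :* b :- c :* d) refl ⟪ Zu , Zu ⟫ ⟪ Zu , u ⟫ c ⟪ u , (λ x → Zu x - c * u x) ⟫)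
               (sym (trans (⟪⟫-subˡ Zu u (λ x → Zu x - c * u x) c) (cong (_- c * ⟪ u , (λ x → Zu x - c * u x) ⟫) (⟪⟫-subʳ Zu Zu u c)))))))) ⟩
        ⟪ Zu , Zu ⟫ + ⟪ (λ x → Zu x - c * u x) , (λ x → Zu x - c * u x) ⟫ ∎)
        where
        open ≡-Reasoning
        Zu : Fin v → ℚ
        Zu x = ⟪ Z x , u ⟫
        apply : ∀ y → ∑ (λ x → Z x y * Zu x) ≡ c * Zu y
        apply y = begin
          ∑ (λ x → Z x y * Zu x)
            ≡⟨ ∑-cong (λ x → trans (cong (Z x y *_) (⟪⟫-comm (Z x) u)) (trans (sym (∑-* (Z x y) (λ z → u z * Z x z)))
                 (∑-cong (λ z → solve 3 (λ a u b → a :* (u :* b) := u :* (a :* b)) refl (Z x y) (u z) (Z x z))))) ⟩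
          ∑ (λ x → ∑ (λ z → u z * (Z x y * Z x z)))
            ≡⟨ ∑-swap (λ x z → u z * (Z x y * Z x z)) ⟩
          ∑ (λ z → ∑ (λ x → u z * (Z x y * Z x z)))
            ≡⟨ ∑-cong (λ z → trans (∑-* (u z) (λ x → Z x y * Z x z)) (cong (u z *_)
                 (trans (∑-cong (λ x → cong (_* Z x z) (Z-sym x y))) (Z-square y z)))) ⟩
          ∑ (λ z → u z * (c * Z y z))
            ≡⟨ trans (∑-cong (λ z → solve 3 (λ u c z → u :* (c :* z) := c :* (z :* u)) refl (u z) c (Z y z))) (∑-* c (λ z → Z y z * u z)) ⟩
          c * Zu y ∎
        Zu-norm : ⟪ Zu , Zu ⟫ ≡ c * ⟪ u , Zu ⟫
        Zu-norm = begin
          ∑ (λ x → Zu x * Zu x)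
            ≡⟨ ∑-cong (λ x → trans (sym (∑-*ʳ (λ y → Z x y * u y) (Zu x)))
                 (∑-cong (λ y → solve 3 (λ a u b → a :* u :* b := u :* (a :* b)) refl (Z x y) (u y) (Zu x)))) ⟩
          ∑ (λ x → ∑ (λ y → u y * (Z x y * Zu x)))
            ≡⟨ ∑-swap (λ x y → u y * (Z x y * Zu x)) ⟩
          ∑ (λ y → ∑ (λ x → u y * (Z x y * Zu x)))
            ≡⟨ ∑-cong (λ y → trans (∑-* (u y) (λ x → Z x y * Zu x)) (cong (u y *_) (apply y))) ⟩
          ∑ (λ y → u y * (c * Zu y))
            ≡⟨ trans (∑-cong (λ y → solve 3 (λ u c z → u :* (c :* z) := c :* (u :* z)) refl (u y) c (Zu y))) (∑-* c (λ y → u y * Zu y)) ⟩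
          c * ⟪ u , Zu ⟫ ∎

      S X : ℚ
      S = ∑ (λ i → 𝟙 (short i))
      X = ∑ (λ x → 𝟙 (excess x))

      -- The rows of the vertices with excess have squared norm `c` and lie in the span of the
      -- `p i`, which vanish on full lines. Bessel's inequality with the constant `c²` gives
      -- `c X ≤ c² S`.
      X≤2S : X ≤ ι 2 * S
      X≤2S = ≤-trans (*-cancel-≤ c>0 (subst₂ _≤_ norm (ℚ.*-assoc c c S)
          (bessel s p (λ i → 𝟙 (short i)) h a (<⇒≤ c>0 ⊛ <⇒≤ c>0) (λ i → 𝟙≥0 (short i)) cases span bound)))
        (≤-trans (≤-reflexive (ℚ.*-comm c S)) (≤-trans (*-mono-≤ˡ (∑≥0 (λ i → 𝟙≥0 (short i))) c≤2) (≤-reflexive (ℚ.*-comm S (ι 2)))))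
        where
        h : Fin v → Fin v → ℚ
        h x w = 𝟙 (excess x) * Z x w
        a : Fin v → Fin s → ℚ
        -- The coefficients come from dividing `∑-p` by `t x - r`, which is positive at the vertices
        -- kept by the indicator.
        a x i = 𝟙 (excess x) * ((t x - r) ⁻¹ * 𝟙 (M i x))
        cases : ∀ i → (∀ w → p i w ≡ 0ℚ) ⊎ 𝟙 (short i) ≡ 1ℚ
        cases i with short i in si
        ... | true  = inj₂ refl
        ... | false = inj₁ (¬short⇒p≡0 si)
        span : ∀ x w → h x w ≡ ∑ (λ i → a x i * p i w)
        span x w = begin
          𝟙 (excess x) * Z x w
            ≡⟨ weighted-≡ (excess x) (λ ex → begin
                 Z x w                                 ≡⟨ ℚ.*-identityˡ (Z x w) ⟨
                 1ℚ * Z x w                            ≡⟨ cong (_* Z x w) (*-inverseʳ (>⇒≢0 (diff>0 (<ᵇ-true ex)))) ⟨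
                 (t x - r) * (t x - r) ⁻¹ * Z x w      ≡⟨ solve 3 (λ a b z → a :* b :* z := b :* (a :* z)) refl (t x - r) ((t x - r) ⁻¹) (Z x w) ⟩
                 (t x - r) ⁻¹ * ((t x - r) * Z x w)    ≡⟨ cong ((t x - r) ⁻¹ *_) (∑-p x w) ⟨
                 (t x - r) ⁻¹ * ∑ (λ i → 𝟙 (M i x) * p i w)  ∎) ⟩
          𝟙 (excess x) * ((t x - r) ⁻¹ * ∑ (λ i → 𝟙 (M i x) * p i w))
            ≡⟨ trans (cong (𝟙 (excess x) *_) (sym (∑-* ((t x - r) ⁻¹) (λ i → 𝟙 (M i x) * p i w))))
                 (sym (∑-* (𝟙 (excess x)) (λ i → (t x - r) ⁻¹ * (𝟙 (M i x) * p i w)))) ⟩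
          ∑ (λ i → 𝟙 (excess x) * ((t x - r) ⁻¹ * (𝟙 (M i x) * p i w)))
            ≡⟨ ∑-cong (λ i → solve 4 (λ e n m p → e :* (n :* (m :* p)) := e :* (n :* m) :* p) refl (𝟙 (excess x)) ((t x - r) ⁻¹) (𝟙 (M i x)) (p i w)) ⟩
          ∑ (λ i → a x i * p i w) ∎
          where open ≡-Reasoning
        ⟪h,⟫ : ∀ x u → ⟪ h x , u ⟫ ≡ 𝟙 (excess x) * ⟪ Z x , u ⟫
        ⟪h,⟫ x u = trans (∑-cong (λ w → ℚ.*-assoc (𝟙 (excess x)) (Z x w) (u w))) (∑-* (𝟙 (excess x)) (λ w → Z x w * u w))
        bound : ∀ u → ∑ (λ x → ⟪ h x , u ⟫ * ⟪ h x , u ⟫) ≤ c * c * ⟪ u , u ⟫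
        bound u = ≤-trans (∑-mono {v} λ x → drop (excess x) (⟪ Z x , u ⟫) (⟪h,⟫ x u)) (Z-bound u)
          where
          drop : ∀ e z {y} → y ≡ 𝟙 e * z → y * y ≤ z * z
          drop true  z refl = ≤-reflexive (cong (λ y → y * y) (ℚ.*-identityˡ z))
          drop false z refl = subst (_≤ z * z) (solve 1 (λ z → con 0ℚ := con 0ℚ :* z :* (con 0ℚ :* z)) refl z) (sq≥0 z)
        norm : ∑ (λ x → ⟪ h x , h x ⟫) ≡ c * X
        norm = trans (∑-cong λ x → begin
          ⟪ h x , h x ⟫                             ≡⟨ ⟪h,⟫ x (h x) ⟩
          𝟙 (excess x) * ⟪ Z x , h x ⟫              ≡⟨ cong (𝟙 (excess x) *_) (trans (⟪⟫-comm (Z x) (h x)) (⟪h,⟫ x (Z x))) ⟩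
          𝟙 (excess x) * (𝟙 (excess x) * ⟪ Z x , Z x ⟫)
            ≡⟨ cong (λ e → 𝟙 (excess x) * (𝟙 (excess x) * e)) (trans (⟪Z,Z⟫ x x) (trans (cong (c *_) (Z-diag x)) (ℚ.*-identityʳ c))) ⟩
          𝟙 (excess x) * (𝟙 (excess x) * c)         ≡⟨ solve 2 (λ e c → e :* (e :* c) := c :* (e :* e)) refl (𝟙 (excess x)) c ⟩
          c * (𝟙 (excess x) * 𝟙 (excess x))         ≡⟨ cong (c *_) (𝟙-idem (excess x)) ⟩
          c * 𝟙 (excess x)                          ∎)
          (∑-* c (λ x → 𝟙 (excess x)))
          where open ≡-Reasoning

      -- Count incident pairs of a short line and a vertex. A short line has at least `11β/14`
      -- vertices; each of them has excess, by `∑-short≤`, and lies on at most `14r/11` lines.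
      121βS≤196rX : ι 121 * (β * S) ≤ ι 196 * (r * X)
      121βS≤196rX = begin
        ι 121 * (β * S)
          ≡⟨ trans (solve 2 (λ b s → con (ι 121) :* (b :* s) := con (ι 11) :* (s :* (con (ι 11) :* b))) refl β S)
               (cong (ι 11 *_) (sym (∑-*ʳ (λ i → 𝟙 (short i)) (ι 11 * β)))) ⟩
        ι 11 * ∑ (λ i → 𝟙 (short i) * (ι 11 * β))
          ≤⟨ *-mono-≤ˡ (ι≥0 11) (∑-mono λ i → *-mono-≤ˡ (𝟙≥0 (short i)) (≤-trans (size-large i)
               (*-mono-≤ˡ (ι≥0 14) (≤-by {size i - 1ℚ} (ι≥0 1) (solve 1 (λ s → s := s :- con 1ℚ :+ con 1ℚ) refl (size i)))))) ⟩
        ι 11 * ∑ (λ i → 𝟙 (short i) * (ι 14 * size i))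
          ≡⟨ cong (ι 11 *_) (trans (∑-cong λ i → solve 2 (λ e s → e :* (con (ι 14) :* s) := con (ι 14) :* (e :* s)) refl (𝟙 (short i)) (size i))
               (∑-* (ι 14) (λ i → 𝟙 (short i) * size i))) ⟩
        ι 11 * (ι 14 * ∑ (λ i → 𝟙 (short i) * size i))
          ≡⟨ cong (λ e → ι 11 * (ι 14 * e)) (trans (∑-cong λ i → sym (∑-* (𝟙 (short i)) (λ x → 𝟙 (M i x))))
               (∑-swap (λ i x → 𝟙 (short i) * 𝟙 (M i x)))) ⟩
        ι 11 * (ι 14 * ∑ (λ x → ∑ (λ i → 𝟙 (short i) * 𝟙 (M i x))))
          ≤⟨ *-mono-≤ˡ (ι≥0 11) (*-mono-≤ˡ (ι≥0 14) (∑-mono ∑-short≤)) ⟩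
        ι 11 * (ι 14 * ∑ (λ x → 𝟙 (excess x) * t x))
          ≡⟨ trans (solve 1 (λ e → con (ι 11) :* (con (ι 14) :* e) := con (ι 14) :* (con (ι 11) :* e)) refl (∑ (λ x → 𝟙 (excess x) * t x)))
               (cong (ι 14 *_) (sym (∑-* (ι 11) (λ x → 𝟙 (excess x) * t x)))) ⟩
        ι 14 * ∑ (λ x → ι 11 * (𝟙 (excess x) * t x))
          ≤⟨ *-mono-≤ˡ (ι≥0 14) (∑-mono λ x → ≤-trans (≤-reflexive (solve 2 (λ e t → con (ι 11) :* (e :* t) := e :* (con (ι 11) :* t)) refl (𝟙 (excess x)) (t x)))
               (*-mono-≤ˡ (𝟙≥0 (excess x)) (11t≤14r x))) ⟩
        ι 14 * ∑ (λ x → 𝟙 (excess x) * (ι 14 * r))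
          ≡⟨ trans (cong (ι 14 *_) (∑-*ʳ (λ x → 𝟙 (excess x)) (ι 14 * r)))
               (solve 2 (λ x r → con (ι 14) :* (x :* (con (ι 14) :* r)) := con (ι 196) :* (r :* x)) refl X r) ⟩
        ι 196 * (r * X) ∎
        where open ℚ.≤-Reasoning

      S≥0 : 0ℚ ≤ S
      S≥0 = ∑≥0 (λ i → 𝟙≥0 (short i))

      -- The chain is `2541 r S ≤ 121 β S ≤ 196 r X ≤ 392 r S`, with `2541 = 121 * 21`; the
      -- coefficient `2149 = 2541 - 392` is what remains.
      S≡0 : S ≡ 0ℚ
      S≡0 = ≤-antisym (*-cancel-≤ (0<* (ι>0 2148) r>0) (≤-by
          (diff≥0 121βS≤196rX ⊕ ι≥0 196 ⊛ (<⇒≤ r>0 ⊛ diff≥0 X≤2S) ⊕ ι≥0 121 ⊛ (S≥0 ⊛ diff≥0 21r≤β))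
          (solve 4 (λ b s x r → con (ι 2149) :* r :* con 0ℚ := con (ι 2149) :* r :* s :+
             ((con (ι 196) :* (r :* x) :- con (ι 121) :* (b :* s)) :+ con (ι 196) :* (r :* (con (ι 2) :* s :- x))
               :+ con (ι 121) :* (s :* (b :- con (ι 21) :* r)))) refl β S X r)))
        S≥0

      size≡ : ∀ i → size i ≡ β + 1ℚ
      size≡ i = trans (solve 2 (λ b s → s := b :- (b :- s)) refl (β + 1ℚ) (size i)) (trans (cong (λ e → β + 1ℚ - e) (¬short⇒full ¬si))
          (solve 1 (λ b → b :- con 0ℚ := b) refl (β + 1ℚ)))
        where
        ¬si : short i ≡ false
        ¬si = ¬true⇒false λ si → contradiction (trans (cong 𝟙 (sym si)) (∑≡0⇒≡0 (λ i → 𝟙≥0 (short i)) S≡0 i)) λ ()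

      t≡r : ∀ x → t x ≡ r
      t≡r x = *-cancel-≡ (>⇒≢0 β>0) (trans (solve 3 (λ b t r → b :* t := b :* (t :- r) :+ b :* r) refl β (t x) r)
        (trans (cong (_+ β * r) (trans (sym (∑-slack′ x)) (trans (∑-cong λ i → trans (cong (λ e → 𝟙 (M i x) * (β + 1ℚ - e)) (size≡ i))
          (trans (cong (𝟙 (M i x) *_) (ℚ.+-inverseʳ (β + 1ℚ))) (ℚ.*-zeroʳ (𝟙 (M i x))))) (∑-0 s)))) (ℚ.+-identityˡ (β * r))))

  -- The finite list of lines and its incidence matrix

  lookup-injective : ∀ {A : Set} {xs : List A} → Unique xs → ∀ i j →
    List.lookup xs i ≡ List.lookup xs j → i ≡ j
  lookup-injective (_ ∷ _)    zero    zero    _  = refl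
  lookup-injective {xs = x ∷ xs} (x∉ ∷ _) zero (suc j) eq = contradiction eq (All.lookup x∉ (List.∈-lookup {xs = xs} j))
  lookup-injective {xs = x ∷ xs} (x∉ ∷ _) (suc i) zero eq = contradiction (sym eq) (All.lookup x∉ (List.∈-lookup {xs = xs} i))
  lookup-injective (_ ∷ u)    (suc i) (suc j) eq = cong suc (lookup-injective u i j eq)

  module Enumeration {v : ℕ} (adj : Fin v → Fin v → Bool)
    (L : ∀ {x y} → adj x y ≡ true → Fin v → Bool)
    (x∈L : ∀ {x y} (x~y : adj x y ≡ true) → L x~y x ≡ true)
    (y∈L : ∀ {x y} (x~y : adj x y ≡ true) → L x~y y ≡ true)
    (L-unique : ∀ {x y u w} (x~y : adj x y ≡ true) (u~w : adj u w ≡ true) →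
      L x~y u ≡ true → L x~y w ≡ true → ∀ z → L x~y z ≡ L u~w z)
    (L-adj : ∀ {x y z w} (x~y : adj x y ≡ true) → L x~y z ≡ true → L x~y w ≡ true → z ≢ w → adj z w ≡ true)
    where

    -- Tabulated, so that lines with the same vertices become equal objects with decidable equality
    -- and duplicates can be removed.
    line : ∀ {x y} → adj x y ≡ true → Subset v
    line x~y = Vec.tabulate (L x~y)

    line-cong : ∀ {x y u w} (x~y : adj x y ≡ true) (u~w : adj u w ≡ true) →
      L x~y u ≡ true → L x~y w ≡ true → line x~y ≡ line u~w
    line-cong x~y u~w u∈ w∈ = Vec.tabulate-cong (L-unique x~y u~w u∈ w∈)

    -- The value of `adj x y` is a separate argument, so that matching on it still leaves the proof
    -- of adjacency that `line` consumes.
    linesAt : ∀ {a} x y → adj x y ≡ a → List (Subset v)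
    linesAt {true}  x y x~y = line x~y ∷ []
    linesAt {false} x y _   = []

    candidates : List (Subset v)
    candidates = concatMap (λ x → concatMap (λ y → linesAt x y refl) (allFin v)) (allFin v)

    lines : List (Subset v)
    lines = deduplicate (Vec.≡-dec Bool._≟_) candidates

    line∈lines : ∀ {x y} (x~y : adj x y ≡ true) → line x~y ∈ lines
    line∈lines {x} {y} x~y = List.∈-deduplicate⁺ (Vec.≡-dec Bool._≟_)
      (List.∈-concatMap⁺ _ (Any.tabulate⁺ x (List.∈-concatMap⁺ _ (Any.tabulate⁺ y (at refl x~y)))))
      where
      at : ∀ {a} (eq : adj x y ≡ a) → a ≡ true → line x~y ∈ linesAt x y eq
      at eq refl = here (line-cong x~y eq (x∈L x~y) (y∈L x~y))

    IsLine : Subset v → Set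
    IsLine C = ∃[ x ] ∃[ y ] ∃ λ (x~y : adj x y ≡ true) → C ≡ line x~y

    ∈lines⇒IsLine : ∀ {C} → C ∈ lines → IsLine C
    ∈lines⇒IsLine {C} C∈ with Any.satisfied (List.∈-concatMap⁻ (λ x → concatMap (λ y → linesAt x y refl) (allFin v)) {xs = allFin v} (List.∈-deduplicate⁻ (Vec.≡-dec Bool._≟_) candidates C∈))
    ... | x , C∈ₓ with Any.satisfied (List.∈-concatMap⁻ (λ y → linesAt x y refl) {xs = allFin v} C∈ₓ)
    ... | y , C∈ₓᵧ = at refl C∈ₓᵧ
      where
      at : ∀ {a} (eq : adj x y ≡ a) → C ∈ linesAt x y eq → IsLine C
      at {true} eq (here C≡) = x , y , eq , C≡

    x∈line : ∀ {x y} (x~y : adj x y ≡ true) → Vec.lookup (line x~y) x ≡ true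
    x∈line {x} x~y = trans (Vec.lookup∘tabulate (L x~y) x) (x∈L x~y)

    y∈line : ∀ {x y} (x~y : adj x y ≡ true) → Vec.lookup (line x~y) y ≡ true
    y∈line {y = y} x~y = trans (Vec.lookup∘tabulate (L x~y) y) (y∈L x~y)

    line-unique : ∀ {x y C} (x~y : adj x y ≡ true) → C ∈ lines →
      Vec.lookup C x ≡ true → Vec.lookup C y ≡ true → line x~y ≡ C
    line-unique {x} {y} x~y C∈ Cx Cy with ∈lines⇒IsLine C∈
    ... | _ , _ , e , refl = sym (line-cong e x~y
      (trans (sym (Vec.lookup∘tabulate (L e) x)) Cx) (trans (sym (Vec.lookup∘tabulate (L e) y)) Cy))

    s : ℕ
    s = List.length lines

    M : Fin s → Fin v → Bool
    M i = Vec.lookup (List.lookup lines i)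

    M-line : ∀ i → ∃[ x ] ∃[ y ] ∃ λ (x~y : adj x y ≡ true) → List.lookup lines i ≡ line x~y × (∀ z → M i z ≡ L x~y z)
    M-line i with ∈lines⇒IsLine (List.∈-lookup {xs = lines} i)
    ... | x , y , x~y , eq = x , y , x~y , eq
        , λ z → trans (cong (λ C → Vec.lookup C z) eq) (Vec.lookup∘tabulate (L x~y) z)

    M-adj : ∀ {i x y} → M i x ≡ true → M i y ≡ true → x ≢ y → adj x y ≡ true
    M-adj {i} {x} {y} Mx My x≢y = let _ , _ , e , _ , eq = M-line i in
      L-adj e (trans (sym (eq x)) Mx) (trans (sym (eq y)) My) x≢y

    index : ∀ {x y} → adj x y ≡ true → Fin s
    index x~y = Any.index (line∈lines x~y)

    lookup-index : ∀ {x y} (x~y : adj x y ≡ true) → line x~y ≡ List.lookup lines (index x~y)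
    lookup-index x~y = Any.lookup-index (line∈lines x~y)

    M-index : ∀ {x y} (x~y : adj x y ≡ true) z → M (index x~y) z ≡ L x~y z
    M-index x~y z = trans (cong (λ C → Vec.lookup C z) (sym (lookup-index x~y))) (Vec.lookup∘tabulate (L x~y) z)

    index-unique : ∀ {x y} (x~y : adj x y ≡ true) i → M i x ≡ true → M i y ≡ true → i ≡ index x~y
    index-unique {x} {y} x~y i Mx My = lookup-injective (Unique.deduplicate-! (Vec.≡-dec Bool._≟_) candidates) i (index x~y)
      (trans (sym (line-unique x~y (List.∈-lookup {xs = lines} i) Mx My)) (lookup-index x~y))

    -- By `index-unique`, the list without duplicates has exactly one index whose line contains `x`
    -- and `y`, so the summand is a Kronecker delta in `i`.
    pair : ∀ {x y} → adj x y ≡ true → ∑ (λ i → 𝟙 (M i x) * 𝟙 (M i y)) ≡ 1ℚ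
    pair {x} {y} x~y = trans (∑-cong pointwise) (∑-δ1 (index x~y))
      where
      pointwise : ∀ i → 𝟙 (M i x) * 𝟙 (M i y) ≡ δ (index x~y) i
      pointwise i with index x~y Fin.≟ i
      ... | yes refl rewrite M-index x~y x | M-index x~y y | x∈L x~y | y∈L x~y = refl
      ... | no i₀≢i  = trans (sym (𝟙-∧ (M i x) (M i y)))
        (cong 𝟙 (¬true⇒false λ h → let Mx , My = ∧-true {M i x} h in i₀≢i (sym (index-unique x~y i Mx My))))

  count≡∑ : ∀ {A : Set} {P : A → Set} (P? : ∀ a → Dec (P a)) {n} (xs : Vec.Vec A n) →
    ι (Vec.count P? xs) ≡ ∑ (λ i → 𝟙 (does (P? (Vec.lookup xs i))))
  count≡∑ P? Vec.[]       = refl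
  count≡∑ P? (x Vec.∷ xs) with does (P? x)
  ... | true  = trans (ι-suc (Vec.count P? xs)) (cong (_+_ 1ℚ) (count≡∑ P? xs))
  ... | false = trans (count≡∑ P? xs) (sym (ℚ.+-identityˡ _))

  ∣∣≡∑ : ∀ {n} (C : Subset n) → ι Subset.∣ C ∣ ≡ ∑ (λ i → 𝟙 (Vec.lookup C i))
  ∣∣≡∑ C = trans (count≡∑ (Bool._≟ inside) C) (∑-cong λ i → cong 𝟙 (does-≟ (Vec.lookup C i)))
    where
    does-≟ : ∀ a → does (a Bool.≟ inside) ≡ a
    does-≟ true  = refl
    does-≟ false = refl

  -- The cosine sequence of the eigenvalue -r

  -- The Kronecker delta on distances, recursive so that it computes on successors. That a distance
  -- is one below `j` is then written with `suc` on the left, which correctly gives 0 at `j = 0`.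
  E⟦_,_⟧ : ℕ → ℕ → ℚ
  E⟦ zero  , zero  ⟧ = 1ℚ
  E⟦ zero  , suc n ⟧ = 0ℚ
  E⟦ suc m , zero  ⟧ = 0ℚ
  E⟦ suc m , suc n ⟧ = E⟦ m , n ⟧

  E-refl : ∀ n → E⟦ n , n ⟧ ≡ 1ℚ
  E-refl zero    = refl
  E-refl (suc n) = E-refl n

  E-≢ : ∀ {m n} → m ≢ n → E⟦ m , n ⟧ ≡ 0ℚ
  E-≢ {zero}  {zero}  m≢n = contradiction refl m≢n
  E-≢ {zero}  {suc n} m≢n = refl
  E-≢ {suc m} {zero}  m≢n = refl
  E-≢ {suc m} {suc n} m≢n = E-≢ (m≢n ∘ cong suc)

  E-subst : ∀ m n (ψ : ℕ → ℚ) → E⟦ m , n ⟧ * ψ m ≡ E⟦ m , n ⟧ * ψ n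
  E-subst zero    zero    ψ = refl
  E-subst zero    (suc n) ψ = trans (ℚ.*-zeroˡ (ψ zero)) (sym (ℚ.*-zeroˡ (ψ (suc n))))
  E-subst (suc m) zero    ψ = trans (ℚ.*-zeroˡ (ψ (suc m))) (sym (ℚ.*-zeroˡ (ψ zero)))
  E-subst (suc m) (suc n) ψ = E-subst m n (ψ ∘ suc)

  ∑-E : ∀ n m (φ : ℕ → ℚ) → m ℕ.< n → ∑ {n} (λ i → E⟦ m , toℕ i ⟧ * φ (toℕ i)) ≡ φ m
  ∑-E (suc n) zero    φ _ = trans (cong₂ _+_ (ℚ.*-identityˡ (φ 0))
    (trans (∑-cong {n} (λ i → ℚ.*-zeroˡ (φ (suc (toℕ i))))) (∑-0 n))) (ℚ.+-identityʳ (φ 0))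
  ∑-E (suc n) (suc m) φ (ℕ.s≤s m<n) = trans (cong₂ _+_ (ℚ.*-zeroˡ (φ 0)) (∑-E n m (φ ∘ suc) m<n)) (ℚ.+-identityˡ (φ (suc m)))

  -- Comparison with the geometric series of ratio 1/2; this is where the bound 2 for `c`
  -- originates.
  ∑-halving : ∀ n (a : ℕ → ℚ) → (∀ i → i ℕ.≤ n → 0ℚ ≤ a i) → (∀ i → i ℕ.< n → ι 2 * a (suc i) ≤ a i) →
    ∑ {suc n} (a ∘ toℕ) ≤ ι 2 * a 0
  ∑-halving zero a a≥0 _ = ≤-by (a≥0 0 ℕ.z≤n) (solve 1 (λ a → con (ι 2) :* a := a :+ con 0ℚ :+ a) refl (a 0))
  ∑-halving (suc n) a a≥0 half = ≤-trans
    (ℚ.+-monoʳ-≤ (a 0) (≤-trans (∑-halving n (a ∘ suc) (λ i i≤n → a≥0 (suc i) (ℕ.s≤s i≤n)) (λ i i<n → half (suc i) (ℕ.s≤s i<n)))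
      (half 0 ℕ.z<s)))
    (≤-reflexive (solve 1 (λ a → a :+ a := con (ι 2) :* a) refl (a 0)))

  module Spectral {v : ℕ} (adj : Fin v → Fin v → Bool) (adj-sym : ∀ x y → adj x y ≡ adj y x)
    (d : Fin v → Fin v → ℕ) (d-sym : ∀ x y → d x y ≡ d y x)
    (d≡0⇒≡ : ∀ {x y} → d x y ≡ 0 → x ≡ y) (d-refl : ∀ x → d x x ≡ 0)
    (d-adj : ∀ {x y} → adj x y ≡ true → d x y ≡ 1)
    (d-step : ∀ x {y z} → adj y z ≡ true → d x z ℕ.≤ suc (d x y))
    (D : ℕ) (d≤D : ∀ x y → d x y ℕ.≤ D) (D>0 : 0 ℕ.< D)
    (g : ℕ → ℚ) (r α β : ℚ)
    (g0≡0 : g 0 ≡ 0ℚ) (g1≡1 : g 1 ≡ 1ℚ) (gD≡r : g D ≡ r) (g>0 : ∀ i → 0ℚ < g (suc i))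
    (r-g≥0 : ∀ i → i ℕ.≤ D → 0ℚ ≤ r - g i)
    (β-αg>0 : ∀ i → i ℕ.< D → 0ℚ < β - α * g i)
    (1+αg>0 : ∀ i → i ℕ.< D → 0ℚ < 1ℚ + α * g i)
    (ratio : ∀ i → i ℕ.< D → ι 2 * ((1ℚ + α * g i) * (r - g i)) ≤ g (suc i) * (β - α * g i))
    (degree : ∀ y → ∑ (λ z → 𝟙 (adj y z)) ≡ r * β)
    (up : ∀ x y → ∑ (λ z → 𝟙 (adj y z) * E⟦ d x z , suc (d x y) ⟧) ≡ (r - g (d x y)) * (β - α * g (d x y)))
    (down : ∀ x y → ∑ (λ z → 𝟙 (adj y z) * E⟦ suc (d x z) , d x y ⟧) ≡ g (d x y) * (1ℚ + α * g (pred (d x y))))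
    where

    B Cd : ℕ → ℚ
    B  j = (r - g j) * (β - α * g j)
    Cd j = g j * (1ℚ + α * g (pred j))

    -- A neighbour of `y` is at distance `j - 1`, `j` or `j + 1` from `x`. As `φ` is arbitrary, the
    -- same count serves for the cosine sequence, for sphere sums and for common neighbours. At
    -- `j = 0` the term with `pred` vanishes.
    three-term : ∀ (φ : ℕ → ℚ) x y → let j = d x y in
      ∑ (λ z → 𝟙 (adj y z) * φ (d x z)) ≡ r * β * φ j + Cd j * (φ (pred j) - φ j) + B j * (φ (suc j) - φ j)
    three-term φ x y = begin
      ∑ (λ z → 𝟙 (adj y z) * φ (d x z))
        ≡⟨ ∑-cong (λ z → trans (weighted-≡ (adj y z) λ y~z → local (d x z) j (d-step x y~z)
               (d-step x (trans (adj-sym z y) y~z)))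
             (solve 6 (λ a f e p e′ q → a :* (f :+ e :* p :+ e′ :* q) := a :* f :+ a :* e :* p :+ a :* e′ :* q) refl
               (𝟙 (adj y z)) (φ j) E⟦ suc (d x z) , j ⟧ (φ (pred j) - φ j) E⟦ d x z , suc j ⟧ (φ (suc j) - φ j))) ⟩
      ∑ (λ z → 𝟙 (adj y z) * φ j + 𝟙 (adj y z) * E⟦ suc (d x z) , j ⟧ * (φ (pred j) - φ j) + 𝟙 (adj y z) * E⟦ d x z , suc j ⟧ * (φ (suc j) - φ j))
        ≡⟨ trans (∑-+ (λ z → 𝟙 (adj y z) * φ j + 𝟙 (adj y z) * E⟦ suc (d x z) , j ⟧ * (φ (pred j) - φ j)) (λ z → 𝟙 (adj y z) * E⟦ d x z , suc j ⟧ * (φ (suc j) - φ j)))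
             (cong₂ _+_ (trans (∑-+ (λ z → 𝟙 (adj y z) * φ j) (λ z → 𝟙 (adj y z) * E⟦ suc (d x z) , j ⟧ * (φ (pred j) - φ j)))
               (cong₂ _+_ (trans (∑-*ʳ (λ z → 𝟙 (adj y z)) (φ j)) (cong (_* φ j) (degree y)))
                 (trans (∑-*ʳ (λ z → 𝟙 (adj y z) * E⟦ suc (d x z) , j ⟧) (φ (pred j) - φ j)) (cong (_* (φ (pred j) - φ j)) (down x y)))))
               (trans (∑-*ʳ (λ z → 𝟙 (adj y z) * E⟦ d x z , suc j ⟧) (φ (suc j) - φ j)) (cong (_* (φ (suc j) - φ j)) (up x y)))) ⟩
      r * β * φ j + Cd j * (φ (pred j) - φ j) + B j * (φ (suc j) - φ j) ∎
      where
      open ≡-Reasoning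
      j = d x y
      local : ∀ m j → m ℕ.≤ suc j → j ℕ.≤ suc m →
        φ m ≡ φ j + E⟦ suc m , j ⟧ * (φ (pred j) - φ j) + E⟦ m , suc j ⟧ * (φ (suc j) - φ j)
      local m j m≤ j≤ with ℕ.<-cmp m j
      ... | tri≈ _ refl _ rewrite E-≢ {suc m} {m} ℕ.1+n≢n | E-≢ {m} {suc m} (ℕ.1+n≢n ∘ sym) =
        solve 3 (λ f p s → f := f :+ con 0ℚ :* (p :- f) :+ con 0ℚ :* (s :- f)) refl (φ m) (φ (pred m)) (φ (suc m))
      ... | tri< m<j _ _ with refl ← ℕ.≤-antisym m<j j≤ rewrite E-refl m | E-≢ {m} {suc (suc m)} (ℕ.<⇒≢ (ℕ.m<n⇒m<1+n ℕ.≤-refl)) =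
        solve 3 (λ f p s → p := f :+ con 1ℚ :* (p :- f) :+ con 0ℚ :* (s :- f)) refl (φ (suc m)) (φ m) (φ (suc (suc m)))
      ... | tri> _ _ j<m with refl ← ℕ.≤-antisym m≤ j<m rewrite E-refl j | E-≢ {suc (suc j)} {j} (ℕ.<⇒≢ (ℕ.m<n⇒m<1+n ℕ.≤-refl) ∘ sym) =
        solve 3 (λ f p s → s := f :+ con 0ℚ :* (p :- f) :+ con 1ℚ :* (s :- f)) refl (φ j) (φ (pred j)) (φ (suc j))

    -- For the eigenvalue `-r`, consecutive cosines have an explicit ratio. Hence `B j * ω (suc j)`
    -- and `Cd j * ω (pred j)` are both multiples of `ω j`, and the three-term recurrence reduces to
    -- an identity between coefficients.
    ω : ℕ → ℚ
    ω zero    = 1ℚ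
    ω (suc i) = - (ω i * (1ℚ + α * g i)) * (β - α * g i) ⁻¹

    ω-step : ∀ i → i ℕ.< D → (β - α * g i) * ω (suc i) ≡ - (1ℚ + α * g i) * ω i
    ω-step i i<D = trans (solve 4 (λ b o a n → b :* ((:- (o :* a)) :* n) := (:- a) :* o :* (b :* n)) refl
        (β - α * g i) (ω i) (1ℚ + α * g i) ((β - α * g i) ⁻¹))
      (trans (cong (- (1ℚ + α * g i) * ω i *_) (*-inverseʳ (>⇒≢0 (β-αg>0 i i<D)))) (ℚ.*-identityʳ _))

    Z : Fin v → Fin v → ℚ
    Z x y = ω (d x y)

    Z-sym : ∀ x y → Z x y ≡ Z y x
    Z-sym x y = cong ω (d-sym x y)

    Z-diag : ∀ x → Z x x ≡ 1ℚ
    Z-diag x = cong ω (d-refl x)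

    Z-adj : ∀ {x y} → adj x y ≡ true → β * Z x y ≡ - 1ℚ
    Z-adj {x} {y} x~y = begin
      β * Z x y                  ≡⟨ cong (λ i → β * ω i) (d-adj x~y) ⟩
      β * ω 1                    ≡⟨ solve 3 (λ b a o → b :* o := (b :- a :* con 0ℚ) :* o) refl β α (ω 1) ⟩
      (β - α * 0ℚ) * ω 1         ≡⟨ cong (λ e → (β - α * e) * ω 1) g0≡0 ⟨
      (β - α * g 0) * ω 1        ≡⟨ ω-step 0 D>0 ⟩
      - (1ℚ + α * g 0) * 1ℚ      ≡⟨ cong (λ e → - (1ℚ + α * e) * 1ℚ) g0≡0 ⟩
      - (1ℚ + α * 0ℚ) * 1ℚ       ≡⟨ solve 1 (λ a → (:- (con 1ℚ :+ a :* con 0ℚ)) :* con 1ℚ := con (- 1ℚ)) refl α ⟩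
      - 1ℚ                       ∎
      where open ≡-Reasoning

    B-ω : ∀ j → j ℕ.≤ D → B j * ω (suc j) ≡ - ((r - g j) * (1ℚ + α * g j)) * ω j
    B-ω j j≤D with ℕ.m≤n⇒m<n∨m≡n j≤D
    ... | inj₁ j<D  = trans (ℚ.*-assoc (r - g j) (β - α * g j) (ω (suc j))) (trans (cong ((r - g j) *_) (ω-step j j<D))
      (solve 3 (λ a b o → a :* ((:- b) :* o) := (:- (a :* b)) :* o) refl (r - g j) (1ℚ + α * g j) (ω j)))
    -- At the diameter the factor `r - g j` is 0, so the value of `ω` beyond `D` does not enter.
    ... | inj₂ j≡D  = trans (cong (λ e → e * (β - α * g j) * ω (suc j)) r-gj≡0)
      (trans (solve 4 (λ b o a o′ → con 0ℚ :* b :* o := (:- (con 0ℚ :* a)) :* o′) refl (β - α * g j) (ω (suc j)) (1ℚ + α * g j) (ω j))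
      (cong (λ e → - (e * (1ℚ + α * g j)) * ω j) (sym r-gj≡0)))
      where
      r-gj≡0 : r - g j ≡ 0ℚ
      r-gj≡0 = trans (cong (λ e → r - e) (trans (cong g j≡D) gD≡r)) (ℚ.+-inverseʳ r)

    Cd-ω : ∀ j → j ℕ.≤ D → Cd j * ω (pred j) ≡ - (g j * (β - α * g (pred j))) * ω j
    Cd-ω zero    _   rewrite g0≡0 = solve 3 (λ a b o → con 0ℚ :* (con 1ℚ :+ a :* con 0ℚ) :* o := (:- (con 0ℚ :* (b :- a :* con 0ℚ))) :* o) refl α β 1ℚ
    Cd-ω (suc j) j<D = trans (solve 3 (λ a b o → a :* b :* o := (:- a) :* ((:- b) :* o)) refl (g (suc j)) (1ℚ + α * g j) (ω j))
      (trans (cong (- g (suc j) *_) (sym (ω-step j j<D)))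
      (solve 3 (λ a b o → (:- a) :* (b :* o) := (:- (a :* b)) :* o) refl (g (suc j)) (β - α * g j) (ω (suc j))))

    Z-eigen : ∀ x w → ∑ (λ y → 𝟙 (adj x y) * Z y w) ≡ - r * Z x w
    Z-eigen x w = begin
      ∑ (λ y → 𝟙 (adj x y) * Z y w)
        ≡⟨ ∑-cong (λ y → cong (𝟙 (adj x y) *_) (Z-sym y w)) ⟩
      ∑ (λ y → 𝟙 (adj x y) * ω (d w y))
        ≡⟨ three-term ω w x ⟩
      r * β * ω j + Cd j * (ω (pred j) - ω j) + B j * (ω (suc j) - ω j)
        ≡⟨ solve 6 (λ k o c p b s → k :* o :+ c :* (p :- o) :+ b :* (s :- o) := k :* o :+ (c :* p :- c :* o) :+ (b :* s :- b :* o)) refl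
             (r * β) (ω j) (Cd j) (ω (pred j)) (B j) (ω (suc j)) ⟩
      r * β * ω j + (Cd j * ω (pred j) - Cd j * ω j) + (B j * ω (suc j) - B j * ω j)
        ≡⟨ cong₂ (λ a b → r * β * ω j + (a - Cd j * ω j) + (b - B j * ω j)) (Cd-ω j (d≤D w x)) (B-ω j (d≤D w x)) ⟩
      r * β * ω j + (- (g j * (β - α * g (pred j))) * ω j - Cd j * ω j) + (- ((r - g j) * (1ℚ + α * g j)) * ω j - B j * ω j)
        -- The terms with `α` cancel in pairs: `B j + (r - g j)(1 + α g j) = (r - g j)(β +
        -- 1)` and `Cd j + g j (β - α g (pred j)) = g j (β + 1)`. What remains is `r β - r (β + 1) =
        -- -r`.
        ≡⟨ solve 6 (λ r b a g p o → r :* b :* o :+ ((:- (g :* (b :- a :* p))) :* o :- g :* (con 1ℚ :+ a :* p) :* o)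
              :+ ((:- ((r :- g) :* (con 1ℚ :+ a :* g))) :* o :- (r :- g) :* (b :- a :* g) :* o) := (:- r) :* o) refl
             r β α (g j) (g (pred j)) (ω j) ⟩
      - r * ω j
        ≡⟨ cong (- r *_) (Z-sym w x) ⟩
      - r * Z x w ∎
      where
      open ≡-Reasoning
      j = d w x

    module _ (f : Fin v → ℚ) (f-eigen : ∀ z → ∑ (λ y → 𝟙 (adj z y) * f y) ≡ - r * f z) where

      -- The distance-`i` matrix applied to the eigenvector `f`, evaluated at `x`; `F≡κf` will show
      -- that `f` is an eigenvector of all these matrices.
      F : Fin v → ℕ → ℚ
      F x i = ∑ (λ z → E⟦ d x z , i ⟧ * f z)

      F-0 : ∀ x → F x 0 ≡ f x
      F-0 x = trans (∑-cong (λ z → cong (_* f z) (E≡δ z))) (∑-δ x f)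
        where
        E≡δ : ∀ z → E⟦ d x z , 0 ⟧ ≡ δ x z
        E≡δ z with x Fin.≟ z
        ... | yes refl rewrite d-refl x = refl
        ... | no x≢z   = E-≢ (x≢z ∘ d≡0⇒≡)

      double-count : ∀ x i →
        - r * F x i ≡ ∑ (λ y → f y * ∑ (λ z → 𝟙 (adj y z) * E⟦ d x z , i ⟧))
      double-count x i = begin
        - r * F x i
          ≡⟨ ∑-* (- r) (λ z → E⟦ d x z , i ⟧ * f z) ⟨
        ∑ (λ z → - r * (E⟦ d x z , i ⟧ * f z))
          ≡⟨ ∑-cong (λ z → trans (solve 3 (λ r e f → r :* (e :* f) := e :* (r :* f)) refl (- r) E⟦ d x z , i ⟧ (f z))
               (trans (cong (E⟦ d x z , i ⟧ *_) (sym (f-eigen z))) (sym (∑-* E⟦ d x z , i ⟧ (λ y → 𝟙 (adj z y) * f y))))) ⟩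
        ∑ (λ z → ∑ (λ y → E⟦ d x z , i ⟧ * (𝟙 (adj z y) * f y)))
          ≡⟨ ∑-swap (λ z y → E⟦ d x z , i ⟧ * (𝟙 (adj z y) * f y)) ⟩
        ∑ (λ y → ∑ (λ z → E⟦ d x z , i ⟧ * (𝟙 (adj z y) * f y)))
          ≡⟨ ∑-cong (λ y → trans (∑-cong (λ z → trans (cong (λ a → E⟦ d x z , i ⟧ * (𝟙 a * f y)) (adj-sym z y))
               (solve 3 (λ e a f → e :* (a :* f) := f :* (a :* e)) refl E⟦ d x z , i ⟧ (𝟙 (adj y z)) (f y))))
               (∑-* (f y) (λ z → 𝟙 (adj y z) * E⟦ d x z , i ⟧))) ⟩
        ∑ (λ y → f y * ∑ (λ z → 𝟙 (adj y z) * E⟦ d x z , i ⟧)) ∎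
        where open ≡-Reasoning

      scaled : ∀ x i a → ∑ (λ y → a * (E⟦ d x y , i ⟧ * f y)) ≡ a * F x i
      scaled x i a = ∑-* a (λ y → E⟦ d x y , i ⟧ * f y)

      F-three-term-0 : ∀ x → - r * F x 0 ≡ (r * β - Cd 0 - B 0) * F x 0 + Cd 1 * F x 1
      F-three-term-0 x = trans (double-count x 0) (trans (∑-cong pointwise)
        (trans (∑-+ (λ y → (r * β - Cd 0 - B 0) * (E⟦ d x y , 0 ⟧ * f y)) (λ y → Cd 1 * (E⟦ d x y , 1 ⟧ * f y)))
          (cong₂ _+_ (scaled x 0 (r * β - Cd 0 - B 0)) (scaled x 1 (Cd 1)))))
        where
        local : ∀ j f → f * (r * β * E⟦ j , 0 ⟧ + Cd j * (E⟦ pred j , 0 ⟧ - E⟦ j , 0 ⟧) + B j * (0ℚ - E⟦ j , 0 ⟧))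
          ≡ (r * β - Cd 0 - B 0) * (E⟦ j , 0 ⟧ * f) + Cd 1 * (E⟦ j , 1 ⟧ * f)
        local zero f = trans
          (solve 5 (λ f k c b c′ → f :* (k :* con 1ℚ :+ c :* (con 1ℚ :- con 1ℚ) :+ b :* (con 0ℚ :- con 1ℚ))
            := (k :- con 0ℚ :- b) :* (con 1ℚ :* f) :+ c′ :* (con 0ℚ :* f)) refl f (r * β) (Cd 0) (B 0) (Cd 1))
          (cong (λ e → (r * β - e - B 0) * (1ℚ * f) + Cd 1 * (0ℚ * f))
            (sym (trans (cong (_* (1ℚ + α * g 0)) g0≡0) (ℚ.*-zeroˡ (1ℚ + α * g 0)))))
        local (suc zero) f = solve 5 (λ f k c b a → f :* (k :* con 0ℚ :+ c :* (con 1ℚ :- con 0ℚ) :+ b :* (con 0ℚ :- con 0ℚ))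
            := a :* (con 0ℚ :* f) :+ c :* (con 1ℚ :* f)) refl f (r * β) (Cd 1) (B 1) (r * β - Cd 0 - B 0)
        local (suc (suc j)) f = solve 6 (λ f k c b a c′ → f :* (k :* con 0ℚ :+ c :* (con 0ℚ :- con 0ℚ) :+ b :* (con 0ℚ :- con 0ℚ))
            := a :* (con 0ℚ :* f) :+ c′ :* (con 0ℚ :* f)) refl f (r * β) (Cd (suc (suc j))) (B (suc (suc j))) (r * β - Cd 0 - B 0) (Cd 1)
        pointwise : ∀ y → f y * ∑ (λ z → 𝟙 (adj y z) * E⟦ d x z , 0 ⟧)
          ≡ (r * β - Cd 0 - B 0) * (E⟦ d x y , 0 ⟧ * f y) + Cd 1 * (E⟦ d x y , 1 ⟧ * f y)
        pointwise y = trans (cong (f y *_) (three-term (λ m → E⟦ m , 0 ⟧) x y)) (local (d x y) (f y))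

      F-three-term : ∀ x i → - r * F x (suc i) ≡
        (r * β - Cd (suc i) - B (suc i)) * F x (suc i) + Cd (suc (suc i)) * F x (suc (suc i)) + B i * F x i
      F-three-term x i = trans (double-count x (suc i)) (trans (∑-cong pointwise)
        (trans (∑-+ (λ y → a * (E⟦ d x y , suc i ⟧ * f y) + Cd (suc (suc i)) * (E⟦ d x y , suc (suc i) ⟧ * f y)) (λ y → B i * (E⟦ d x y , i ⟧ * f y)))
          (cong₂ _+_ (trans (∑-+ (λ y → a * (E⟦ d x y , suc i ⟧ * f y)) (λ y → Cd (suc (suc i)) * (E⟦ d x y , suc (suc i) ⟧ * f y)))
             (cong₂ _+_ (scaled x (suc i) a) (scaled x (suc (suc i)) (Cd (suc (suc i)))))) (scaled x i (B i)))))
        where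
        a = r * β - Cd (suc i) - B (suc i)
        lower : ∀ j → Cd j * E⟦ pred j , suc i ⟧ ≡ E⟦ j , suc (suc i) ⟧ * Cd (suc (suc i))
        lower zero    = trans (ℚ.*-zeroʳ (Cd 0)) (sym (ℚ.*-zeroˡ (Cd (suc (suc i)))))
        lower (suc j) = trans (ℚ.*-comm (Cd (suc j)) E⟦ j , suc i ⟧) (E-subst j (suc i) (Cd ∘ suc))
        local : ∀ j f → f * (r * β * E⟦ j , suc i ⟧ + Cd j * (E⟦ pred j , suc i ⟧ - E⟦ j , suc i ⟧) + B j * (E⟦ j , i ⟧ - E⟦ j , suc i ⟧))
          ≡ a * (E⟦ j , suc i ⟧ * f) + Cd (suc (suc i)) * (E⟦ j , suc (suc i) ⟧ * f) + B i * (E⟦ j , i ⟧ * f)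
        local j f = begin
          f * (r * β * e + Cd j * (E⟦ pred j , suc i ⟧ - e) + B j * (E⟦ j , i ⟧ - e))
            ≡⟨ solve 7 (λ f k e c p b q → f :* (k :* e :+ c :* (p :- e) :+ b :* (q :- e)) := f :* (k :* e :+ (c :* p :- e :* c) :+ (q :* b :- e :* b))) refl
                 f (r * β) e (Cd j) E⟦ pred j , suc i ⟧ (B j) E⟦ j , i ⟧ ⟩
          f * (r * β * e + (Cd j * E⟦ pred j , suc i ⟧ - e * Cd j) + (E⟦ j , i ⟧ * B j - e * B j))
            ≡⟨ cong (f *_) (cong₂ (λ p q → r * β * e + p + q)
                 (cong₂ _-_ (lower j) (E-subst j (suc i) Cd)) (cong₂ _-_ (E-subst j i B) (E-subst j (suc i) B))) ⟩
          f * (r * β * e + (E⟦ j , suc (suc i) ⟧ * Cd (suc (suc i)) - e * Cd (suc i)) + (E⟦ j , i ⟧ * B i - e * B (suc i)))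
            ≡⟨ solve 9 (λ f k e p c″ c′ q b b′ → f :* (k :* e :+ (p :* c″ :- e :* c′) :+ (q :* b :- e :* b′))
                  := (k :- c′ :- b′) :* (e :* f) :+ c″ :* (p :* f) :+ b :* (q :* f)) refl
                 f (r * β) e E⟦ j , suc (suc i) ⟧ (Cd (suc (suc i))) (Cd (suc i)) E⟦ j , i ⟧ (B i) (B (suc i)) ⟩
          a * (e * f) + Cd (suc (suc i)) * (E⟦ j , suc (suc i) ⟧ * f) + B i * (E⟦ j , i ⟧ * f) ∎
          where
          open ≡-Reasoning
          e = E⟦ j , suc i ⟧
        pointwise : ∀ y → f y * ∑ (λ z → 𝟙 (adj y z) * E⟦ d x z , suc i ⟧)
          ≡ a * (E⟦ d x y , suc i ⟧ * f y) + Cd (suc (suc i)) * (E⟦ d x y , suc (suc i) ⟧ * f y) + B i * (E⟦ d x y , i ⟧ * f y)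
        pointwise y = trans (cong (f y *_) (three-term (λ m → E⟦ m , suc i ⟧) x y)) (local (d x y) (f y))

      -- The three-term recurrence for -r collapses to a two-term one.
      F-two-term : ∀ x i → i ℕ.< D → g (suc i) * F x (suc i) ≡ - (r - g i) * F x i
      F-two-term x zero 0<D = begin
        g 1 * F x 1
          ≡⟨ cong (_* F x 1) g1≡1 ⟩
        1ℚ * F x 1
          ≡⟨ solve 4 (λ r b a p → con 1ℚ :* p := con 1ℚ :* (con 1ℚ :+ a :* con 0ℚ) :* p) refl r β α (F x 1) ⟩
        1ℚ * (1ℚ + α * 0ℚ) * F x 1
          ≡⟨ cong₂ (λ e e′ → e * (1ℚ + α * e′) * F x 1) g1≡1 g0≡0 ⟨
        Cd 1 * F x 1
          ≡⟨ solve 2 (λ a b → b := a :+ b :- a) refl ((r * β - Cd 0 - B 0) * F x 0) (Cd 1 * F x 1) ⟩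
        (r * β - Cd 0 - B 0) * F x 0 + Cd 1 * F x 1 - (r * β - Cd 0 - B 0) * F x 0
          ≡⟨ cong (_- (r * β - Cd 0 - B 0) * F x 0) (sym (F-three-term-0 x)) ⟩
        - r * F x 0 - (r * β - g 0 * (1ℚ + α * g 0) - (r - g 0) * (β - α * g 0)) * F x 0
          ≡⟨ cong (λ e → - r * F x 0 - (r * β - e * (1ℚ + α * e) - (r - e) * (β - α * e)) * F x 0) g0≡0 ⟩
        - r * F x 0 - (r * β - 0ℚ * (1ℚ + α * 0ℚ) - (r - 0ℚ) * (β - α * 0ℚ)) * F x 0
          ≡⟨ solve 4 (λ r b a p → (:- r) :* p :- (r :* b :- con 0ℚ :* (con 1ℚ :+ a :* con 0ℚ) :- (r :- con 0ℚ) :* (b :- a :* con 0ℚ)) :* p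
                := (:- (r :- con 0ℚ)) :* p) refl r β α (F x 0) ⟩
        - (r - 0ℚ) * F x 0
          ≡⟨ cong (λ e → - (r - e) * F x 0) g0≡0 ⟨
        - (r - g 0) * F x 0 ∎
        where open ≡-Reasoning
      F-two-term x (suc i) i+1<D = *-cancel-≡ (>⇒≢0 (1+αg>0 (suc i) i+1<D)) (begin
        (1ℚ + α * g₁) * (g₂ * F₂)
          ≡⟨ solve 5 (λ c g f u w → c :* (g :* f) := u :+ g :* c :* f :+ w :- u :- w) refl (1ℚ + α * g₁) g₂ F₂ (a * F₁) (B i * F₀) ⟩
        a * F₁ + Cd (suc (suc i)) * F₂ + B i * F₀ - a * F₁ - B i * F₀
          ≡⟨ cong₂ (λ u w → u - a * F₁ - w) (sym (F-three-term x i)) (trans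
               (solve 3 (λ a b f → a :* b :* f := (:- b) :* ((:- a) :* f)) refl (r - g₀) (β - α * g₀) F₀)
               (cong (- (β - α * g₀) *_) (sym (F-two-term x i (ℕ.<-trans ℕ.≤-refl i+1<D))))) ⟩
        - r * F₁ - a * F₁ - - (β - α * g₀) * (g₁ * F₁)
          ≡⟨ solve 6 (λ r b al g₀ g₁ f → (:- r) :* f :- (r :* b :- g₁ :* (con 1ℚ :+ al :* g₀) :- (r :- g₁) :* (b :- al :* g₁)) :* f
                 :- (:- (b :- al :* g₀)) :* (g₁ :* f) := (con 1ℚ :+ al :* g₁) :* ((:- (r :- g₁)) :* f)) refl
               r β α g₀ g₁ F₁ ⟩
        (1ℚ + α * g₁) * (- (r - g₁) * F₁) ∎)
        where
        open ≡-Reasoning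
        a = r * β - Cd (suc i) - B (suc i)
        F₀ = F x i
        F₁ = F x (suc i)
        F₂ = F x (suc (suc i))
        g₀ = g i
        g₁ = g (suc i)
        g₂ = g (suc (suc i))

    -- The eigenvalue of the distance-`i` matrix on the `-r` eigenspace, which is `ω i` times the
    -- number of vertices at distance `i`. For Gaussian numbers it is the Gaussian binomial of `D`
    -- over `i` times `b^(i(i-1)/2)`, with alternating sign.
    κ : ℕ → ℚ
    κ zero    = 1ℚ
    κ (suc i) = - ((r - g i) * κ i) * g (suc i) ⁻¹

    F≡κf : ∀ f f-eigen x i → i ℕ.≤ D → F f f-eigen x i ≡ κ i * f x
    F≡κf f f-eigen x zero    _   = trans (F-0 f f-eigen x) (sym (ℚ.*-identityˡ (f x)))
    F≡κf f f-eigen x (suc i) i<D = *-cancel-≡ (>⇒≢0 (g>0 i)) (begin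
      g (suc i) * F f f-eigen x (suc i)
        ≡⟨ F-two-term f f-eigen x i i<D ⟩
      - (r - g i) * F f f-eigen x i
        ≡⟨ cong (- (r - g i) *_) (F≡κf f f-eigen x i (ℕ.<⇒≤ i<D)) ⟩
      - (r - g i) * (κ i * f x)
        ≡⟨ trans (solve 3 (λ a k f → (:- a) :* (k :* f) := (:- (a :* k)) :* con 1ℚ :* f) refl (r - g i) (κ i) (f x))
             (cong (λ e → - ((r - g i) * κ i) * e * f x) (sym (*-inverseʳ (>⇒≢0 (g>0 i))))) ⟩
      - ((r - g i) * κ i) * (g (suc i) * g (suc i) ⁻¹) * f x
        ≡⟨ solve 4 (λ a g n f → a :* (g :* n) :* f := g :* (a :* n :* f)) refl (- ((r - g i) * κ i)) (g (suc i)) (g (suc i) ⁻¹) (f x) ⟩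
      g (suc i) * (κ (suc i) * f x) ∎)
      where open ≡-Reasoning

    a : ℕ → ℚ
    a i = ω i * κ i

    -- The sum of the squared cosines weighted by the sphere sizes. Since `Z` has trace `v` and
    -- `Z/c` is a projection, `c` is `v` divided by the rank of `Z`; the bound `c≤2` says that this
    -- rank is at least `v/2`.
    c : ℚ
    c = ∑ {suc D} (a ∘ toℕ)

    -- Column `y` of `Z` is an eigenvector for `-r`. Sorting `z` by its distance from `x` turns the
    -- sum into sphere sums of this eigenvector, which `F≡κf` evaluates.
    Z-square : ∀ x y → ∑ (λ z → Z x z * Z z y) ≡ c * Z x y
    Z-square x y = begin
      ∑ (λ z → ω (d x z) * f z)
        ≡⟨ ∑-cong (λ z → trans (cong (_* f z) (sym (∑-E (suc D) (d x z) ω (ℕ.s≤s (d≤D x z)))))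
             (sym (∑-*ʳ {suc D} (λ i → E⟦ d x z , toℕ i ⟧ * ω (toℕ i)) (f z)))) ⟩
      ∑ (λ z → ∑ {suc D} (λ i → E⟦ d x z , toℕ i ⟧ * ω (toℕ i) * f z))
        ≡⟨ ∑-swap {n = suc D} (λ z i → E⟦ d x z , toℕ i ⟧ * ω (toℕ i) * f z) ⟩
      ∑ {suc D} (λ i → ∑ (λ z → E⟦ d x z , toℕ i ⟧ * ω (toℕ i) * f z))
        ≡⟨ ∑-cong {suc D} (λ i → trans (∑-cong (λ z → solve 3 (λ e o f → e :* o :* f := o :* (e :* f)) refl E⟦ d x z , toℕ i ⟧ (ω (toℕ i)) (f z)))
             (trans (∑-* (ω (toℕ i)) (λ z → E⟦ d x z , toℕ i ⟧ * f z))
             (trans (cong (ω (toℕ i) *_) (F≡κf f (λ z → Z-eigen z y) x (toℕ i) (Fin.toℕ≤pred[n] i)))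
             (sym (ℚ.*-assoc (ω (toℕ i)) (κ (toℕ i)) (f x)))))) ⟩
      ∑ {suc D} (λ i → a (toℕ i) * f x)
        ≡⟨ ∑-*ʳ {suc D} (a ∘ toℕ) (f x) ⟩
      c * f x ∎
      where
      open ≡-Reasoning
      f : Fin v → ℚ
      f z = Z z y

    -- The alternating signs of `ω` and `κ` cancel in the product, which is why all terms of `c` are
    -- nonnegative; the quotient of consecutive terms is the one bounded in `ratio`.
    a-suc : ∀ i → a (suc i) ≡ a i * ((1ℚ + α * g i) * (r - g i)) * ((β - α * g i) ⁻¹ * g (suc i) ⁻¹)
    a-suc i = solve 6 (λ o p n q k m → (:- (o :* p)) :* n :* ((:- (q :* k)) :* m) := o :* k :* (p :* q) :* (n :* m)) refl
      (ω i) (1ℚ + α * g i) ((β - α * g i) ⁻¹) (r - g i) (κ i) (g (suc i) ⁻¹)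

    inverses>0 : ∀ i → i ℕ.< D → 0ℚ < (β - α * g i) ⁻¹ * g (suc i) ⁻¹
    inverses>0 i i<D = 0<* (⁻¹>0 (β-αg>0 i i<D)) (⁻¹>0 (g>0 i))

    a≥0 : ∀ i → i ℕ.≤ D → 0ℚ ≤ a i
    a≥0 zero    _   = decide-≤
    a≥0 (suc i) i<D = subst (0ℚ ≤_) (sym (a-suc i))
      (a≥0 i (ℕ.<⇒≤ i<D) ⊛ (<⇒≤ (1+αg>0 i i<D) ⊛ r-g≥0 i (ℕ.<⇒≤ i<D)) ⊛ <⇒≤ (inverses>0 i i<D))

    a-half : ∀ i → i ℕ.< D → ι 2 * a (suc i) ≤ a i
    a-half i i<D = begin
      ι 2 * a (suc i)
        ≡⟨ trans (cong (ι 2 *_) (a-suc i)) (solve 3 (λ a p n → con (ι 2) :* (a :* p :* n) := a :* n :* (con (ι 2) :* p)) refl (a i) _ _) ⟩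
      a i * ((β - α * g i) ⁻¹ * g (suc i) ⁻¹) * (ι 2 * ((1ℚ + α * g i) * (r - g i)))
        ≤⟨ *-mono-≤ˡ (a≥0 i (ℕ.<⇒≤ i<D) ⊛ <⇒≤ (inverses>0 i i<D)) (ratio i i<D) ⟩
      a i * ((β - α * g i) ⁻¹ * g (suc i) ⁻¹) * (g (suc i) * (β - α * g i))
        ≡⟨ solve 5 (λ a b n g m → a :* (n :* m) :* (g :* b) := a :* ((b :* n) :* (g :* m))) refl
             (a i) (β - α * g i) ((β - α * g i) ⁻¹) (g (suc i)) (g (suc i) ⁻¹) ⟩
      a i * ((β - α * g i) * (β - α * g i) ⁻¹ * (g (suc i) * g (suc i) ⁻¹))
        ≡⟨ cong₂ (λ e e′ → a i * (e * e′)) (*-inverseʳ (>⇒≢0 (β-αg>0 i i<D))) (*-inverseʳ (>⇒≢0 (g>0 i))) ⟩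
      a i * (1ℚ * 1ℚ)
        ≡⟨ ℚ.*-identityʳ (a i) ⟩
      a i ∎
      where open ℚ.≤-Reasoning

    c≤2 : c ≤ ι 2
    c≤2 = ∑-halving D a a≥0 a-half

    1≤c : 1ℚ ≤ c
    1≤c = term≤∑ {suc D} (λ i → a≥0 (toℕ i) (Fin.toℕ≤pred[n] i)) zero

  -- Distances and intersection numbers

  module Distances (Γ : DistanceRegularGraph) where

    open DistanceRegularGraph Γ

    adj : Vertex → Vertex → Bool
    adj x y = does (x ~? y)

    ~⇒adj : ∀ {x y} → x ~ y → adj x y ≡ true
    ~⇒adj {x} {y} = dec-true (x ~? y)

    adj⇒~ : ∀ {x y} → adj x y ≡ true → x ~ y
    adj⇒~ {x} {y} eq with yes x~y ← x ~? y = x~y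

    adj-irrefl : ∀ x → adj x x ≡ false
    adj-irrefl x = dec-false (x ~? x) (irrefl refl)

    adj-sym : ∀ x y → adj x y ≡ adj y x
    adj-sym x y with x ~? y
    ... | yes x~y = sym (~⇒adj (~-sym x~y))
    ... | no x≁y  = sym (dec-false (y ~? x) (x≁y ∘ ~-sym))

    snoc : ∀ {ℓ x y z} → Walk ℓ x y → y ~ z → Walk (suc ℓ) x z
    snoc []      y~z = y~z ∷ []
    snoc (e ∷ w) y~z = e ∷ snoc w y~z

    reverse : ∀ {ℓ x y} → Walk ℓ x y → Walk ℓ y x
    reverse []      = []
    reverse (e ∷ w) = snoc (reverse w) (~-sym e)

    -- An upward search for the least length: `k` bounds the remaining attempts, and the given walk
    -- of length `k + m` guarantees that they suffice.
    shortest : ∀ k m {x y} → (∀ {ℓ} → ℓ ℕ.< m → ¬ Walk ℓ x y) → Walk (k ℕ.+ m) x y → ∃ (Distance x y)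
    shortest zero    m         none w = m , w , none
    shortest (suc k) m {x} {y} none w with walk? m x y
    ... | yes w′ = m , w′ , none
    ... | no ¬w  = shortest k (suc m)
      (λ { (ℕ.s≤s ℓ≤m) → case ℕ.m≤n⇒m<n∨m≡n ℓ≤m of λ { (inj₁ ℓ<m) → none ℓ<m ; (inj₂ refl) → ¬w } })
      (subst (λ n → Walk n x y) (sym (ℕ.+-suc k m)) w)

    distance : ∀ x y → ∃ (Distance x y)
    distance x y = let ℓ , w = connected x y in
      shortest ℓ 0 (λ ()) (subst (λ n → Walk n x y) (sym (ℕ.+-identityʳ ℓ)) w)

    d : Vertex → Vertex → ℕ
    d x y = proj₁ (distance x y)

    d-walk : ∀ x y → Walk (d x y) x y
    d-walk x y = proj₁ (proj₂ (distance x y))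

    d-minimal : ∀ {ℓ x y} → Walk ℓ x y → d x y ℕ.≤ ℓ
    d-minimal {ℓ} {x} {y} w = ℕ.≮⇒≥ λ ℓ<d → proj₂ (proj₂ (distance x y)) ℓ<d w

    Distance⇒d≡ : ∀ {x y n} → Distance x y n → d x y ≡ n
    Distance⇒d≡ {x} {y} (w , none) = ℕ.≤-antisym (d-minimal w) (ℕ.≮⇒≥ λ d<n → none d<n (d-walk x y))

    d≡⇒Distance : ∀ {x y n} → d x y ≡ n → Distance x y n
    d≡⇒Distance {x} {y} refl = proj₂ (distance x y)

    d-sym : ∀ x y → d x y ≡ d y x
    d-sym x y = ℕ.≤-antisym (d-minimal (reverse (d-walk y x))) (d-minimal (reverse (d-walk x y)))

    d-refl : ∀ x → d x x ≡ 0
    d-refl x = ℕ.n≤0⇒n≡0 (d-minimal [])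

    d≡0⇒≡ : ∀ {x y} → d x y ≡ 0 → x ≡ y
    d≡0⇒≡ {x} {y} eq with [] ← subst (λ n → Walk n x y) eq (d-walk x y) = refl

    d≡1⇒~ : ∀ {x y} → d x y ≡ 1 → x ~ y
    d≡1⇒~ {x} {y} eq with e ∷ [] ← subst (λ n → Walk n x y) eq (d-walk x y) = e

    d-adj : ∀ {x y} → adj x y ≡ true → d x y ≡ 1
    d-adj {x} {y} x~y = ℕ.≤-antisym (d-minimal (adj⇒~ x~y ∷ []))
      (ℕ.n≢0⇒n>0 λ d≡0 → irrefl (d≡0⇒≡ d≡0) (adj⇒~ x~y))

    d-step : ∀ x {y z} → adj y z ≡ true → d x z ℕ.≤ suc (d x y)
    d-step x {y} y~z = d-minimal (snoc (d-walk x y) (adj⇒~ y~z))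

    d≤diameter : ∀ x y → d x y ℕ.≤ diameter
    d≤diameter x y = proj₁ hasDiameter (proj₂ (distance x y))

    E≡adj : ∀ x y → E⟦ d x y , 1 ⟧ ≡ 𝟙 (adj x y)
    E≡adj x y with x ~? y
    ... | yes x~y rewrite d-adj (~⇒adj x~y) = refl
    ... | no x≁y  = E-≢ (x≁y ∘ d≡1⇒~)

    E≡distance? : ∀ x z n → 𝟙 (does (distance? x z n)) ≡ E⟦ d x z , n ⟧
    E≡distance? x z n with d x z ℕ.≟ n
    ... | yes refl = trans (cong 𝟙 (dec-true (distance? x z n) (d≡⇒Distance refl))) (sym (E-refl n))
    ... | no d≢n   = trans (cong 𝟙 (dec-false (distance? x z n) (d≢n ∘ Distance⇒d≡))) (sym (E-≢ d≢n))

    #≡∑ : ∀ x y n → ι (# λ z → (y ~? z) ×-dec distance? x z n) ≡ ∑ (λ z → 𝟙 (adj y z) * E⟦ d x z , n ⟧)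
    #≡∑ x y n = trans (count≡∑ (λ z → (y ~? z) ×-dec distance? x z n) (Vec.allFin order)) (∑-cong λ i →
      trans (cong (λ z → 𝟙 (adj y z ∧ does (distance? x z n))) (Vec.lookup-allFin i))
      (trans (𝟙-∧ (adj y i) _) (cong (𝟙 (adj y i) *_) (E≡distance? x i n))))

    b-count : ∀ x y → d x y ℕ.< diameter → ∑ (λ z → 𝟙 (adj y z) * E⟦ d x z , suc (d x y) ⟧) ≡ ι (bᵢ (d x y))
    b-count x y d<D = trans (sym (#≡∑ x y (suc (d x y)))) (cong ι (b-regular d<D (d≡⇒Distance refl)))

    b-count-diameter : ∀ x y → d x y ≡ diameter → ∑ (λ z → 𝟙 (adj y z) * E⟦ d x z , suc (d x y) ⟧) ≡ 0ℚ
    b-count-diameter x y d≡D = trans (∑-cong λ z → trans (cong (𝟙 (adj y z) *_)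
        (E-≢ λ eq → ℕ.<-irrefl refl (subst (ℕ._≤ diameter) (trans eq (cong suc d≡D)) (d≤diameter x z))))
        (ℚ.*-zeroʳ (𝟙 (adj y z))))
      (∑-0 order)

    c-count : ∀ x y {i} → d x y ≡ suc i → ∑ (λ z → 𝟙 (adj y z) * E⟦ d x z , i ⟧) ≡ ι (cᵢ (suc i))
    c-count x y {i} eq = trans (sym (#≡∑ x y i)) (cong ι (c-regular (d≡⇒Distance eq)))

    degree : 0 ℕ.< diameter → ∀ y → ∑ (λ z → 𝟙 (adj y z)) ≡ ι valency
    degree 0<D y = trans (∑-cong pointwise) (trans (b-count y y (subst (ℕ._< diameter) (sym (d-refl y)) 0<D))
        (cong (ι ∘ bᵢ) (d-refl y)))
      where
      pointwise : ∀ z → 𝟙 (adj y z) ≡ 𝟙 (adj y z) * E⟦ d y z , suc (d y y) ⟧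
      pointwise z rewrite d-refl y | E≡adj y z with adj y z
      ... | true  = refl
      ... | false = refl

    predecessor : ∀ {x y n} → d x y ≡ suc n → ∃[ z ] adj y z ≡ true × d x z ≡ n
    predecessor {x} {y} {n} eq with subst (λ n → Walk n y x) (trans (d-sym y x) eq) (d-walk y x)
    ... | _∷_ {y = z} e w = z , ~⇒adj e , ℕ.≤-antisym (d-minimal (reverse w))
      (ℕ.s≤s⁻¹ (subst (ℕ._≤ suc (d x z)) eq (d-step x (trans (adj-sym z y) (~⇒adj e)))))

    at-distance : ∀ {n} m → m ℕ.≤ n → ∃[ x ] ∃[ y ] d x y ≡ n → ∃[ x ] ∃[ y ] d x y ≡ m
    at-distance {n} m m≤n xy with ℕ.m≤n⇒m<n∨m≡n m≤n
    ... | inj₂ refl = xy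
    at-distance {suc n} m m≤n (x , y , eq) | inj₁ (ℕ.s≤s m≤n′) = let z , _ , eq′ = predecessor eq in
      at-distance m m≤n′ (x , z , eq′)

    -- The diameter is attained, so a geodesic contains a pair at distance `i + 1`, and the
    -- predecessor of its end is counted. This is the source of the positivity of `1 + α [i]`.
    c>0 : ∀ i → i ℕ.< diameter → 0ℚ < ι (cᵢ (suc i))
    c>0 i i<D with at-distance (suc i) i<D (let x , y , p = proj₂ hasDiameter in x , y , Distance⇒d≡ p)
    ... | x , y , eq with predecessor eq
    ... | z , y~z , eq′ = <-≤-trans (ι>0 0) (subst (1ℚ ≤_) (c-count x y eq) (subst (_≤ ∑ (λ z → 𝟙 (adj y z) * E⟦ d x z , i ⟧)) one
        (term≤∑ (λ z → 𝟙≥0 (adj y z) ⊛ E≥0 (d x z) i) z)))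
      where
      E≥0 : ∀ m n → 0ℚ ≤ E⟦ m , n ⟧
      E≥0 zero    zero    = decide-≤
      E≥0 zero    (suc n) = decide-≤
      E≥0 (suc m) zero    = decide-≤
      E≥0 (suc m) (suc n) = E≥0 m n
      one : 𝟙 (adj y z) * E⟦ d x z , i ⟧ ≡ 1ℚ
      one rewrite y~z | eq′ | E-refl i = refl

  -- Rational classical parameters

  module GaussNumbers (b : ℚ) (b≥2 : ι 2 ≤ b) (g : ℕ → ℚ)
    (g-zero : g 0 ≡ 0ℚ) (g-suc : ∀ i → g (suc i) ≡ b * g i + 1ℚ) where

    b-2≥0 : 0ℚ ≤ b - ι 2
    b-2≥0 = diff≥0 b≥2

    b≥0 : 0ℚ ≤ b
    b≥0 = ≤-trans (ι≥0 2) b≥2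

    g≥0 : ∀ i → 0ℚ ≤ g i
    g≥0 zero    = ≤-reflexive (sym g-zero)
    g≥0 (suc i) = subst (0ℚ ≤_) (sym (g-suc i)) (b≥0 ⊛ g≥0 i ⊕ ι≥0 1)

    g-suc≥1 : ∀ i → 1ℚ ≤ g (suc i)
    g-suc≥1 i = ≤-by (b≥0 ⊛ g≥0 i) (trans (g-suc i) (ℚ.+-comm (b * g i) 1ℚ))

    g-suc>0 : ∀ i → 0ℚ < g (suc i)
    g-suc>0 i = <-≤-trans (ι>0 0) (g-suc≥1 i)

    g≤g-suc : ∀ i → g i ≤ g (suc i)
    g≤g-suc i = ≤-by ((b-2≥0 ⊕ ι≥0 1) ⊛ g≥0 i ⊕ ι≥0 1) (trans (g-suc i)
      (solve 2 (λ b g → b :* g :+ con 1ℚ := g :+ ((b :- con (ι 2) :+ con (ι 1)) :* g :+ con (ι 1))) refl b (g i)))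

    g-mono : ∀ {i j} → i ℕ.≤ j → g i ≤ g j
    g-mono {i} i≤j = lemma (ℕ.≤⇒≤′ i≤j)
      where
      lemma : ∀ {j} → i ℕ.≤′ j → g i ≤ g j
      lemma ℕ.≤′-refl               = ≤-refl
      lemma {suc j} (ℕ.≤′-step i≤j) = ≤-trans (lemma i≤j) (g≤g-suc j)

    g1≡1 : g 1 ≡ 1ℚ
    g1≡1 = trans (g-suc 0) (trans (cong (λ e → b * e + 1ℚ) g-zero) (solve 1 (λ b → b :* con 0ℚ :+ con 1ℚ := con 1ℚ) refl b))

    g2≡b+1 : g 2 ≡ b + 1ℚ
    g2≡b+1 = trans (g-suc 1) (cong (_+ 1ℚ) (trans (cong (b *_) g1≡1) (ℚ.*-identityʳ b)))

  module Parameters (D : ℕ) (3≤D : 3 ℕ.≤ D) (b α β : ℚ) (b≥2 : ι 2 ≤ b) (g : ℕ → ℚ)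
    (g-zero : g 0 ≡ 0ℚ) (g-suc : ∀ i → g (suc i) ≡ b * g i + 1ℚ)
    (1+αg>0 : ∀ i → i ℕ.< D → 0ℚ < 1ℚ + α * g i)
    (μ≥0 : 0ℚ ≤ α * b + b + α)
    (4rμ≤β : ι 4 * (g D * (α * b + b + α)) ≤ β) (21r≤β : ι 21 * g D ≤ β)
    where

    open GaussNumbers b b≥2 g g-zero g-suc

    -- Here `μ` is `c₂ - 1`, the form in which `c₂` enters the hypothesis on `β`.
    r μ : ℚ
    r = g D
    μ = α * b + b + α

    r≥7 : ι 7 ≤ r
    r≥7 = ≤-trans (≤-by (b-2≥0 ⊛ (b-2≥0 ⊕ ι≥0 5)) (trans (trans (g-suc 2) (cong (λ e → b * e + 1ℚ) g2≡b+1))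
        (solve 1 (λ b → b :* (b :+ con 1ℚ) :+ con 1ℚ := con (ι 7) :+ (b :- con (ι 2)) :* (b :- con (ι 2) :+ con (ι 5))) refl b)))
      (g-mono 3≤D)

    r>0 : 0ℚ < r
    r>0 = <-≤-trans (ι>0 6) r≥7

    r-g≥0 : ∀ i → i ℕ.≤ D → 0ℚ ≤ r - g i
    r-g≥0 i i≤D = diff≥0 (g-mono i≤D)

    β>0 : 0ℚ < β
    β>0 = <-≤-trans (0<* (ι>0 20) r>0) 21r≤β

    β≥28 : ι 28 ≤ β
    β≥28 = ≤-trans (≤-by {e = ι 21 * (r - ι 7) + ι 119} (ι≥0 21 ⊛ diff≥0 r≥7 ⊕ ι≥0 119)
      (solve 1 (λ r → con (ι 21) :* r := con (ι 28) :+ (con (ι 21) :* (r :- con (ι 7)) :+ con (ι 119))) refl r)) 21r≤β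

    28μ≤β : ι 28 * μ ≤ β
    28μ≤β = ≤-trans (≤-by (ι≥0 4 ⊛ (diff≥0 r≥7 ⊛ μ≥0))
      (solve 2 (λ r m → con (ι 4) :* (r :* m) := con (ι 28) :* m :+ con (ι 4) :* ((r :- con (ι 7)) :* m)) refl r μ)) 4rμ≤β

    0<1+α : 0ℚ < 1ℚ + α
    0<1+α = subst (λ e → 0ℚ < 1ℚ + e) (trans (cong (α *_) g1≡1) (ℚ.*-identityʳ α)) (1+αg>0 1 (ℕ.<-≤-trans (ℕ.s≤s (ℕ.s≤s ℕ.z≤n)) 3≤D))

    α≥0⇒3α≤μ : 0ℚ ≤ α → ι 3 * α ≤ μ
    α≥0⇒3α≤μ α≥0 = ≤-by (α≥0 ⊛ b-2≥0 ⊕ b≥0)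
      (solve 2 (λ a b → a :* b :+ b :+ a := con (ι 3) :* a :+ (a :* (b :- con (ι 2)) :+ b)) refl α b)

    α≥0⇒12αr≤β : 0ℚ ≤ α → ι 12 * (α * r) ≤ β
    α≥0⇒12αr≤β α≥0 = ≤-trans (≤-by (ι≥0 4 ⊛ (<⇒≤ r>0 ⊛ diff≥0 (α≥0⇒3α≤μ α≥0)))
      (solve 3 (λ r m a → con (ι 4) :* (r :* m) := con (ι 12) :* (a :* r) :+ con (ι 4) :* (r :* (m :- con (ι 3) :* a))) refl r μ α)) 4rμ≤β

    -- The sign of `α` is not prescribed. For `α ≥ 0`, combine `4 r μ ≤ β` with `μ ≥ 3 α`; for
    -- `α ≤ 0` the left side is not positive.
    12αg≤β : ∀ i → i ℕ.≤ D → ι 12 * (α * g i) ≤ β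
    12αg≤β i i≤D with ℚ.≤-total 0ℚ α
    ... | inj₁ α≥0 = ≤-trans (*-mono-≤ˡ (ι≥0 12) (*-mono-≤ˡ α≥0 (g-mono i≤D))) (α≥0⇒12αr≤β α≥0)
    ... | inj₂ α≤0 = ≤-trans (≤-by (ι≥0 12 ⊛ (neg≥0 α≤0 ⊛ g≥0 i))
      (solve 2 (λ a g → con 0ℚ := con (ι 12) :* (a :* g) :+ con (ι 12) :* ((:- a) :* g)) refl α (g i))) (<⇒≤ β>0)

    β-αg>0 : ∀ i → i ℕ.< D → 0ℚ < β - α * g i
    β-αg>0 i i<D = ℚ.*-cancelˡ-<-nonNeg (ι 12) (<-by
      (ℚ.+-mono-<-≤ (0<* (ι>0 10) β>0) (diff≥0 (12αg≤β i (ℕ.<⇒≤ i<D))))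
      (solve 2 (λ b a → con (ι 12) :* (b :- a) := con (ι 12) :* con 0ℚ :+ (con (ι 11) :* b :+ (b :- con (ι 12) :* a))) refl β (α * g i)))

    -- A bound that treats both signs of `α` alike: `w` is `1 + α` or 1. In `ratio` the left side is
    -- then at most `2 w r g (suc i) ≤ β g (suc i) / 3`, while `β - α g i ≥ 11β/12`.
    weight : ∃[ w ] 0ℚ ≤ w × ι 6 * (w * r) ≤ β × (∀ i → 1ℚ + α * g i ≤ w * g (suc i))
    weight with ℚ.≤-total 0ℚ α
    ... | inj₁ α≥0 = 1ℚ + α , ι≥0 1 ⊕ α≥0
      , *-cancel-≤ (ι>0 1) (≤-by (diff≥0 21r≤β ⊕ diff≥0 (α≥0⇒12αr≤β α≥0) ⊕ ι≥0 9 ⊛ <⇒≤ r>0)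
        (solve 3 (λ b r a → con (ι 2) :* b := con (ι 2) :* (con (ι 6) :* ((con 1ℚ :+ a) :* r)) :+
           ((b :- con (ι 21) :* r) :+ (b :- con (ι 12) :* (a :* r)) :+ con (ι 9) :* r)) refl β r α))
      , λ i → ≤-by (diff≥0 (g-suc≥1 i) ⊕ α≥0 ⊛ diff≥0 (g≤g-suc i))
        (solve 3 (λ a g h → (con 1ℚ :+ a) :* h := con 1ℚ :+ a :* g :+ ((h :- con 1ℚ) :+ a :* (h :- g))) refl α (g i) (g (suc i)))
    ... | inj₂ α≤0 = 1ℚ , ι≥0 1
      , ≤-trans (≤-by (ι≥0 15 ⊛ <⇒≤ r>0) (solve 1 (λ r → con (ι 21) :* r := con (ι 6) :* (con 1ℚ :* r) :+ con (ι 15) :* r) refl r)) 21r≤β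
      , λ i → ≤-by (diff≥0 (g-suc≥1 i) ⊕ neg≥0 α≤0 ⊛ g≥0 i)
        (solve 3 (λ a g h → con 1ℚ :* h := con 1ℚ :+ a :* g :+ ((h :- con 1ℚ) :+ (:- a) :* g)) refl α (g i) (g (suc i)))

    ratio : ∀ i → i ℕ.< D → ι 2 * ((1ℚ + α * g i) * (r - g i)) ≤ g (suc i) * (β - α * g i)
    ratio i i<D = let w , w≥0 , 6wr≤β , 1+αg≤wg′ = weight in *-cancel-≤ (ι>0 11) (≤-by
      (ι≥0 24 ⊛ (diff≥0 (1+αg≤wg′ i) ⊛ r-g≥0 i (ℕ.<⇒≤ i<D))
        ⊕ ι≥0 24 ⊛ (w≥0 ⊛ <⇒≤ (g-suc>0 i) ⊛ g≥0 i)
        ⊕ <⇒≤ (g-suc>0 i) ⊛ (ι≥0 4 ⊛ diff≥0 6wr≤β ⊕ diff≥0 (12αg≤β i (ℕ.<⇒≤ i<D)) ⊕ ι≥0 7 ⊛ <⇒≤ β>0))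
      (solve 6 (λ b r a g h w → con (ι 12) :* (h :* (b :- a :* g)) := con (ι 12) :* (con (ι 2) :* ((con 1ℚ :+ a :* g) :* (r :- g))) :+
         (con (ι 24) :* ((w :* h :- (con 1ℚ :+ a :* g)) :* (r :- g)) :+ con (ι 24) :* (w :* h :* g)
           :+ h :* (con (ι 4) :* (b :- con (ι 6) :* (w :* r)) :+ (b :- con (ι 12) :* (a :* g)) :+ con (ι 7) :* b)))
         refl β r α (g i) (g (suc i)) w))

    b₁ ℓ : ℚ
    b₁ = (r - 1ℚ) * (β - α)
    ℓ = r * β - 1ℚ - b₁

    r-1≥0 : 0ℚ ≤ r - 1ℚ
    r-1≥0 = diff≥0 (≤-trans (decide-≤ {1ℚ} {ι 7}) r≥7)

    -- It suffices that `b₁ ≤ r β`, and `r β - b₁ = (1 + α)(r - 1) + (β - r) + 1`.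
    bound₁ : ι 4 * ((r * β - 1ℚ - ℓ) * μ) ≤ β * β
    bound₁ = ≤-by
      (<⇒≤ β>0 ⊛ diff≥0 4rμ≤β ⊕ ι≥0 4 ⊛ (μ≥0 ⊛ (<⇒≤ 0<1+α ⊛ r-1≥0 ⊕ diff≥0 21r≤β ⊕ ι≥0 20 ⊛ <⇒≤ r>0 ⊕ ι≥0 1)))
      (solve 4 (λ b r a m → b :* b := con (ι 4) :* ((r :* b :- con 1ℚ :- (r :* b :- con 1ℚ :- (r :- con 1ℚ) :* (b :- a))) :* m) :+
         (b :* (b :- con (ι 4) :* (r :* m)) :+ con (ι 4) :* (m :* ((con 1ℚ :+ a) :* (r :- con 1ℚ) :+ (b :- con (ι 21) :* r) :+ con (ι 20) :* r :+ con (ι 1)))))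
         refl β r α μ)

    -- Since `ℓ = (β - r) + (1 + α)(r - 1)`, one has `ℓ ≥ 20β/21`. With `μ ≤ β/28` this gives
    -- `20/21 - 1/28 = 11/12`.
    bound₂ : ι 11 * β ≤ ι 12 * (ℓ + ι 2 - (μ + 1ℚ))
    bound₂ = *-cancel-≤ (ι>0 6) (≤-by
      (ι≥0 84 ⊛ (<⇒≤ 0<1+α ⊛ r-1≥0) ⊕ ι≥0 4 ⊛ diff≥0 21r≤β ⊕ ι≥0 3 ⊛ diff≥0 28μ≤β ⊕ ι≥0 84)
      (solve 4 (λ b r a m → con (ι 7) :* (con (ι 12) :* (r :* b :- con 1ℚ :- (r :- con 1ℚ) :* (b :- a) :+ con (ι 2) :- (m :+ con 1ℚ)))
         := con (ι 7) :* (con (ι 11) :* b) :+ (con (ι 84) :* ((con 1ℚ :+ a) :* (r :- con 1ℚ)) :+ con (ι 4) :* (b :- con (ι 21) :* r)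
              :+ con (ι 3) :* (b :- con (ι 28) :* m) :+ con (ι 84))) refl β r α μ))

    bound₃ : ι 20 * β ≤ ι 21 * ℓ
    bound₃ = ≤-by (ι≥0 21 ⊛ (<⇒≤ 0<1+α ⊛ r-1≥0) ⊕ diff≥0 21r≤β)
      (solve 3 (λ b r a → con (ι 21) :* (r :* b :- con 1ℚ :- (r :- con 1ℚ) :* (b :- a)) := con (ι 20) :* b :+
         (con (ι 21) :* ((con 1ℚ :+ a) :* (r :- con 1ℚ)) :+ (b :- con (ι 21) :* r))) refl β r α)

  -- The lines of a graph with rational parameters

  module _ (Γ : DistanceRegularGraph) where

    open DistanceRegularGraph Γ using (diameter; bᵢ; cᵢ; valency; order)
    open Distances Γ

    module RationalParameters
      (3≤D : 3 ℕ.≤ diameter) (b α β : ℚ) (b≥2 : ι 2 ≤ b) (g : ℕ → ℚ)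
      (g-zero : g 0 ≡ 0ℚ) (g-suc : ∀ i → g (suc i) ≡ b * g i + 1ℚ)
      (b-formula : ∀ i → i ℕ.< diameter → ι (bᵢ i) ≡ (g diameter - g i) * (β - α * g i))
      (c-formula : ∀ i → i ℕ.< diameter → ι (cᵢ (suc i)) ≡ g (suc i) * (1ℚ + α * g i))
      (4rμ≤β : 0ℚ ≤ α * b + b + α → ι 4 * (g diameter * (α * b + b + α)) ≤ β) (21r≤β : ι 21 * g diameter ≤ β)
      where


      0<D : 0 ℕ.< diameter
      0<D = ℕ.<-≤-trans ℕ.z<s 3≤D

      1<D : 1 ℕ.< diameter
      1<D = ℕ.<-≤-trans (ℕ.s<s ℕ.z<s) 3≤D

      open GaussNumbers b b≥2 g g-zero g-suc public

      1+αg>0 : ∀ i → i ℕ.< diameter → 0ℚ < 1ℚ + α * g i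
      1+αg>0 i i<D = ℚ.*-cancelˡ-<-nonNeg (g (suc i)) {{nonNegative (g≥0 (suc i))}}
        (subst₂ _<_ (sym (ℚ.*-zeroʳ (g (suc i)))) (c-formula i i<D) (c>0 i i<D))

      c₂≡ : ι (cᵢ 2) ≡ α * b + b + α + 1ℚ
      c₂≡ = trans (c-formula 1 1<D) (trans (cong₂ (λ x y → x * (1ℚ + α * y)) g2≡b+1 g1≡1)
        (solve 2 (λ a b → (b :+ con 1ℚ) :* (con 1ℚ :+ a :* con 1ℚ) := a :* b :+ b :+ a :+ con 1ℚ) refl α b))

      -- The number `c₂` is a positive integer, hence at least 1.
      μ≥0 : 0ℚ ≤ α * b + b + α
      μ≥0 = subst (0ℚ ≤_) (trans (cong (_- 1ℚ) c₂≡) (solve 1 (λ m → m :+ con 1ℚ :- con 1ℚ := m) refl (α * b + b + α)))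
        (diff≥0 (ι≥1 (cᵢ 2) (c>0 1 1<D)))
        where
        ι≥1 : ∀ n → 0ℚ < ι n → 1ℚ ≤ ι n
        ι≥1 zero    0<0 = contradiction 0<0 (<-irrefl refl)
        ι≥1 (suc n) _   = ≤-by (ι≥0 n) (ι-suc n)

      open Parameters diameter 3≤D b α β b≥2 g g-zero g-suc 1+αg>0 μ≥0 (4rμ≤β μ≥0) 21r≤β public

      valency≡ : ι valency ≡ r * β
      valency≡ = trans (b-formula 0 0<D) (trans (cong (λ e → (r - e) * (β - α * e)) g-zero)
        (solve 3 (λ r b a → (r :- con 0ℚ) :* (b :- a :* con 0ℚ) := r :* b) refl r β α))

      degree′ : ∀ y → ∑ (λ z → 𝟙 (adj y z)) ≡ r * β
      degree′ y = trans (degree 0<D y) valency≡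

      up : ∀ x y → ∑ (λ z → 𝟙 (adj y z) * E⟦ d x z , suc (d x y) ⟧) ≡ (r - g (d x y)) * (β - α * g (d x y))
      up x y with ℕ.m≤n⇒m<n∨m≡n (d≤diameter x y)
      ... | inj₁ d<D = trans (b-count x y d<D) (b-formula (d x y) d<D)
      ... | inj₂ d≡D = trans (b-count-diameter x y d≡D) (sym (trans
        (cong (_* (β - α * g (d x y))) (trans (cong (λ n → r - g n) d≡D) (ℚ.+-inverseʳ r))) (ℚ.*-zeroˡ (β - α * g (d x y)))))

      down : ∀ x y → ∑ (λ z → 𝟙 (adj y z) * E⟦ suc (d x z) , d x y ⟧) ≡ g (d x y) * (1ℚ + α * g (pred (d x y)))
      down x y = lemma (d x y) refl
        where
        lemma : ∀ j → d x y ≡ j → ∑ (λ z → 𝟙 (adj y z) * E⟦ suc (d x z) , j ⟧) ≡ g j * (1ℚ + α * g (pred j))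
        lemma zero    eq = trans (trans (∑-cong (λ z → ℚ.*-zeroʳ (𝟙 (adj y z)))) (∑-0 order))
          (sym (trans (cong (_* (1ℚ + α * g 0)) g-zero) (ℚ.*-zeroˡ (1ℚ + α * g 0))))
        lemma (suc i) eq = trans (c-count x y eq) (c-formula i (subst (ℕ._≤ diameter) eq (d≤diameter x y)))

      open Spectral adj adj-sym d d-sym d≡0⇒≡ d-refl d-adj d-step diameter d≤diameter 0<D g r α β
        g-zero g1≡1 refl g-suc>0 r-g≥0 β-αg>0 1+αg>0 ratio degree′ up down public
        using (three-term; Z; Z-sym; Z-diag; Z-adj; Z-eigen; Z-square; c; 1≤c; c≤2)

      open SimpleGraph adj adj-irrefl adj-sym using (nonadj; trichotomy; nonadj⇒≢; nonadj⇒¬adj)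

      common : ∀ {x y} → adj x y ≡ true → ∑ (λ z → 𝟙 (adj x z ∧ adj y z)) ≡ ℓ
      common {x} {y} x~y = begin
        ∑ (λ z → 𝟙 (adj x z ∧ adj y z))
          ≡⟨ ∑-cong (λ z → trans (𝟙-∧ (adj x z) (adj y z)) (trans (ℚ.*-comm (𝟙 (adj x z)) (𝟙 (adj y z)))
               (cong (𝟙 (adj y z) *_) (sym (E≡adj x z))))) ⟩
        ∑ (λ z → 𝟙 (adj y z) * E⟦ d x z , 1 ⟧)
          ≡⟨ three-term (λ m → E⟦ m , 1 ⟧) x y ⟩
        -- At `j = 1` the delta at distance 1 leaves the valency minus `c₁` and `b₁`.
        _ ≡⟨ cong (λ j → r * β * E⟦ j , 1 ⟧ + g j * (1ℚ + α * g (pred j)) * (E⟦ pred j , 1 ⟧ - E⟦ j , 1 ⟧)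
               + (r - g j) * (β - α * g j) * (E⟦ suc j , 1 ⟧ - E⟦ j , 1 ⟧)) (d-adj x~y) ⟩
        r * β * 1ℚ + g 1 * (1ℚ + α * g 0) * (0ℚ - 1ℚ) + (r - g 1) * (β - α * g 1) * (0ℚ - 1ℚ)
          ≡⟨ cong₂ (λ e e′ → r * β * 1ℚ + e * (1ℚ + α * e′) * (0ℚ - 1ℚ) + (r - e) * (β - α * e) * (0ℚ - 1ℚ)) g1≡1 g-zero ⟩
        r * β * 1ℚ + 1ℚ * (1ℚ + α * 0ℚ) * (0ℚ - 1ℚ) + (r - 1ℚ) * (β - α * 1ℚ) * (0ℚ - 1ℚ)
          ≡⟨ solve 3 (λ r b a → r :* b :* con 1ℚ :+ con 1ℚ :* (con 1ℚ :+ a :* con 0ℚ) :* (con 0ℚ :- con 1ℚ) :+ (r :- con 1ℚ) :* (b :- a :* con 1ℚ) :* (con 0ℚ :- con 1ℚ)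
                := r :* b :- con 1ℚ :- (r :- con 1ℚ) :* (b :- a)) refl r β α ⟩
        ℓ ∎
        where open ≡-Reasoning

      common-≤ : ∀ {x y} → nonadj x y ≡ true → ∑ (λ z → 𝟙 (adj x z ∧ adj y z)) ≤ μ + 1ℚ
      common-≤ {x} {y} x≁y with d x y ℕ.≟ 2
      ... | yes d≡2 = ≤-reflexive (trans (∑-cong (λ z → trans (𝟙-∧ (adj x z) (adj y z)) (trans (ℚ.*-comm (𝟙 (adj x z)) (𝟙 (adj y z)))
               (cong (𝟙 (adj y z) *_) (sym (E≡adj x z)))))) (trans (c-count x y d≡2) c₂≡))
      ... | no d≢2  = ≤-trans (≤-reflexive (trans (∑-cong (λ z → cong 𝟙 (¬true⇒false (none z)))) (∑-0 order))) (μ≥0 ⊕ ι≥0 1)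
        where
        none : ∀ z → ¬ (adj x z ∧ adj y z ≡ true)
        none z h = let x~z , y~z = ∧-true {adj x z} h in
          excluded (d x y) refl (subst (λ n → d x y ℕ.≤ suc n) (d-adj x~z) (d-step x (trans (adj-sym z y) y~z)))
          where
          excluded : ∀ n → d x y ≡ n → n ℕ.≤ 2 → ⊥
          excluded 0 eq _ = nonadj⇒≢ x≁y (d≡0⇒≡ eq)
          excluded 1 eq _ = true≢false (~⇒adj (d≡1⇒~ eq)) (nonadj⇒¬adj x≁y)
          excluded 2 eq _ = d≢2 eq
          excluded (suc (suc (suc n))) eq (ℕ.s≤s (ℕ.s≤s ()))

      μ≡μ+1-1 : μ ≡ μ + 1ℚ - 1ℚ
      μ≡μ+1-1 = solve 1 (λ m → m := m :+ con 1ℚ :- con 1ℚ) refl μ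

      open module NearCliques = SimpleGraph.NearCliques adj adj-irrefl adj-sym (r * β) ℓ (μ + 1ℚ) β degree′ common common-≤ β≥28
        (subst (λ e → ι 4 * ((r * β - 1ℚ - ℓ) * e) ≤ β * β) μ≡μ+1-1 bound₁) bound₂ bound₃
        (subst (λ e → ι 28 * e ≤ β) μ≡μ+1-1 28μ≤β)
        using (module Edge; L-unique)
      open Edge using (L; x∈L; y∈L; L-clique; L-large)

      L-adj : ∀ {x y z w} (x~y : adj x y ≡ true) → L x~y z ≡ true → L x~y w ≡ true → z ≢ w → adj z w ≡ true
      L-adj {z = z} {w} x~y Lz Lw z≢w with trichotomy z w
      ... | inj₁ z≡w        = contradiction z≡w z≢w
      ... | inj₂ (inj₁ z~w) = z~w
      ... | inj₂ (inj₂ z≁w) = contradiction (L-clique x~y Lz Lw) (true≢false z≁w)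

      open Enumeration adj L x∈L y∈L L-unique L-adj public

      size-large : ∀ i → ι 11 * β ≤ ι 14 * (∑ (λ z → 𝟙 (M i z)) - 1ℚ)
      size-large i = let _ , _ , e , _ , M≡L = M-line i in
        subst (λ s → ι 11 * β ≤ ι 14 * (s - 1ℚ)) (∑-cong (λ z → cong 𝟙 (sym (M≡L z)))) (L-large e)

      open Geometry adj adj-irrefl adj-sym M pair (λ {i} → M-adj {i}) r β degree′ public using (t; size; gram-apply)

      open module Full = Geometry.Fullness adj adj-irrefl adj-sym M pair (λ {i} → M-adj {i}) r β degree′
        Z c r>0 21r≤β 1≤c c≤2 size-large Z-sym Z-diag Z-adj Z-eigen Z-square public using (size≡; t≡r)

      psd : ∀ (f : Fin order → ℚ) → 0ℚ ≤ ∑ (λ x → f x * ∑ (λ y → 𝟙 (adj x y) * f y)) + r * ⟪ f , f ⟫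
      psd f = subst (0ℚ ≤_) eq (⟪⟫≥0 (λ i → ∑ (λ y → 𝟙 (M i y) * f y)))
        where
        open ≡-Reasoning
        on : Fin s → ℚ
        on i = ∑ (λ y → 𝟙 (M i y) * f y)
        eq : ⟪ on , on ⟫ ≡ ∑ (λ x → f x * ∑ (λ y → 𝟙 (adj x y) * f y)) + r * ⟪ f , f ⟫
        eq = begin
          ∑ (λ i → on i * on i)
            ≡⟨ ∑-cong (λ i → trans (sym (∑-*ʳ (λ x → 𝟙 (M i x) * f x) (on i)))
                 (∑-cong (λ x → solve 3 (λ m f o → m :* f :* o := f :* (m :* o)) refl (𝟙 (M i x)) (f x) (on i)))) ⟩
          ∑ (λ i → ∑ (λ x → f x * (𝟙 (M i x) * on i)))
            ≡⟨ ∑-swap (λ i x → f x * (𝟙 (M i x) * on i)) ⟩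
          ∑ (λ x → ∑ (λ i → f x * (𝟙 (M i x) * on i)))
            ≡⟨ ∑-cong (λ x → trans (∑-* (f x) (λ i → 𝟙 (M i x) * on i)) (trans
                 (cong (f x *_) (trans (gram-apply f x) (cong (λ t → ∑ (λ y → 𝟙 (adj x y) * f y) + t * f x) (t≡r x))))
                 (solve 3 (λ f s r → f :* (s :+ r :* f) := f :* s :+ r :* (f :* f)) refl (f x) (∑ (λ y → 𝟙 (adj x y) * f y)) r))) ⟩
          ∑ (λ x → f x * ∑ (λ y → 𝟙 (adj x y) * f y) + r * (f x * f x))
            ≡⟨ trans (∑-+ (λ x → f x * ∑ (λ y → 𝟙 (adj x y) * f y)) (λ x → r * (f x * f x)))
                 (cong (_+_ (∑ (λ x → f x * ∑ (λ y → 𝟙 (adj x y) * f y)))) (∑-* r (λ x → f x * f x))) ⟩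
          ∑ (λ x → f x * ∑ (λ y → 𝟙 (adj x y) * f y)) + r * ⟪ f , f ⟫ ∎

  -- Rational limits of reals

  a≤∣a∣ : ∀ a → a ≤ ∣ a ∣
  a≤∣a∣ a with ℚ.≤-total 0ℚ a
  ... | inj₁ a≥0 = ≤-reflexive (sym (ℚ.0≤p⇒∣p∣≡p a≥0))
  ... | inj₂ a≤0 = ≤-trans a≤0 (ℚ.0≤∣p∣ a)

  -a≤∣a∣ : ∀ a → - a ≤ ∣ a ∣
  -a≤∣a∣ a = subst (- a ≤_) (ℚ.∣-p∣≡∣p∣ a) (a≤∣a∣ (- a))

  ∣a-b∣≤⇒a≤b+ : ∀ {a b c} → ∣ a - b ∣ ≤ c → a ≤ b + c
  ∣a-b∣≤⇒a≤b+ {a} {b} {c} le = ≤-by (diff≥0 (≤-trans (a≤∣a∣ (a - b)) le))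
    (solve 3 (λ a b c → b :+ c := a :+ (c :- (a :- b))) refl a b c)

  ∣a-b∣≤⇒b≤a+ : ∀ {a b c} → ∣ a - b ∣ ≤ c → b ≤ a + c
  ∣a-b∣≤⇒b≤a+ {a} {b} {c} le = ≤-by (diff≥0 (≤-trans (-a≤∣a∣ (a - b)) le))
    (solve 3 (λ a b c → a :+ c := b :+ (c :- (:- (a :- b)))) refl a b c)

  ∣∣²≡ : ∀ a → ∣ a ∣ * ∣ a ∣ ≡ a * a
  ∣∣²≡ a with ℚ.∣p∣≡p∨∣p∣≡-p a
  ... | inj₁ eq = cong₂ _*_ eq eq
  ... | inj₂ eq = trans (cong₂ _*_ eq eq) (solve 1 (λ a → (:- a) :* (:- a) := a :* a) refl a)

  *-mono-≤ : ∀ {a b c d} → 0ℚ ≤ a → a ≤ b → 0ℚ ≤ c → c ≤ d → a * c ≤ b * d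
  *-mono-≤ {a} {b} {c} {d} a≥0 a≤b c≥0 c≤d = ≤-by
    (a≥0 ⊛ diff≥0 c≤d ⊕ diff≥0 a≤b ⊛ ≤-trans c≥0 c≤d)
    (solve 4 (λ a b c d → b :* d := a :* c :+ (a :* (d :- c) :+ (b :- a) :* d)) refl a b c d)

  ∣∣≤⇒²≤ : ∀ {a b} → ∣ a ∣ ≤ b → a * a ≤ b * b
  ∣∣≤⇒²≤ {a} {b} le = subst (_≤ b * b) (∣∣²≡ a) (*-mono-≤ (ℚ.0≤∣p∣ a) le (ℚ.0≤∣p∣ a) le)

  ²≤⇒∣∣≤ : ∀ {a b} → 0ℚ ≤ b → a * a ≤ b * b → ∣ a ∣ ≤ b
  ²≤⇒∣∣≤ {a} {b} b≥0 le = ℚ.≮⇒≥ λ b<∣a∣ → ≤⇒≯ le (subst (b * b <_) (∣∣²≡ a)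
    (≤-<-trans (*-mono-≤ˡ b≥0 (<⇒≤ b<∣a∣)) (<-by
      (0<* (diff>0 b<∣a∣) (≤-<-trans b≥0 b<∣a∣))
      (solve 2 (λ a b → a :* a := b :* a :+ (a :- b) :* a) refl ∣ a ∣ b))))

  ≤+ε⇒≤ : ∀ {a b} → (∀ ε → 0ℚ < ε → a ≤ b + ε) → a ≤ b
  ≤+ε⇒≤ {a} {b} h = ℚ.≮⇒≥ λ b<a → let ε = (a - b) * ι 2 ⁻¹ ; ε>0 = 0<* (diff>0 b<a) (⁻¹>0 (ι>0 1)) in
    ≤⇒≯ (h ε ε>0) (<-by ε>0 (trans
      (solve 2 (λ a b → a := b :+ (a :- b) :* con 1ℚ) refl a b)
      (trans (cong (λ e → b + (a - b) * e) (trans (sym (*-inverseʳ (>⇒≢0 (ι>0 1)))) (solve 1 (λ h → con (ι 2) :* h := h :+ h) refl (ι 2 ⁻¹))))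
      (solve 3 (λ a b h → b :+ (a :- b) :* (h :+ h) := b :+ (a :- b) :* h :+ (a :- b) :* h) refl a b (ι 2 ⁻¹)))))

  half : ∀ ε → 0ℚ < ε → ∃[ η ] 0ℚ < η × η + η ≡ ε
  half ε ε>0 = ε * ι 2 ⁻¹ , 0<* ε>0 (⁻¹>0 (ι>0 1)) , trans
    (solve 2 (λ e h → e :* h :+ e :* h := e :* (con (ι 2) :* h)) refl ε (ι 2 ⁻¹))
    (trans (cong (ε *_) (*-inverseʳ (>⇒≢0 (ι>0 1)))) (ℚ.*-identityʳ ε))

  infix 4 _⇝_

  _⇝_ : ℝ → ℚ → Set
  x ⇝ p = x ≈ ℚ⇒ℝ p

  private variable
    x y : ℝ
    p q : ℚ

  ⇝-const : ∀ p → ℚ⇒ℝ p ⇝ p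
  ⇝-const p ε ε>0 = 0 , λ _ _ → subst (_≤ ε) (sym (cong ∣_∣ (ℚ.+-inverseʳ p))) (<⇒≤ ε>0)

  ⇝-cong : (∀ n → seq x n ≡ seq y n) → x ⇝ p → y ⇝ p
  ⇝-cong {p = p} eq x⇝p ε ε>0 = let N , close = x⇝p ε ε>0 in
    N , λ n N≤n → subst (λ a → ∣ a - p ∣ ≤ ε) (eq n) (close n N≤n)

  ⇝-+ : x ⇝ p → y ⇝ q → (x Defs.+ y) ⇝ p + q
  ⇝-+ {x = x} {p = p} {y = y} {q = q} x⇝p y⇝q ε ε>0 =
    let η , η>0 , η+η≡ε = half ε ε>0
        M , closeˣ = x⇝p η η>0
        N , closeʸ = y⇝q η η>0
    in M ℕ.⊔ N , λ n le → subst₂ _≤_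
         (cong ∣_∣ (solve 4 (λ x y p q → x :- p :+ (y :- q) := x :+ y :- (p :+ q)) refl (seq x n) (seq y n) p q)) η+η≡ε
         (≤-trans (ℚ.∣p+q∣≤∣p∣+∣q∣ (seq x n - p) (seq y n - q))
           (ℚ.+-mono-≤ (closeˣ n (ℕ.m⊔n≤o⇒m≤o M N le)) (closeʸ n (ℕ.m⊔n≤o⇒n≤o M N le))))

  ⇝-neg : x ⇝ p → (Defs.- x) ⇝ - p
  ⇝-neg {x = x} {p = p} x⇝p ε ε>0 = let N , close = x⇝p ε ε>0 in
    N , λ n N≤n → subst (_≤ ε) (trans (sym (ℚ.∣-p∣≡∣p∣ (seq x n - p)))
      (cong ∣_∣ (solve 2 (λ x p → :- (x :- p) := (:- x) :- (:- p)) refl (seq x n) p))) (close n N≤n)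

  ⇝-- : x ⇝ p → y ⇝ q → (x Defs.- y) ⇝ p - q
  ⇝-- {x = x} {p = p} {y = y} {q = q} x⇝p y⇝q = ⇝-+ {x = x} {p = p} {y = Defs.- y} {q = (- q)} x⇝p (⇝-neg {x = y} {p = q} y⇝q)

  ⇝-* : x ⇝ p → y ⇝ q → (x Defs.* y) ⇝ p * q
  ⇝-* {x = x} {p = p} {y = y} {q = q} x⇝p y⇝q ε ε>0 =
    let M , closeˣ = x⇝p η η>0
        N , closeʸ = y⇝q η η>0
    in M ℕ.⊔ N , λ n le → bound (seq x n) (seq y n) (closeˣ n (ℕ.m⊔n≤o⇒m≤o M N le)) (closeʸ n (ℕ.m⊔n≤o⇒n≤o M N le))
    where
    open ℚ.≤-Reasoning
    K η : ℚ
    K = 1ℚ + ∣ p ∣ + ∣ q ∣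
    K>0 : 0ℚ < K
    K>0 = <-≤-trans (ι>0 0) (≤-by (ℚ.0≤∣p∣ p ⊕ ℚ.0≤∣p∣ q) (ℚ.+-assoc 1ℚ ∣ p ∣ ∣ q ∣))
    K+ε>0 : 0ℚ < K + ε
    K+ε>0 = ℚ.+-mono-< K>0 ε>0
    -- Chosen below 1, so that the product of the two errors is at most `η`, and with `η K ≤ ε`.
    η = ε * (K + ε) ⁻¹
    η>0 : 0ℚ < η
    η>0 = 0<* ε>0 (⁻¹>0 K+ε>0)
    ηK+ηε≡ε : η * (K + ε) ≡ ε
    ηK+ηε≡ε = trans (solve 3 (λ e k h → e :* h :* k := e :* (k :* h)) refl ε (K + ε) ((K + ε) ⁻¹))
      (trans (cong (ε *_) (*-inverseʳ (>⇒≢0 K+ε>0))) (ℚ.*-identityʳ ε))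
    η≤1 : η ≤ 1ℚ
    η≤1 = *-cancel-≤ K+ε>0 (≤-by (<⇒≤ K>0) (trans (solve 2 (λ k e → (k :+ e) :* con 1ℚ := e :+ k) refl K ε)
      (cong (_+ K) (trans (sym ηK+ηε≡ε) (ℚ.*-comm η (K + ε))))))
    bound : ∀ a b → ∣ a - p ∣ ≤ η → ∣ b - q ∣ ≤ η → ∣ a * b - p * q ∣ ≤ ε
    bound a b a≈p b≈q = begin
      ∣ a * b - p * q ∣
        ≡⟨ cong ∣_∣ (solve 4 (λ a b p q → a :* b :- p :* q := (a :- p) :* (b :- q) :+ (a :- p) :* q :+ p :* (b :- q)) refl a b p q) ⟩
      ∣ (a - p) * (b - q) + (a - p) * q + p * (b - q) ∣
        ≤⟨ ≤-trans (ℚ.∣p+q∣≤∣p∣+∣q∣ ((a - p) * (b - q) + (a - p) * q) (p * (b - q)))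
             (ℚ.+-monoˡ-≤ ∣ p * (b - q) ∣ (ℚ.∣p+q∣≤∣p∣+∣q∣ ((a - p) * (b - q)) ((a - p) * q))) ⟩
      ∣ (a - p) * (b - q) ∣ + ∣ (a - p) * q ∣ + ∣ p * (b - q) ∣
        ≡⟨ cong₂ _+_ (cong₂ _+_ (ℚ.∣p*q∣≡∣p∣*∣q∣ (a - p) (b - q)) (ℚ.∣p*q∣≡∣p∣*∣q∣ (a - p) q)) (ℚ.∣p*q∣≡∣p∣*∣q∣ p (b - q)) ⟩
      ∣ a - p ∣ * ∣ b - q ∣ + ∣ a - p ∣ * ∣ q ∣ + ∣ p ∣ * ∣ b - q ∣
        ≤⟨ ℚ.+-mono-≤ (ℚ.+-mono-≤ (*-mono-≤ (ℚ.0≤∣p∣ (a - p)) a≈p (ℚ.0≤∣p∣ (b - q)) (≤-trans b≈q η≤1))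
               (*-mono-≤ (ℚ.0≤∣p∣ (a - p)) a≈p (ℚ.0≤∣p∣ q) ≤-refl))
             (*-mono-≤ˡ (ℚ.0≤∣p∣ p) b≈q) ⟩
      η * 1ℚ + η * ∣ q ∣ + ∣ p ∣ * η
        ≤⟨ ≤-by (<⇒≤ η>0 ⊛ <⇒≤ ε>0) (solve 4 (λ h p q e → h :* (con 1ℚ :+ p :+ q :+ e) := h :* con 1ℚ :+ h :* q :+ p :* h :+ h :* e) refl η ∣ p ∣ ∣ q ∣ ε) ⟩
      η * (K + ε)
        ≡⟨ ηK+ηε≡ε ⟩
      ε ∎

  ⇝-≤ : x ⇝ p → y ⇝ q → x Defs.≤ y → p ≤ q
  ⇝-≤ {x = x} {p = p} {y = y} {q = q} x⇝p y⇝q x≤y = ≤+ε⇒≤ λ ε ε>0 →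
    let η , η>0 , η+η≡ε = half ε ε>0
        ζ , ζ>0 , ζ+ζ≡η = half η η>0
        L , closeˣ = x⇝p η η>0
        M , closeʸ = y⇝q ζ ζ>0
        N , le     = x≤y ζ ζ>0
        n = L ℕ.⊔ (M ℕ.⊔ N)
        M⊔N≤n = ℕ.m≤n⊔m L (M ℕ.⊔ N)
    in ≤-by {e = (seq x n + η - p) + (seq y n + ζ - seq x n) + (q + ζ - seq y n)}
         (diff≥0 (∣a-b∣≤⇒b≤a+ {seq x n} {p} (closeˣ n (ℕ.m≤m⊔n L _)))
           ⊕ diff≥0 (le n (ℕ.≤-trans (ℕ.m≤n⊔m M N) M⊔N≤n))
           ⊕ diff≥0 (∣a-b∣≤⇒a≤b+ {seq y n} {q} (closeʸ n (ℕ.≤-trans (ℕ.m≤m⊔n M N) M⊔N≤n))))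
         (trans (cong (_+_ q) (trans (sym η+η≡ε) (cong (_+ η) (sym ζ+ζ≡η))))
           (solve 6 (λ q p x y η ζ → q :+ (ζ :+ ζ :+ η) := p :+ ((x :+ η :- p) :+ (y :+ ζ :- x) :+ (q :+ ζ :- y))) refl q p (seq x n) (seq y n) η ζ))

  ≈⇒≤ : x ≈ y → x Defs.≤ y
  ≈⇒≤ {x = x} {y = y} x≈y ε ε>0 = let N , close = x≈y ε ε>0 in N , λ n N≤n → ∣a-b∣≤⇒a≤b+ {seq x n} (close n N≤n)

  ≈⇒≥ : x ≈ y → y Defs.≤ x
  ≈⇒≥ {x = x} {y = y} x≈y ε ε>0 = let N , close = x≈y ε ε>0 in N , λ n N≤n → ∣a-b∣≤⇒b≤a+ {seq x n} (close n N≤n)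

  ⇝-unique : x ⇝ p → y ⇝ q → x ≈ y → p ≡ q
  ⇝-unique {x = x} {p = p} {y = y} {q = q} x⇝p y⇝q x≈y = ≤-antisym
    (⇝-≤ {x = x} {p = p} {y = y} {q = q} x⇝p y⇝q (≈⇒≤ {x = x} {y = y} x≈y)) (⇝-≤ {x = y} {p = q} {y = x} {q = p} y⇝q x⇝p (≈⇒≥ {x = x} {y = y} x≈y))

  ≈-const : ∀ c → ℚ⇒ℝ c ≈ x → x ⇝ c
  ≈-const {x = x} c c≈x ε ε>0 = let N , close = c≈x ε ε>0 in N , λ n N≤n →
    subst (_≤ ε) (trans (sym (ℚ.∣-p∣≡∣p∣ (c - seq x n))) (cong ∣_∣ (solve 2 (λ c x → :- (c :- x) := x :- c) refl c (seq x n)))) (close n N≤n)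

  ⊔-≤ˡ : ∀ {z} → (x Defs.⊔ y) Defs.≤ z → x Defs.≤ z
  ⊔-≤ˡ {x = x} {y = y} le ε ε>0 = let N , h = le ε ε>0 in N , λ n N≤n → ≤-trans (ℚ.p≤p⊔q (seq x n) (seq y n)) (h n N≤n)

  ⊔-≤ʳ : ∀ {z} → (x Defs.⊔ y) Defs.≤ z → y Defs.≤ z
  ⊔-≤ʳ {x = x} {y = y} le ε ε>0 = let N , h = le ε ε>0 in N , λ n N≤n → ≤-trans (ℚ.p≤q⊔p (seq x n) (seq y n)) (h n N≤n)

  seq-∑ : ∀ {l} (f : Fin l → ℝ) n → seq (Defs.∑ f) n ≡ ∑ (λ i → seq (f i) n)
  seq-∑ {zero}  f n = refl
  seq-∑ {suc l} f n = cong (_+_ (seq (f zero) n)) (seq-∑ (f ∘ suc) n)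

  eventually : ∀ {l} {P : Fin l → ℕ → Set} → (∀ i → ∃[ N ] (∀ n → N ℕ.≤ n → P i n)) →
    ∃[ N ] (∀ n → N ℕ.≤ n → ∀ i → P i n)
  eventually {zero}  h = 0 , λ _ _ ()
  eventually {suc l} h =
    let M , hM = h zero
        N , hN = eventually (h ∘ suc)
    in M ℕ.⊔ N , λ { n le zero    → hM n (ℕ.m⊔n≤o⇒m≤o M N le)
                   ; n le (suc i) → hN n (ℕ.m⊔n≤o⇒n≤o M N le) i }

  -- Real eigenvalues

  opaque
    -- A rational substitute for the square root of the number of vertices.
    square-above : ∀ a → 0ℚ ≤ a → ∃[ k ] 0ℚ < k × a ≤ k * k
    square-above a a≥0 = 1ℚ + a , ℚ.+-mono-<-≤ (ι>0 0) a≥0 , ≤-by (ι≥0 1 ⊕ a≥0 ⊕ sq≥0 a)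
      (solve 1 (λ a → (con 1ℚ :+ a) :* (con 1ℚ :+ a) := a :+ (con (ι 1) :+ a :+ a :* a)) refl a)

  seq-∑-* : ∀ {l} (a u : Fin l → ℝ) n → seq (Defs.∑ (λ y → a y Defs.* u y)) n ≡ ∑ (λ y → seq (a y) n * seq (u y) n)
  seq-∑-* a u n = seq-∑ (λ y → a y Defs.* u y) n

  -- Names are qualified because comparing reals is feasible only as long as the two sides
  -- agree syntactically, which fails for the copies made by opening the record.
  module Eigenvalues (G : Defs.Graph) where

    Vertex : Set
    Vertex = Defs.Graph.Vertex G

    order : ℕ
    order = Defs.Graph.order G

    adj : Vertex → Vertex → Bool
    adj x y = does (Defs.Graph._~?_ G x y)

    A_∙_ : Vertex → (Vertex → ℚ) → ℚ
    A x ∙ f = ∑ (λ y → 𝟙 (adj x y) * f y)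

    seq-A : ∀ (u : Vertex → ℝ) x n → seq (Defs.∑ (λ y → Defs.Graph.adjacency G x y Defs.* u y)) n ≡ A x ∙ (λ y → seq (u y) n)
    seq-A u x n = trans (seq-∑-* (Defs.Graph.adjacency G x) u n) (∑-cong λ y → cong (_* seq (u y) n) (seq-if (adj x y)))
      where
      seq-if : ∀ a → seq (if a then 1ℝ else 0ℝ) n ≡ 𝟙 a
      seq-if true  = refl
      seq-if false = refl

    eigenvector⇒eigenvalue : ∀ θ (f : Vertex → ℚ) x₀ → f x₀ ≡ 1ℚ → (∀ x → A x ∙ f ≡ θ * f x) → Defs.Graph.IsEigenvalue G (ℚ⇒ℝ θ)
    eigenvector⇒eigenvalue θ f x₀ fx₀≡1 Af≡θf = (λ x → ℚ⇒ℝ (f x))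
      , (λ f≈0 → contradiction (⇝-unique {x = ℚ⇒ℝ (f x₀)} {p = f x₀} {y = 0ℝ} {q = 0ℚ} (⇝-const (f x₀)) (⇝-const 0ℚ) (f≈0 x₀))
          λ fx₀≡0 → contradiction (trans (sym fx₀≡1) fx₀≡0) λ ())
      , λ x ε ε>0 → 0 , λ n _ → subst (_≤ ε) (sym (cong ∣_∣ (trans (cong (_- θ * f x) (trans (seq-A (λ x → ℚ⇒ℝ (f x)) x n) (Af≡θf x))) (ℚ.+-inverseʳ (θ * f x))))) (<⇒≤ ε>0)

    -- A finite stage of a real eigenvector is only an approximate eigenvector. If `θ` lies at least
    -- `δ` below `-r`, positive semidefiniteness forces the residual `e` to satisfy `|e| ≥ δ |f|`,
    -- so a small residual makes `f` small.
    residual-bound : ∀ r θ δ η (f : Vertex → ℚ) → (∀ h → 0ℚ ≤ ∑ (λ x → h x * (A x ∙ h)) + r * ⟪ h , h ⟫) →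
      0ℚ < δ → θ + δ ≤ - r → (∀ x → ∣ A x ∙ f - θ * f x ∣ ≤ η) → ∀ x → δ * f x * (δ * f x) ≤ ι order * (η * η)
    residual-bound r θ δ η f psd δ>0 θ+δ≤-r close x = ≤-trans
      (≤-trans (≤-reflexive (solve 2 (λ d f → d :* f :* (d :* f) := d :* d :* (f :* f)) refl δ (f x)))
               (*-mono-≤ˡ (sq≥0 δ) (term≤∑ {f = λ x → f x * f x} (λ x → sq≥0 (f x)) x)))
      (≤-trans δ²ff≤ee ee≤)
      where
      e : Vertex → ℚ
      e x = A x ∙ f - θ * f x
      ee≤ : ⟪ e , e ⟫ ≤ ι order * (η * η)
      ee≤ = ≤-trans (∑-mono {order} λ x → ∣∣≤⇒²≤ (close x)) (≤-reflexive (∑-const order (η * η)))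
      fAf : ∑ (λ x → f x * (A x ∙ f)) ≡ ⟪ f , e ⟫ + θ * ⟪ f , f ⟫
      fAf = trans (∑-cong λ x → solve 3 (λ f a t → f :* a := f :* (a :- t :* f) :+ t :* (f :* f)) refl (f x) (A x ∙ f) θ)
        (trans (∑-+ (λ x → f x * e x) (λ x → θ * (f x * f x))) (cong (_+_ ⟪ f , e ⟫) (∑-* θ (λ x → f x * f x))))
      -- 0 ≤ |δf - e|², where ⟪ f , e ⟫ ≥ δ ⟪ f , f ⟫.
      δ²ff≤ee : δ * δ * ⟪ f , f ⟫ ≤ ⟪ e , e ⟫
      δ²ff≤ee = ≤-by
        (⟪⟫≥0 (λ x → e x - δ * f x) ⊕ ι≥0 2 ⊛ (<⇒≤ δ>0 ⊛ subst (λ s → 0ℚ ≤ s + r * ⟪ f , f ⟫) fAf (psd f))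
          ⊕ ι≥0 2 ⊛ (<⇒≤ δ>0 ⊛ (diff≥0 θ+δ≤-r ⊛ ⟪⟫≥0 f)))
        (trans
          (solve 6 (λ d ff fe ee t r → ee := d :* d :* ff :+ (ee :- d :* fe :- d :* (fe :- d :* ff) :+ con (ι 2) :* (d :* (fe :+ t :* ff :+ r :* ff))
              :+ con (ι 2) :* (d :* ((:- r :- (t :+ d)) :* ff)))) refl δ ⟪ f , f ⟫ ⟪ f , e ⟫ ⟪ e , e ⟫ θ r)
          (cong (λ s → δ * δ * ⟪ f , f ⟫ + (s + ι 2 * (δ * (⟪ f , e ⟫ + θ * ⟪ f , f ⟫ + r * ⟪ f , f ⟫)) + ι 2 * (δ * ((- r - (θ + δ)) * ⟪ f , f ⟫))))
            (sym (trans (⟪⟫-subˡ e f (λ x → e x - δ * f x) δ) (cong₂ (λ a b → a - δ * b)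
              (trans (⟪⟫-subʳ e e f δ) (cong (λ a → ⟪ e , e ⟫ - δ * a) (⟪⟫-comm e f)))
              (⟪⟫-subʳ f e f δ))))))

    PSD : ℚ → Set
    PSD r = ∀ h → 0ℚ ≤ ∑ (λ x → h x * (A x ∙ h)) + r * ⟪ h , h ⟫

    residual→0 : ∀ (θ : ℝ) (u : Vertex → ℝ) →
      (∀ x → Defs.∑ (λ y → Defs.Graph.adjacency G x y Defs.* u y) ≈ θ Defs.* u x) → ∀ η → 0ℚ < η →
      ∃[ N ] (∀ n → N ℕ.≤ n → ∀ x → ∣ A x ∙ (λ y → seq (u y) n) - seq θ n * seq (u x) n ∣ ≤ η)
    residual→0 θ u Au≈θu η η>0 = eventually
      {P = λ x n → ∣ A x ∙ (λ y → seq (u y) n) - seq θ n * seq (u x) n ∣ ≤ η} λ x →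
      proj₁ (Au≈θu x η η>0) , λ n N≤n →
        subst (λ a → ∣ a - seq θ n * seq (u x) n ∣ ≤ η) (seq-A u x n) (proj₂ (Au≈θu x η η>0) n N≤n)

    residual-small⇒null : ∀ r θ (u : Vertex → ℝ) δ N → PSD r → 0ℚ < δ → (∀ n → N ℕ.≤ n → seq θ n + δ ≤ - r) →
      (∀ η → 0ℚ < η →
        ∃[ N ] (∀ n → N ℕ.≤ n → ∀ x → ∣ A x ∙ (λ y → seq (u y) n) - seq θ n * seq (u x) n ∣ ≤ η)) →
      ∀ x → u x ⇝ 0ℚ
    residual-small⇒null r θ u δ N psd δ>0 gap small x ζ ζ>0 = let K , close = small η η>0 in
      K ℕ.⊔ N , λ n le → subst (λ a → ∣ a ∣ ≤ ζ) (solve 1 (λ a → a := a :- con 0ℚ) refl (seq (u x) n))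
        (²≤⇒∣∣≤ (<⇒≤ ζ>0) (*-cancel-≤ (0<* δ>0 δ>0) (≤-trans
          (≤-trans (≤-reflexive (solve 2 (λ d f → d :* d :* (f :* f) := d :* f :* (d :* f)) refl δ (seq (u x) n)))
            (residual-bound r (seq θ n) δ η (λ x → seq (u x) n) psd δ>0 (gap n (ℕ.m⊔n≤o⇒n≤o K N le))
              (close n (ℕ.m⊔n≤o⇒m≤o K N le)) x))
          η-small)))
      where
      k η : ℚ
      k = proj₁ (square-above (ι order) (ι≥0 order))
      η = δ * ζ * k ⁻¹
      k>0 : 0ℚ < k
      k>0 = proj₁ (proj₂ (square-above (ι order) (ι≥0 order)))
      η>0 : 0ℚ < η
      η>0 = 0<* (0<* δ>0 ζ>0) (⁻¹>0 k>0)
      η-small : ι order * (η * η) ≤ δ * δ * (ζ * ζ)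
      η-small = ≤-trans (*-mono-≤ (ι≥0 order) (proj₂ (proj₂ (square-above (ι order) (ι≥0 order)))) (sq≥0 η) ≤-refl)
        (≤-reflexive (trans (solve 4 (λ d z k i → k :* k :* (d :* z :* i :* (d :* z :* i)) := d :* d :* (z :* z) :* (k :* i :* (k :* i))) refl δ ζ k (k ⁻¹))
          (trans (cong (λ e → δ * δ * (ζ * ζ) * (e * e)) (*-inverseʳ (>⇒≢0 k>0))) (ℚ.*-identityʳ (δ * δ * (ζ * ζ))))))

    -- Two reals cannot be compared by cases, so `-r` is compared with a single rational term of
    -- `θ`, after which `θ` moves by at most `δ = ε/4`. If this term is at most `-r - 2δ`, all later
    -- ones are at most `-r - δ`, and `u` would tend to 0.
    psd⇒residual-bounded-below : ∀ r → PSD r → ∀ θ (u : Vertex → ℝ) →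
      (∀ η → 0ℚ < η →
        ∃[ N ] (∀ n → N ℕ.≤ n → ∀ x → ∣ A x ∙ (λ y → seq (u y) n) - seq θ n * seq (u x) n ∣ ≤ η)) →
      ¬ (∀ x → u x ⇝ 0ℚ) → ∀ ε → 0ℚ < ε → ∃[ N ] (∀ n → N ℕ.≤ n → - r ≤ seq θ n + ε)
    psd⇒residual-bounded-below r psd θ u small u≢0 ε ε>0 =
      let η , η>0 , η+η≡ε = half ε ε>0
          δ , δ>0 , δ+δ≡η = half η η>0
      in quarters δ δ>0 (trans (cong₂ _+_ δ+δ≡η δ+δ≡η) η+η≡ε)
      where
      quarters : ∀ δ → 0ℚ < δ → δ + δ + (δ + δ) ≡ ε → ∃[ N ] (∀ n → N ℕ.≤ n → - r ≤ seq θ n + ε)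
      quarters δ δ>0 refl = cases (ℚ.≤-total (- r) (seq θ N + (δ + δ)))
        where
        N = proj₁ (cauchy θ δ δ>0)
        close : ∀ n → N ℕ.≤ n → ∣ seq θ N - seq θ n ∣ ≤ δ
        close n N≤n = proj₂ (cauchy θ δ δ>0) N n ℕ.≤-refl N≤n
        cases : - r ≤ seq θ N + (δ + δ) ⊎ seq θ N + (δ + δ) ≤ - r → ∃[ N ] (∀ n → N ℕ.≤ n → - r ≤ seq θ n + ε)
        cases (inj₁ -r≤) = N , λ n N≤n → ≤-trans -r≤ (≤-by {e = seq θ n + δ - seq θ N + δ}
          (diff≥0 (∣a-b∣≤⇒a≤b+ {seq θ N} {seq θ n} (close n N≤n)) ⊕ <⇒≤ δ>0)
          (solve 3 (λ s t d → t :+ (d :+ d :+ (d :+ d)) := s :+ (d :+ d) :+ (t :+ d :- s :+ d)) refl (seq θ N) (seq θ n) δ))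
        cases (inj₂ ≤-r) = contradiction
          (residual-small⇒null r θ u δ N psd δ>0
            (λ n N≤n → ≤-trans (≤-by (diff≥0 (∣a-b∣≤⇒b≤a+ {seq θ N} {seq θ n} (close n N≤n)))
              (solve 3 (λ s t d → s :+ (d :+ d) := t :+ d :+ (s :+ d :- t)) refl (seq θ N) (seq θ n) δ)) ≤-r)
            small)
          u≢0

    psd⇒eigenvalue≥ : ∀ r → PSD r → ∀ θ → Defs.Graph.IsEigenvalue G θ → ℚ⇒ℝ (- r) Defs.≤ θ
    psd⇒eigenvalue≥ r psd θ (u , u≢0 , Au≈θu) = psd⇒residual-bounded-below r psd θ u (residual→0 θ u Au≈θu) u≢0

  -- Gaussian numbers and the limits of the parameters

  ÷-cancel : ∀ p q .{{_ : NonZero q}} → (p ÷ q) * q ≡ p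
  ÷-cancel p q = trans (ℚ.*-assoc p (1/ q) q) (trans (cong (p *_) (ℚ.*-inverseˡ q)) (ℚ.*-identityʳ p))

  module Gauss (b : ℤ) .{{_ : ℤ.NonZero (b ℤ.- + 1)}} (b≥2 : + 2 ℤ.≤ b) where

    b̂ : ℚ
    b̂ = fromℤ b

    b̂≥2 : ι 2 ≤ b̂
    b̂≥2 = fromℤ-mono b≥2

    g : ℕ → ℚ
    g j = fromℤ (b ℤ.^ j ℤ.- + 1) ÷ fromℤ (b ℤ.- + 1)

    b̂-1>0 : 0ℚ < b̂ - 1ℚ
    b̂-1>0 = <-by (ℚ.+-mono-<-≤ (ι>0 0) (diff≥0 b̂≥2)) (solve 1 (λ b → b :- con 1ℚ := con 0ℚ :+ (con (ι 1) :+ (b :- con (ι 2)))) refl b̂)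

    fromℤ-pred : ∀ i → fromℤ (i ℤ.- + 1) ≡ fromℤ i - 1ℚ
    fromℤ-pred i = fromℤ-+ i (ℤ.- + 1)

    g*[b-1] : ∀ j → g j * (b̂ - 1ℚ) ≡ fromℤ (b ℤ.^ j) - 1ℚ
    g*[b-1] j = trans (cong (g j *_) (sym (fromℤ-pred b)))
      (trans (÷-cancel (fromℤ (b ℤ.^ j ℤ.- + 1)) (fromℤ (b ℤ.- + 1))) (fromℤ-pred (b ℤ.^ j)))

    g-zero : g 0 ≡ 0ℚ
    g-zero = *-cancel-≡ (>⇒≢0 b̂-1>0) (trans (ℚ.*-comm (b̂ - 1ℚ) (g 0)) (trans (g*[b-1] 0) (sym (ℚ.*-zeroʳ (b̂ - 1ℚ)))))

    g-suc : ∀ i → g (suc i) ≡ b̂ * g i + 1ℚ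
    g-suc i = *-cancel-≡ (>⇒≢0 b̂-1>0) (begin
      (b̂ - 1ℚ) * g (suc i)
        ≡⟨ trans (ℚ.*-comm (b̂ - 1ℚ) (g (suc i))) (trans (g*[b-1] (suc i)) (cong (_- 1ℚ) (fromℤ-* b (b ℤ.^ i)))) ⟩
      b̂ * fromℤ (b ℤ.^ i) - 1ℚ
        ≡⟨ solve 2 (λ b p → b :* p :- con 1ℚ := b :* (p :- con 1ℚ) :+ (b :- con 1ℚ)) refl b̂ (fromℤ (b ℤ.^ i)) ⟩
      b̂ * (fromℤ (b ℤ.^ i) - 1ℚ) + (b̂ - 1ℚ)
        ≡⟨ cong (λ e → b̂ * e + (b̂ - 1ℚ)) (g*[b-1] i) ⟨
      b̂ * (g i * (b̂ - 1ℚ)) + (b̂ - 1ℚ)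
        ≡⟨ solve 2 (λ b g → b :* (g :* (b :- con 1ℚ)) :+ (b :- con 1ℚ) := (b :- con 1ℚ) :* (b :* g :+ con 1ℚ)) refl b̂ (g i) ⟩
      (b̂ - 1ℚ) * (b̂ * g i + 1ℚ) ∎)
      where open ≡-Reasoning

    φ : ℚ
    φ = fromℤ (+ 2 ℤ.* b ℤ.+ + 4) ÷ fromℤ (+ 2 ℤ.* b ℤ.+ + 3)
      where instance _ = 2b+3-nonZero b

    φ≥1 : 1ℚ ≤ φ
    φ≥1 = *-cancel-≤ 2b+3>0 (≤-by (ι≥0 1) (trans (ℚ.*-comm (ι 2 * b̂ + ι 3) φ) (trans φ*[2b+3]
        (solve 1 (λ b → con (ι 2) :* b :+ con (ι 4) := (con (ι 2) :* b :+ con (ι 3)) :* con 1ℚ :+ con (ι 1)) refl b̂))))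
      where
      instance _ = 2b+3-nonZero b
      2b+ : ∀ n → fromℤ (+ 2 ℤ.* b ℤ.+ + n) ≡ ι 2 * b̂ + ι n
      2b+ n = trans (fromℤ-+ (+ 2 ℤ.* b) (+ n)) (cong (_+ ι n) (fromℤ-* (+ 2) b))
      φ*[2b+3] : φ * (ι 2 * b̂ + ι 3) ≡ ι 2 * b̂ + ι 4
      φ*[2b+3] = trans (cong (φ *_) (sym (2b+ 3))) (trans (÷-cancel (fromℤ (+ 2 ℤ.* b ℤ.+ + 4)) (fromℤ (+ 2 ℤ.* b ℤ.+ + 3))) (2b+ 4))
      2b+3>0 : 0ℚ < ι 2 * b̂ + ι 3
      2b+3>0 = <-by (ℚ.+-mono-<-≤ (ι>0 6) (ι≥0 2 ⊛ diff≥0 b̂≥2))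
        (solve 1 (λ b → con (ι 2) :* b :+ con (ι 3) := con 0ℚ :+ (con (ι 7) :+ con (ι 2) :* (b :- con (ι 2)))) refl b̂)

  -- In the limit every real of the hypotheses is rational: k = r β, and c₂ = [2](1 + α).
  module Limits (b : ℤ) .{{_ : ℤ.NonZero (b ℤ.- + 1)}} (b≥2 : + 2 ℤ.≤ b) (D : ℕ) (3≤D : 3 ℕ.≤ D)
    (bᵢ cᵢ : ℕ → ℕ) (α β : ℝ)
    (b-formula : ∀ i → i ℕ.< D → ℕ⇒ℝ (bᵢ i) ≈ (gauss b D Defs.- gauss b i) Defs.* (β Defs.- α Defs.* gauss b i))
    (c-formula : ∀ i → i ℕ.< D → ℕ⇒ℝ (cᵢ (suc i)) ≈ gauss b (suc i) Defs.* (1ℝ Defs.+ α Defs.* gauss b i))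
    where

    open Gauss b b≥2
    open GaussNumbers b̂ b̂≥2 g g-zero g-suc using (g1≡1; g2≡b+1; g-suc>0; g-mono; b≥0)

    r>0 : 0ℚ < g D
    r>0 = <-≤-trans (g-suc>0 0) (g-mono (ℕ.≤-trans (ℕ.s≤s ℕ.z≤n) 3≤D))

    β̂ α̂ : ℚ
    β̂ = g D ⁻¹ * ι (bᵢ 0)
    α̂ = g 2 ⁻¹ * ι (cᵢ 2) - 1ℚ

    β⇝β̂ : β ⇝ β̂
    β⇝β̂ = ⇝-cong {x = ℚ⇒ℝ (g D ⁻¹) Defs.* X} {y = β} {p = β̂} pointwise
      (⇝-* {x = ℚ⇒ℝ (g D ⁻¹)} {p = g D ⁻¹} {y = X} {q = ι (bᵢ 0)} (⇝-const (g D ⁻¹))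
        (≈-const {x = X} (ι (bᵢ 0)) (b-formula 0 (ℕ.<-≤-trans ℕ.z<s 3≤D))))
      where
      X : ℝ
      X = (gauss b D Defs.- gauss b 0) Defs.* (β Defs.- α Defs.* gauss b 0)
      -- Dividing `X` by `[D]` gives back the sequence of `β` term by term, so `β` inherits the
      -- limit of `X` divided by `[D]`.
      pointwise : ∀ n → g D ⁻¹ * ((g D - g 0) * (seq β n - seq α n * g 0)) ≡ seq β n
      pointwise n = trans (cong (λ e → g D ⁻¹ * ((g D - e) * (seq β n - seq α n * e))) g-zero)
        (trans (solve 4 (λ r i b a → i :* ((r :- con 0ℚ) :* (b :- a :* con 0ℚ)) := r :* i :* b) refl (g D) (g D ⁻¹) (seq β n) (seq α n))
        (trans (cong (_* seq β n) (*-inverseʳ (>⇒≢0 r>0))) (ℚ.*-identityˡ (seq β n))))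

    α⇝α̂ : α ⇝ α̂
    α⇝α̂ = ⇝-cong {x = ℚ⇒ℝ (g 2 ⁻¹) Defs.* X Defs.- 1ℝ} {y = α} {p = α̂} pointwise
      (⇝-- {x = ℚ⇒ℝ (g 2 ⁻¹) Defs.* X} {p = g 2 ⁻¹ * ι (cᵢ 2)} {y = 1ℝ} {q = 1ℚ}
        (⇝-* {x = ℚ⇒ℝ (g 2 ⁻¹)} {p = g 2 ⁻¹} {y = X} {q = ι (cᵢ 2)} (⇝-const (g 2 ⁻¹))
          (≈-const {x = X} (ι (cᵢ 2)) (c-formula 1 (ℕ.<-≤-trans (ℕ.s<s ℕ.z<s) 3≤D))))
        (⇝-const 1ℚ))
      where
      X : ℝ
      X = gauss b 2 Defs.* (1ℝ Defs.+ α Defs.* gauss b 1)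
      pointwise : ∀ n → g 2 ⁻¹ * (g 2 * (1ℚ + seq α n * g 1)) - 1ℚ ≡ seq α n
      pointwise n = trans (cong (λ e → g 2 ⁻¹ * (g 2 * (1ℚ + seq α n * e)) - 1ℚ) g1≡1)
        (trans (solve 3 (λ g i a → i :* (g :* (con 1ℚ :+ a :* con 1ℚ)) :- con 1ℚ := g :* i :* (con 1ℚ :+ a) :- con 1ℚ) refl (g 2) (g 2 ⁻¹) (seq α n))
        (trans (cong (λ e → e * (1ℚ + seq α n) - 1ℚ) (*-inverseʳ (>⇒≢0 (g-suc>0 1)))) (solve 1 (λ a → con 1ℚ :* (con 1ℚ :+ a) :- con 1ℚ := a) refl (seq α n))))

    b-formula′ : ∀ i → i ℕ.< D → ι (bᵢ i) ≡ (g D - g i) * (β̂ - α̂ * g i)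
    b-formula′ i i<D = ⇝-unique {x = ℕ⇒ℝ (bᵢ i)} {p = ι (bᵢ i)} {y = X} {q = (g D - g i) * (β̂ - α̂ * g i)}
      (⇝-const (ι (bᵢ i)))
      (⇝-* {x = gauss b D Defs.- gauss b i} {p = g D - g i} {y = β Defs.- α Defs.* gauss b i} {q = β̂ - α̂ * g i}
        (⇝-- {x = gauss b D} {p = g D} {y = gauss b i} {q = g i} (⇝-const (g D)) (⇝-const (g i)))
        (⇝-- {x = β} {p = β̂} {y = α Defs.* gauss b i} {q = α̂ * g i} β⇝β̂
          (⇝-* {x = α} {p = α̂} {y = gauss b i} {q = g i} α⇝α̂ (⇝-const (g i)))))
      (b-formula i i<D)
      where
      X : ℝ
      X = (gauss b D Defs.- gauss b i) Defs.* (β Defs.- α Defs.* gauss b i)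

    c-formula′ : ∀ i → i ℕ.< D → ι (cᵢ (suc i)) ≡ g (suc i) * (1ℚ + α̂ * g i)
    c-formula′ i i<D = ⇝-unique {x = ℕ⇒ℝ (cᵢ (suc i))} {p = ι (cᵢ (suc i))} {y = X} {q = g (suc i) * (1ℚ + α̂ * g i)}
      (⇝-const (ι (cᵢ (suc i))))
      (⇝-* {x = gauss b (suc i)} {p = g (suc i)} {y = 1ℝ Defs.+ α Defs.* gauss b i} {q = 1ℚ + α̂ * g i}
        (⇝-const (g (suc i)))
        (⇝-+ {x = 1ℝ} {p = 1ℚ} {y = α Defs.* gauss b i} {q = α̂ * g i} (⇝-const 1ℚ)
          (⇝-* {x = α} {p = α̂} {y = gauss b i} {q = g i} α⇝α̂ (⇝-const (g i)))))
      (c-formula i i<D)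
      where
      X : ℝ
      X = gauss b (suc i) Defs.* (1ℝ Defs.+ α Defs.* gauss b i)

    module _ (bound₁ : ([2b+4]/[2b+3] b Defs.* gauss b D Defs.* (ℤ⇒ℝ b Defs.+ ℕ⇒ℝ 2) Defs.* (α Defs.* ℤ⇒ℝ b Defs.+ ℤ⇒ℝ b Defs.+ α)) Defs.≤ β)
      (bound₂ : ([2b+4]/[2b+3] b Defs.* gauss b D Defs.* ((ℤ⇒ℝ b Defs.+ 1ℝ) Defs.* (ℤ⇒ℝ b Defs.* ℤ⇒ℝ b Defs.+ ℤ⇒ℝ b Defs.+ ℕ⇒ℝ 2) Defs.- ℕ⇒ℝ 3)) Defs.≤ β)
      where

      bound₁′ : φ * g D * (b̂ + ι 2) * (α̂ * b̂ + b̂ + α̂) ≤ β̂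
      bound₁′ = ⇝-≤ {x = U Defs.* V} {p = φ * g D * (b̂ + ι 2) * (α̂ * b̂ + b̂ + α̂)} {y = β} {q = β̂}
        (⇝-* {x = U} {p = φ * g D * (b̂ + ι 2)} {y = V} {q = α̂ * b̂ + b̂ + α̂} (⇝-const (φ * g D * (b̂ + ι 2)))
          (⇝-+ {x = α Defs.* ℤ⇒ℝ b Defs.+ ℤ⇒ℝ b} {p = α̂ * b̂ + b̂} {y = α} {q = α̂}
            (⇝-+ {x = α Defs.* ℤ⇒ℝ b} {p = α̂ * b̂} {y = ℤ⇒ℝ b} {q = b̂}
              (⇝-* {x = α} {p = α̂} {y = ℤ⇒ℝ b} {q = b̂} α⇝α̂ (⇝-const b̂)) (⇝-const b̂)) α⇝α̂))
        β⇝β̂ bound₁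
        where
        U V : ℝ
        U = [2b+4]/[2b+3] b Defs.* gauss b D Defs.* (ℤ⇒ℝ b Defs.+ ℕ⇒ℝ 2)
        V = α Defs.* ℤ⇒ℝ b Defs.+ ℤ⇒ℝ b Defs.+ α

      bound₂′ : φ * g D * ((b̂ + 1ℚ) * (b̂ * b̂ + b̂ + ι 2) - ι 3) ≤ β̂
      bound₂′ = ⇝-≤ {x = W} {p = φ * g D * ((b̂ + 1ℚ) * (b̂ * b̂ + b̂ + ι 2) - ι 3)} {y = β} {q = β̂}
        (⇝-const (φ * g D * ((b̂ + 1ℚ) * (b̂ * b̂ + b̂ + ι 2) - ι 3))) β⇝β̂ bound₂
        where
        W : ℝ
        W = [2b+4]/[2b+3] b Defs.* gauss b D Defs.* ((ℤ⇒ℝ b Defs.+ 1ℝ) Defs.* (ℤ⇒ℝ b Defs.* ℤ⇒ℝ b Defs.+ ℤ⇒ℝ b Defs.+ ℕ⇒ℝ 2) Defs.- ℕ⇒ℝ 3)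

      -- From `b ≥ 2` and `φ ≥ 1` one gets `φ (b + 2) ≥ 4`. Multiplying by `r μ` needs the sign of
      -- `μ`, which is supplied by the graph and is therefore an argument here.
      4rμ≤β : 0ℚ ≤ α̂ * b̂ + b̂ + α̂ → ι 4 * (g D * (α̂ * b̂ + b̂ + α̂)) ≤ β̂
      4rμ≤β μ≥0 = ≤-trans (≤-by
        (<⇒≤ r>0 ⊛ μ≥0 ⊛ (diff≥0 b̂≥2 ⊕ diff≥0 φ≥1 ⊛ (b≥0 ⊕ ι≥0 2)))
        (solve 4 (λ f r b m → f :* r :* (b :+ con (ι 2)) :* m := con (ι 4) :* (r :* m) :+
            r :* m :* ((b :- con (ι 2)) :+ (f :- con 1ℚ) :* (b :+ con (ι 2)))) refl φ (g D) b̂ (α̂ * b̂ + b̂ + α̂))) bound₁′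

      -- The value of `(b + 1)(b² + b + 2) - 3` at `b = 2` is 21, and its expansion at 2 has
      -- nonnegative coefficients: `21 + (b - 2)((b - 2)² + 8 (b - 2) + 23)`.
      21r≤β : ι 21 * g D ≤ β̂
      21r≤β = ≤-trans (≤-by
        (<⇒≤ r>0 ⊛ (b-2≥0 ⊛ w≥0 ⊕ diff≥0 φ≥1 ⊛ (ι≥0 21 ⊕ b-2≥0 ⊛ w≥0)))
        (solve 3 (λ f r b → f :* r :* ((b :+ con 1ℚ) :* (b :* b :+ b :+ con (ι 2)) :- con (ι 3)) := con (ι 21) :* r :+
            r :* ((b :- con (ι 2)) :* ((b :- con (ι 2)) :* (b :- con (ι 2)) :+ con (ι 8) :* (b :- con (ι 2)) :+ con (ι 23))
              :+ (f :- con 1ℚ) :* (con (ι 21) :+ (b :- con (ι 2)) :* ((b :- con (ι 2)) :* (b :- con (ι 2)) :+ con (ι 8) :* (b :- con (ι 2)) :+ con (ι 23)))))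
            refl φ (g D) b̂)) bound₂′
        where
        b-2≥0 : 0ℚ ≤ b̂ - ι 2
        b-2≥0 = diff≥0 b̂≥2
        w≥0 : 0ℚ ≤ (b̂ - ι 2) * (b̂ - ι 2) + ι 8 * (b̂ - ι 2) + ι 23
        w≥0 = sq≥0 (b̂ - ι 2) ⊕ ι≥0 8 ⊛ b-2≥0 ⊕ ι≥0 23

  -- The lines are Delsarte cliques

  ≡⇒≈ : ∀ {x y : ℝ} → (∀ n → seq x n ≡ seq y n) → x ≈ y
  ≡⇒≈ {x} {y} eq ε ε>0 = 0 , λ n _ → subst (_≤ ε)
    (sym (cong ∣_∣ (trans (cong (_- seq y n) (eq n)) (ℚ.+-inverseʳ (seq y n))))) (<⇒≤ ε>0)

  module _ (Γ : DistanceRegularGraph) where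

    open DistanceRegularGraph Γ
      using (diameter; bᵢ; cᵢ; graph; hasDiameter; valency; IsClique; IsDelsarteClique; IsGeometric)

    module Conclusion
      (b : ℤ) .{{_ : ℤ.NonZero (b ℤ.- + 1)}} (b≥2 : + 2 ℤ.≤ b) (3≤D : 3 ℕ.≤ diameter) (α β : ℝ)
      (b-formula : ∀ i → i ℕ.< diameter →
        ℕ⇒ℝ (bᵢ i) ≈ (gauss b diameter Defs.- gauss b i) Defs.* (β Defs.- α Defs.* gauss b i))
      (c-formula : ∀ i → i ℕ.< diameter →
        ℕ⇒ℝ (cᵢ (suc i)) ≈ gauss b (suc i) Defs.* (1ℝ Defs.+ α Defs.* gauss b i))
      (bound₁ : ([2b+4]/[2b+3] b Defs.* gauss b diameter Defs.* (ℤ⇒ℝ b Defs.+ ℕ⇒ℝ 2) Defs.*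
        (α Defs.* ℤ⇒ℝ b Defs.+ ℤ⇒ℝ b Defs.+ α)) Defs.≤ β)
      (bound₂ : ([2b+4]/[2b+3] b Defs.* gauss b diameter Defs.*
        ((ℤ⇒ℝ b Defs.+ 1ℝ) Defs.* (ℤ⇒ℝ b Defs.* ℤ⇒ℝ b Defs.+ ℤ⇒ℝ b Defs.+ ℕ⇒ℝ 2) Defs.- ℕ⇒ℝ 3)) Defs.≤ β)
      where

      open Gauss b b≥2
      open Limits b b≥2 diameter 3≤D bᵢ cᵢ α β b-formula c-formula
      open Distances Γ using (~⇒adj; adj⇒~)
      open RationalParameters Γ 3≤D b̂ α̂ β̂ b̂≥2 g g-zero g-suc b-formula′ c-formula′ (4rμ≤β bound₁ bound₂) (21r≤β bound₁ bound₂)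
        using (r; lines; line; line∈lines; x∈line; y∈line; line-unique; M; M-adj; size≡; valency≡; psd; Z; Z-diag; Z-eigen)
      open Eigenvalues graph using (eigenvector⇒eigenvalue; psd⇒eigenvalue≥)

      line-clique : ∀ {C} → C ∈ lines → IsClique C
      line-clique {C} C∈ {x} {y} x∈C y∈C x≢y = adj⇒~ (M-adj {Any.index C∈} (in-M x∈C) (in-M y∈C) x≢y)
        where
        in-M : ∀ {z} → z Subset.∈ C → M (Any.index C∈) z ≡ true
        in-M {z} z∈C = trans (cong (λ C → Vec.lookup C z) (sym (Any.lookup-index C∈))) (Vec.[]=⇒lookup z∈C)

      line-size : ∀ {C} → C ∈ lines → ι Subset.∣ C ∣ ≡ β̂ + 1ℚ
      line-size {C} C∈ = trans (∣∣≡∑ C) (trans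
        (∑-cong λ z → cong (λ C → 𝟙 (Vec.lookup C z)) (Any.lookup-index C∈)) (size≡ (Any.index C∈)))

      line-Delsarte : ∀ {C} → C ∈ lines → IsDelsarteClique C
      line-Delsarte {C} C∈ = (λ {x} {y} → line-clique C∈ {x} {y}) , ℚ⇒ℝ (- r)
        -- The column of `Z` at `x₀` attains `-r` and is nonzero by its diagonal entry; `psd`
        -- excludes anything smaller. The vertex `x₀` is taken from a pair realising the diameter.
        , (eigenvector⇒eigenvalue (- r) (λ x → Z x x₀) x₀ (Z-diag x₀) (λ x → Z-eigen x x₀) , psd⇒eigenvalue≥ r psd)
        , ≡⇒≈ {(ℕ⇒ℝ Subset.∣ C ∣ Defs.- 1ℝ) Defs.* (Defs.- ℚ⇒ℝ (- r))} {ℕ⇒ℝ valency} λ _ → begin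
            (ι Subset.∣ C ∣ - 1ℚ) * (- (- r))  ≡⟨ cong (λ e → (e - 1ℚ) * (- (- r))) (line-size C∈) ⟩
            (β̂ + 1ℚ - 1ℚ) * (- (- r))          ≡⟨ solve 2 (λ b r → (b :+ con 1ℚ :- con 1ℚ) :* (:- (:- r)) := r :* b) refl β̂ r ⟩
            r * β̂                              ≡⟨ valency≡ ⟨
            ι valency                          ∎
        where
        open ≡-Reasoning
        x₀ = proj₁ (proj₂ hasDiameter)

      geometric : IsGeometric
      geometric = (_∈ lines) , line-Delsarte , λ x~y → unique-line (~⇒adj x~y)
        where
        unique-line : ∀ {x y} (x~y : does (DistanceRegularGraph._~?_ Γ x y) ≡ true) →
          ∃! _≡_ λ C → C ∈ lines × x Subset.∈ C × y Subset.∈ C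
        unique-line {x} {y} x~y = line x~y
          , (line∈lines x~y , Vec.lookup⇒[]= x (line x~y) (x∈line x~y) , Vec.lookup⇒[]= y (line x~y) (y∈line x~y))
          , λ (C∈ , x∈C , y∈C) → line-unique x~y C∈ (Vec.[]=⇒lookup x∈C) (Vec.[]=⇒lookup y∈C)

open import Defs

theorem19 : (Γ : DistanceRegularGraph) (D : ℕ) (b : ℤ) .{{_ : ℤ.NonZero (b ℤ.- + 1)}} (α β : ℝ) →
    HasClassicalParameters b Γ D α β →
    + 2 ℤ.≤ b →
    3 ℕ.≤ D →
    let r = gauss b D
        b′ = ℤ⇒ℝ b
    in
    β ≥ ([2b+4]/[2b+3] b * r * (b′ + ℕ⇒ℝ 2) * (α * b′ + b′ + α))
        ⊔ ([2b+4]/[2b+3] b * r * ((b′ + 1ℝ) * (b′ * b′ + b′ + ℕ⇒ℝ 2) - ℕ⇒ℝ 3)) →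
    DistanceRegularGraph.IsGeometric Γ
theorem19 Γ D b α β record { diameter≡D = refl ; b-formula = b-formula ; c-formula = c-formula } b≥2 3≤D bound =
  Conclusion.geometric Γ b b≥2 3≤D α β b-formula (λ i i<D → c-formula (ℕ.suc i) (ℕ.s≤s ℕ.z≤n) i<D)
    (⊔-≤ˡ {x = X} {y = Y} {z = β} bound) (⊔-≤ʳ {x = X} {y = Y} {z = β} bound)
  where
  open Geometricity
  X Y : ℝ
  X = [2b+4]/[2b+3] b * gauss b D * (ℤ⇒ℝ b + ℕ⇒ℝ 2) * (α * ℤ⇒ℝ b + ℤ⇒ℝ b + α)
  Y = [2b+4]/[2b+3] b * gauss b D * ((ℤ⇒ℝ b + 1ℝ) * (ℤ⇒ℝ b * ℤ⇒ℝ b + ℤ⇒ℝ b + ℕ⇒ℝ 2) - ℕ⇒ℝ 3)
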